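{- The theory $\mathrm{RCA}_0^{\Omega}$ proves the equivalences $$(\exists^{2})^{\mathrm{st}}\leftrightarrow \Pi^0_1\text{ -TRANS}\leftrightarrow \mathrm{WKL}^{*}\leftrightarrow \text{E-UWKL}^{\mathrm{st}}.$$
   Context: BASE THEORY. Finite types: $0$ (natural numbers), $\sigma\to\tau$, and $\sigma^{*}$ (finite sequences of objects of type $\sigma$); $1=0\to 0$, $2=1\to 0$, $3=2\to 0$. Superscripts indicate types; tuples are coded as single objects where convenient. Equality $=_0$ is primitive; for $\tau=\tau_1\to\dots\to\tau_k\to 0$, $x=_\tau y$ means $(\forall z_1\dots z_k)(xz_1\dots z_k=_0 yz_1\dots z_k)$. $\mathrm{RCA}_0^{\omega}$ is Kohlenbach's higher-order base theory: classical arithmetic in all finite types with combinators, zero, successor, the recursor $R_0$ (primitive recursion with type $0$ values), quantifier-free induction, extensionality $x=_\rho y\to\varphi(x)=_\tau\varphi(y)$ for all $\varphi^{\rho\to\tau}$, and $\mathrm{QF\text{ - }AC}^{1,0}$, where $\mathrm{QF\text{ - }AC}^{\sigma,\tau}$ is $(\forall x^\sigma)(\exists y^\tau)A_0(x,y)\to(\exists F^{\sigma\to\tau})(\forall x)A_0(x,F(x))$ for quantifier-free $A_0$. $\mathrm{RCA}_0^{\Omega}$ extends $\mathrm{RCA}_0^{\omega}$ (with the types $\sigma^*$) by a predicate $\mathrm{st}$ ("is standard") for each type. A formula is internal if it does not contain $\mathrm{st}$; $(\forall^{\mathrm{st}}x)A$ is $(\forall x)(\mathrm{st}(x)\to A)$,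 $(\exists^{\mathrm{st}}x)A$ is $(\exists x)(\mathrm{st}(x)\wedge A)$; $N\in\Omega$ means $\neg\mathrm{st}(N^0)$. Axioms: (i) standardness respects equality, closed terms are standard, a standard functional applied to a standard object is standard, and numbers below a standard number are standard; (ii) Idealization: $(\forall^{\mathrm{st}}x^{\sigma^*})(\exists y^\tau)(\forall z\in x)\varphi(z,y)\to(\exists y)(\forall^{\mathrm{st}}z^{\sigma})\varphi(z,y)$ for internal $\varphi$; (iii) $\mathrm{HAC}_{\mathrm{int}}$: $(\forall^{\mathrm{st}}x^{\rho})(\exists^{\mathrm{st}}y^{\tau})\varphi(x,y)\to(\exists^{\mathrm{st}}\Phi^{\rho\to\tau^*})(\forall^{\mathrm{st}}x)(\exists y\in\Phi(x))\varphi(x,y)$ for internal $\varphi$; (iv) $\mathrm{PF\text{ - }TP}_\forall$: $(\forall^{\mathrm{st}}x^\tau)\varphi(x)\to(\forall x^\tau)\varphi(x)$ for internal $\varphi(x)$ with no parameters other than $x$; (v) for certain functionals uniquely specified by a parameter-free internal formula $D$ (e.g. the one in $(\exists^2)$), a constant $\Xi_0$ with the axiom $\mathrm{st}(\Xi_0)\wedge(\forall^{\mathrm{st}}\Xi)[D^{\mathrm{st}}(\Xi)\to \Xi_0$ and $\Xi$ agree on all standard inputs$]$; these constants do not count as parameters in (iv). NOTATION. $A^{\mathrm{st}}$ is $A$ with all quantifiers (except bounded number quantifiers) relativised to $\mathrm{st}$. For $\tau=\tau_1\to\dots\to\tau_k\to 0$, $x\approx_\tau y$ means $(\forall^{\mathrm{st}}z_1^{\tau_1}\dots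 z_k^{\tau_k})(xz_1\dots z_k=_0yz_1\dots z_k)$. $\overline{\beta}n$ is the (code of the) initial segment of $\beta^1$ of length $n$. "$T^1\leq_1 1$" means that $T$ represents a binary tree. If $\mathrm{AX}^{\mathrm{st}}$ is $(\exists^{\mathrm{st}}\Phi^{\rho\to\tau})A^{\mathrm{st}}(\Phi)$, then $\text{E-AX}^{\mathrm{st}}$ states that there is such a standard $\Phi$ which is moreover standard extensional: $(\forall^{\mathrm{st}}x^\rho,y^\rho)(x\approx_\rho y\to\Phi(x)\approx_\tau\Phi(y))$. PRINCIPLES. $(\exists^2)$: $(\exists\varphi^2)(\forall g^1)[(\exists x^0)g(x)=0\leftrightarrow\varphi(g)=0]$. $\Pi^0_1\text{ -TRANS}$: $(\forall^{\mathrm{st}}f^1)[(\forall^{\mathrm{st}}n^0)f(n)=0\to(\forall n^0)f(n)=0]$. $\mathrm{WKL}^*$: $(\forall^{\mathrm{st}}T^1\leq_1 1)[(\forall^{\mathrm{st}}n^0)(\exists^{\mathrm{st}}\beta^1)(\overline{\beta}n\in T)\to(\exists^{\mathrm{st}}\alpha^1)(\forall m^0)(\overline{\alpha}m\in T)]$. $\mathrm{UWKL}$: $(\exists\Phi^{1\to1})(\forall T^1\leq_1 1)[(\forall n^0)(\exists\beta^1)(\overline{\beta}n\in T)\to(\forall x^0)(\overline{\Phi(T)}x\in T)]$. -}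

module Defs where

open import Data.Empty using (⊥)
open import Data.List using (List; []; _∷_; map)
open import Data.List.Membership.Propositional using (_∈_)
open import Data.List.Relation.Unary.Any using (here; there)
open import Data.Maybe using (Maybe; just; nothing; zipWith; maybe′)
open import Data.Product using (_×_)
open import Data.Unit using (⊤)
open import Relation.Binary.PropositionalEquality using (refl)

infixr 20 _⇒_
infix  25 _*

data Ty : Set where
  nat : Ty
  _⇒_ : Ty → Ty → Ty
  _*  : Ty → Ty

𝟏 𝟐 : Ty
𝟏 = nat ⇒ nat
𝟐 = 𝟏 ⇒ nat

-- The most recently bound variable is at the head.
Ctx : Set
Ctx = List Ty

-- Constants beyond those of the base language.
record Signature : Set₁ where
  field
    Sym   : Set
    arity : Sym → Ty

open Signature

none : Signature
none = record { Sym = ⊥ ; arity = λ () }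

-- Sequences are governed by length, projection and formation:
-- seg f n is ⟨f 0, …, f (n-1)⟩.  The empty sequence, concatenation, etc. are
-- definable from these.  A list recursor with values of arbitrary type would
-- exceed the strength of R₀ (lists over nat would give all of Gödel's T).
data Con : Ty → Set where
  K    : ∀ σ τ   → Con (σ ⇒ τ ⇒ σ)
  S    : ∀ ρ σ τ → Con ((ρ ⇒ σ ⇒ τ) ⇒ (ρ ⇒ σ) ⇒ ρ ⇒ τ)
  zero : Con nat
  suc  : Con (nat ⇒ nat)
  R₀   : Con (nat ⇒ nat ⇒ (nat ⇒ nat ⇒ nat) ⇒ nat)
  len  : ∀ σ → Con (σ * ⇒ nat)
  at   : ∀ σ → Con (σ * ⇒ nat ⇒ σ)
  seg  : ∀ σ → Con ((nat ⇒ σ) ⇒ nat ⇒ σ *)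

infixl 30 _·_

data Term (L : Signature) (Γ : Ctx) : Ty → Set where
  var : ∀ {τ} → τ ∈ Γ → Term L Γ τ
  con : ∀ {τ} → Con τ → Term L Γ τ
  sym : (c : Sym L) → Term L Γ (arity L c)
  _·_ : ∀ {σ τ} → Term L Γ (σ ⇒ τ) → Term L Γ σ → Term L Γ τ

v0 : ∀ {L Γ σ} → Term L (σ ∷ Γ) σ
v0 = var (here refl)

v1 : ∀ {L Γ σ τ} → Term L (τ ∷ σ ∷ Γ) σ
v1 = var (there (here refl))

v2 : ∀ {L Γ ρ σ τ} → Term L (τ ∷ σ ∷ ρ ∷ Γ) ρ
v2 = var (there (there (here refl)))

Ren : Ctx → Ctx → Set
Ren Γ Δ = ∀ {τ} → τ ∈ Γ → τ ∈ Δ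

Sub : Signature → Ctx → Ctx → Set
Sub L Γ Δ = ∀ {τ} → τ ∈ Γ → Term L Δ τ

fromClosed : ∀ {Γ} → Ren [] Γ
fromClosed ()

extᴿ : ∀ {Γ Δ σ} → Ren Γ Δ → Ren (σ ∷ Γ) (σ ∷ Δ)
extᴿ r (here e)  = here e
extᴿ r (there x) = there (r x)

renᵗ : ∀ {L Γ Δ τ} → Ren Γ Δ → Term L Γ τ → Term L Δ τ
renᵗ r (var x) = var (r x)
renᵗ r (con c) = con c
renᵗ r (sym c) = sym c
renᵗ r (t · u) = renᵗ r t · renᵗ r u

wkᵗ : ∀ {L Γ σ τ} → Term L Γ τ → Term L (σ ∷ Γ) τ
wkᵗ = renᵗ there

extˢ : ∀ {L Γ Δ σ} → Sub L Γ Δ → Sub L (σ ∷ Γ) (σ ∷ Δ)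
extˢ s (here e)  = var (here e)
extˢ s (there x) = wkᵗ (s x)

subᵗ : ∀ {L Γ Δ τ} → Sub L Γ Δ → Term L Γ τ → Term L Δ τ
subᵗ s (var x) = s x
subᵗ s (con c) = con c
subᵗ s (sym c) = sym c
subᵗ s (t · u) = subᵗ s t · subᵗ s u

inst : ∀ {L Γ σ} → Term L Γ σ → Sub L (σ ∷ Γ) Γ
inst t (here refl) = t
inst t (there x)   = var x

-- Bracket abstraction.  Terms not containing the abstracted variable become
-- K t, which keeps the defined functionals below small.

strengthen : ∀ {L Γ σ τ} → Term L (σ ∷ Γ) τ → Maybe (Term L Γ τ)
strengthen (var (here _))  = nothing
strengthen (var (there x)) = just (var x)
strengthen (con c)         = just (con c)
strengthen (sym c)         = just (sym c)
strengthen (t · u)         = zipWith _·_ (strengthen t) (strengthen u)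

lam : ∀ {L Γ σ τ} → Term L (σ ∷ Γ) τ → Term L Γ (σ ⇒ τ)
lam {σ = σ} (var (here refl)) =
  con (S σ (σ ⇒ σ) σ) · con (K σ (σ ⇒ σ)) · con (K σ σ)
lam {σ = σ} {τ} (var (there x)) = con (K τ σ) · var x
lam {σ = σ} {τ} (con c)         = con (K τ σ) · con c
lam {σ = σ}     (sym c)         = con (K _ σ) · sym c
lam {σ = σ} {τ} (_·_ {ρ} t u)   =
  maybe′ (con (K τ σ) ·_)
         (con (S σ ρ τ) · lam t · lam u)
         (strengthen (t · u))

infixl 28 _∸_

num0 num1 : ∀ {L Γ} → Term L Γ nat
num0 = con zero
num1 = con suc · con zero

plus : ∀ {L Γ} → Term L Γ (nat ⇒ nat ⇒ nat)
plus = lam (lam (con R₀ · v0 · v1 · lam (lam (con suc · v1))))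

pred : ∀ {L Γ} → Term L Γ (nat ⇒ nat)
pred = lam (con R₀ · v0 · num0 · lam (lam v0))

monus : ∀ {L Γ} → Term L Γ (nat ⇒ nat ⇒ nat)
monus = lam (lam (con R₀ · v0 · v1 · lam (lam (pred · v1))))

_∸_ : ∀ {L Γ} → Term L Γ nat → Term L Γ nat → Term L Γ nat
t ∸ u = monus · t · u

-- Cantor's pairing: pair a b = (0 + 1 + … + (a + b)) + b.
triangle : ∀ {L Γ} → Term L Γ (nat ⇒ nat)
triangle = lam (con R₀ · v0 · num0 · lam (lam (plus · v1 · (con suc · v0))))

pair : ∀ {L Γ} → Term L Γ (nat ⇒ nat ⇒ nat)
pair = lam (lam (plus · (triangle · (plus · v1 · v0)) · v0))

-- Codes of finite sequences of numbers: the empty sequence is 0, and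
-- s followed by x is 1 + pair s x.  Every number codes exactly one sequence.
snoc : ∀ {L Γ} → Term L Γ (nat ⇒ nat ⇒ nat)
snoc = lam (lam (con suc · (pair · v1 · v0)))

-- initial · β · n is the code of ⟨β 0, …, β (n-1)⟩.
initial : ∀ {L Γ} → Term L Γ (𝟏 ⇒ nat ⇒ nat)
initial = lam (lam (con R₀ · v0 · num0 · lam (lam (snoc · v1 · (wkᵗ (wkᵗ v1) · v0)))))

infix  18 _≐₀_ _≐_ _≈_ _≤ᶠ_ _<ᶠ_ _∈ˢ_
infixr 16 _∧_
infixr 15 _∨_
infixr 14 _⊃_
infix  13 _⟺_

-- Bounded number quantifiers are primitive (all< t A is (∀x<t)A, with t
-- outside the scope of x) because relativisation to st leaves them alone.
data Formula (L : Signature) (Γ : Ctx) : Set where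
  _≐₀_     : Term L Γ nat → Term L Γ nat → Formula L Γ
  st       : ∀ {τ} → Term L Γ τ → Formula L Γ
  ⊥ᶠ       : Formula L Γ
  _∧_      : Formula L Γ → Formula L Γ → Formula L Γ
  _∨_      : Formula L Γ → Formula L Γ → Formula L Γ
  _⊃_      : Formula L Γ → Formula L Γ → Formula L Γ
  all      : ∀ σ → Formula L (σ ∷ Γ) → Formula L Γ
  ex       : ∀ σ → Formula L (σ ∷ Γ) → Formula L Γ
  all< ex< : Term L Γ nat → Formula L (nat ∷ Γ) → Formula L Γ

_⟺_ : ∀ {L Γ} → Formula L Γ → Formula L Γ → Formula L Γ
A ⟺ B = (A ⊃ B) ∧ (B ⊃ A)

¬ᶠ_ : ∀ {L Γ} → Formula L Γ → Formula L Γ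
¬ᶠ A = A ⊃ ⊥ᶠ

allˢᵗ exˢᵗ : ∀ {L Γ} σ → Formula L (σ ∷ Γ) → Formula L Γ
allˢᵗ σ A = all σ (st v0 ⊃ A)
exˢᵗ  σ A = ex  σ (st v0 ∧ A)

ren : ∀ {L Γ Δ} → Ren Γ Δ → Formula L Γ → Formula L Δ
ren r (t ≐₀ u)   = renᵗ r t ≐₀ renᵗ r u
ren r (st t)     = st (renᵗ r t)
ren r ⊥ᶠ         = ⊥ᶠ
ren r (A ∧ B)    = ren r A ∧ ren r B
ren r (A ∨ B)    = ren r A ∨ ren r B
ren r (A ⊃ B)    = ren r A ⊃ ren r B
ren r (all σ A)  = all σ (ren (extᴿ r) A)
ren r (ex σ A)   = ex σ (ren (extᴿ r) A)
ren r (all< t A) = all< (renᵗ r t) (ren (extᴿ r) A)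
ren r (ex< t A)  = ex< (renᵗ r t) (ren (extᴿ r) A)

wk : ∀ {L Γ σ} → Formula L Γ → Formula L (σ ∷ Γ)
wk = ren there

sub : ∀ {L Γ Δ} → Sub L Γ Δ → Formula L Γ → Formula L Δ
sub s (t ≐₀ u)   = subᵗ s t ≐₀ subᵗ s u
sub s (st t)     = st (subᵗ s t)
sub s ⊥ᶠ         = ⊥ᶠ
sub s (A ∧ B)    = sub s A ∧ sub s B
sub s (A ∨ B)    = sub s A ∨ sub s B
sub s (A ⊃ B)    = sub s A ⊃ sub s B
sub s (all σ A)  = all σ (sub (extˢ s) A)
sub s (ex σ A)   = ex σ (sub (extˢ s) A)
sub s (all< t A) = all< (subᵗ s t) (sub (extˢ s) A)
sub s (ex< t A)  = ex< (subᵗ s t) (sub (extˢ s) A)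

infix 19 _[_]

_[_] : ∀ {L Γ σ} → Formula L (σ ∷ Γ) → Term L Γ σ → Formula L Γ
A [ t ] = sub (inst t) A

Internal : ∀ {L Γ} → Formula L Γ → Set
Internal (t ≐₀ u)   = ⊤
Internal (st t)     = ⊥
Internal ⊥ᶠ         = ⊤
Internal (A ∧ B)    = Internal A × Internal B
Internal (A ∨ B)    = Internal A × Internal B
Internal (A ⊃ B)    = Internal A × Internal B
Internal (all σ A)  = Internal A
Internal (ex σ A)   = Internal A
Internal (all< t A) = Internal A
Internal (ex< t A)  = Internal A

-- Internal and without quantifiers of any kind.
QuantifierFree : ∀ {L Γ} → Formula L Γ → Set
QuantifierFree (t ≐₀ u)   = ⊤
QuantifierFree (st t)     = ⊥
QuantifierFree ⊥ᶠ         = ⊤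
QuantifierFree (A ∧ B)    = QuantifierFree A × QuantifierFree B
QuantifierFree (A ∨ B)    = QuantifierFree A × QuantifierFree B
QuantifierFree (A ⊃ B)    = QuantifierFree A × QuantifierFree B
QuantifierFree (all σ A)  = ⊥
QuantifierFree (ex σ A)   = ⊥
QuantifierFree (all< t A) = ⊥
QuantifierFree (ex< t A)  = ⊥

infix 26 _ˢᵗ

_ˢᵗ : ∀ {L Γ} → Formula L Γ → Formula L Γ
(t ≐₀ u)   ˢᵗ = t ≐₀ u
(st t)     ˢᵗ = st t
⊥ᶠ         ˢᵗ = ⊥ᶠ
(A ∧ B)    ˢᵗ = A ˢᵗ ∧ B ˢᵗ
(A ∨ B)    ˢᵗ = A ˢᵗ ∨ B ˢᵗ
(A ⊃ B)    ˢᵗ = A ˢᵗ ⊃ B ˢᵗ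
(all σ A)  ˢᵗ = allˢᵗ σ (A ˢᵗ)
(ex σ A)   ˢᵗ = exˢᵗ σ (A ˢᵗ)
(all< t A) ˢᵗ = all< t (A ˢᵗ)
(ex< t A)  ˢᵗ = ex< t (A ˢᵗ)

_≐_ : ∀ {L Γ τ} → Term L Γ τ → Term L Γ τ → Formula L Γ
_≐_ {τ = nat}   t u = t ≐₀ u
_≐_ {τ = σ ⇒ τ} t u = all σ (wkᵗ t · v0 ≐ wkᵗ u · v0)
_≐_ {τ = σ *}   t u =
  (con (len σ) · t ≐₀ con (len σ) · u)
  ∧ all< (con (len σ) · t) (con (at σ) · wkᵗ t · v0 ≐ con (at σ) · wkᵗ u · v0)

-- (∀ˢᵗ z₁ … zₖ) (t z₁ … zₖ =₀ u z₁ … zₖ) at types σ₁ ⇒ … ⇒ σₖ ⇒ nat.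
_≈_ : ∀ {L Γ τ} → Term L Γ τ → Term L Γ τ → Formula L Γ
t ≈ u = (t ≐ u) ˢᵗ

_≤ᶠ_ _<ᶠ_ : ∀ {L Γ} → Term L Γ nat → Term L Γ nat → Formula L Γ
t ≤ᶠ u = t ∸ u ≐₀ num0
t <ᶠ u = con suc · t ≤ᶠ u

_∈ˢ_ : ∀ {L Γ σ} → Term L Γ σ → Term L Γ (σ *) → Formula L Γ
_∈ˢ_ {σ = σ} z s = ex< (con (len σ) · s) (con (at σ) · wkᵗ s · v0 ≐ wkᵗ z)

Axioms : Signature → Set₁
Axioms L = ∀ {Γ} → Formula L Γ → Set

infix 10 _∣_⊢_

data _∣_⊢_ {L : Signature} (T : Axioms L) {Γ : Ctx} (Δ : List (Formula L Γ))
         : Formula L Γ → Set where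
  axiom : ∀ {A} → T A → T ∣ Δ ⊢ A
  hyp   : ∀ {A} → A ∈ Δ → T ∣ Δ ⊢ A
  raa   : ∀ {A} → T ∣ (¬ᶠ A) ∷ Δ ⊢ ⊥ᶠ → T ∣ Δ ⊢ A
  ⊃I    : ∀ {A B} → T ∣ A ∷ Δ ⊢ B → T ∣ Δ ⊢ A ⊃ B
  ⊃E    : ∀ {A B} → T ∣ Δ ⊢ A ⊃ B → T ∣ Δ ⊢ A → T ∣ Δ ⊢ B
  ∧I    : ∀ {A B} → T ∣ Δ ⊢ A → T ∣ Δ ⊢ B → T ∣ Δ ⊢ A ∧ B
  ∧E₁   : ∀ {A B} → T ∣ Δ ⊢ A ∧ B → T ∣ Δ ⊢ A
  ∧E₂   : ∀ {A B} → T ∣ Δ ⊢ A ∧ B → T ∣ Δ ⊢ B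
  ∨I₁   : ∀ {A B} → T ∣ Δ ⊢ A → T ∣ Δ ⊢ A ∨ B
  ∨I₂   : ∀ {A B} → T ∣ Δ ⊢ B → T ∣ Δ ⊢ A ∨ B
  ∨E    : ∀ {A B C} → T ∣ Δ ⊢ A ∨ B → T ∣ A ∷ Δ ⊢ C → T ∣ B ∷ Δ ⊢ C → T ∣ Δ ⊢ C
  allI  : ∀ {σ A} → T ∣ map wk Δ ⊢ A → T ∣ Δ ⊢ all σ A
  allE  : ∀ {σ A} → T ∣ Δ ⊢ all σ A → (t : Term L Γ σ) → T ∣ Δ ⊢ A [ t ]
  exI   : ∀ {σ A} → (t : Term L Γ σ) → T ∣ Δ ⊢ A [ t ] → T ∣ Δ ⊢ ex σ A
  exE   : ∀ {σ A C} → T ∣ Δ ⊢ ex σ A → T ∣ A ∷ map wk Δ ⊢ wk C → T ∣ Δ ⊢ C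

infix 10 _⊢_

_⊢_ : ∀ {L} → Axioms L → Formula L [] → Set
T ⊢ A = T ∣ [] ⊢ A

-- A(x, y) becomes A(x, F x), with F added below x.
choose : ∀ {L Γ σ τ} → Sub L (τ ∷ σ ∷ Γ) (σ ∷ (σ ⇒ τ) ∷ Γ)
choose (here refl)         = v1 · v0
choose (there (here refl)) = v0
choose (there (there x))   = var (there (there x))

successor : ∀ {L Γ} → Sub L (nat ∷ Γ) (nat ∷ Γ)
successor (here refl) = con suc · v0
successor (there x)   = var (there x)

-- No axiom here mentions st: in RCA₀ω it is an uninterpreted predicate.
data RCA₀ω {L : Signature} {Γ : Ctx} : Formula L Γ → Set where
  eq-refl  : (t : Term L Γ nat) → RCA₀ω (t ≐₀ t)
  eq-sym   : (t u : Term L Γ nat) → RCA₀ω (t ≐₀ u ⊃ u ≐₀ t)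
  eq-trans : (t u v : Term L Γ nat) → RCA₀ω (t ≐₀ u ⊃ u ≐₀ v ⊃ t ≐₀ v)
  ext      : ∀ {ρ τ} (f : Term L Γ (ρ ⇒ τ)) (t u : Term L Γ ρ) →
             RCA₀ω (t ≐ u ⊃ f · t ≐ f · u)
  K-eq     : ∀ {σ τ} (t : Term L Γ σ) (u : Term L Γ τ) →
             RCA₀ω (con (K σ τ) · t · u ≐ t)
  S-eq     : ∀ {ρ σ τ} (t : Term L Γ (ρ ⇒ σ ⇒ τ)) (u : Term L Γ (ρ ⇒ σ))
             (v : Term L Γ ρ) → RCA₀ω (con (S ρ σ τ) · t · u · v ≐ t · v · (u · v))
  suc≢zero : (t : Term L Γ nat) → RCA₀ω (¬ᶠ (con suc · t ≐₀ con zero))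
  suc-inj  : (t u : Term L Γ nat) → RCA₀ω (con suc · t ≐₀ con suc · u ⊃ t ≐₀ u)
  R₀-zero  : (t : Term L Γ nat) (f : Term L Γ (nat ⇒ nat ⇒ nat)) →
             RCA₀ω (con R₀ · con zero · t · f ≐₀ t)
  R₀-suc   : (n t : Term L Γ nat) (f : Term L Γ (nat ⇒ nat ⇒ nat)) →
             RCA₀ω (con R₀ · (con suc · n) · t · f ≐₀ f · (con R₀ · n · t · f) · n)
  len-seg  : ∀ {σ} (f : Term L Γ (nat ⇒ σ)) (n : Term L Γ nat) →
             RCA₀ω (con (len σ) · (con (seg σ) · f · n) ≐₀ n)
  at-seg   : ∀ {σ} (f : Term L Γ (nat ⇒ σ)) (n i : Term L Γ nat) →
             RCA₀ω (i <ᶠ n ⊃ con (at σ) · (con (seg σ) · f · n) · i ≐ f · i)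
  bounded∀ : (t : Term L Γ nat) (A : Formula L (nat ∷ Γ)) →
             RCA₀ω (all< t A ⟺ all nat (v0 <ᶠ wkᵗ t ⊃ A))
  bounded∃ : (t : Term L Γ nat) (A : Formula L (nat ∷ Γ)) →
             RCA₀ω (ex< t A ⟺ ex nat (v0 <ᶠ wkᵗ t ∧ A))
  QF-IND   : (A : Formula L (nat ∷ Γ)) → QuantifierFree A →
             RCA₀ω (A [ con zero ] ∧ all nat (A ⊃ sub successor A) ⊃ all nat A)
  QF-AC¹⁰  : (A : Formula L (nat ∷ 𝟏 ∷ Γ)) → QuantifierFree A →
             RCA₀ω (all 𝟏 (ex nat A) ⊃ ex (𝟏 ⇒ nat) (all 𝟏 (sub choose A)))

∃²-matrix : ∀ {L} → Formula L (𝟐 ∷ [])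
∃²-matrix = all 𝟏 (ex nat (v1 · v0 ≐₀ num0) ⟺ v1 · v0 ≐₀ num0)

-- ∃²-matrix alone leaves the nonzero values open, so it does not specify a
-- unique functional (two standard solutions would refute the axiom `constant`
-- below); the usual normalisation to values 0, 1 does.
∃²-spec : ∀ {L} → Formula L (𝟐 ∷ [])
∃²-spec = ∃²-matrix ∧ all 𝟏 (v1 · v0 ≤ᶠ num1)

-- A choice of further functionals, each uniquely specified by a parameter-free
-- internal formula; the one of (∃²) is always included, see `Functional`.
record Specifications : Set₁ where
  field
    Index    : Set
    type     : Index → Ty
    spec     : (i : Index) → Formula none (type i ∷ [])
    internal : ∀ i → Internal (spec i)
    unique   : ∀ i → RCA₀ω ⊢
               all (type i) (all (type i)
                 (wk (spec i) ⊃ ren (extᴿ fromClosed) (spec i) ⊃ v1 ≐ v0))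

module _ (𝒮 : Specifications) where
  open Specifications 𝒮

  data Functional : Set where
    exists² : Functional
    further : Index → Functional

  functionalType : Functional → Ty
  functionalType exists²     = 𝟐
  functionalType (further i) = type i

  functionalSpec : (c : Functional) → Formula none (functionalType c ∷ [])
  functionalSpec exists²     = ∃²-spec
  functionalSpec (further i) = spec i

  language : Signature
  language = record { Sym = Functional ; arity = functionalType }

liftᵗ : ∀ {L Γ τ} → Term none Γ τ → Term L Γ τ
liftᵗ (var x) = var x
liftᵗ (con c) = con c
liftᵗ (t · u) = liftᵗ t · liftᵗ u

lift : ∀ {L Γ} → Formula none Γ → Formula L Γ
lift (t ≐₀ u)   = liftᵗ t ≐₀ liftᵗ u
lift (st t)     = st (liftᵗ t)
lift ⊥ᶠ         = ⊥ᶠ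
lift (A ∧ B)    = lift A ∧ lift B
lift (A ∨ B)    = lift A ∨ lift B
lift (A ⊃ B)    = lift A ⊃ lift B
lift (all σ A)  = all σ (lift A)
lift (ex σ A)   = ex σ (lift A)
lift (all< t A) = all< (liftᵗ t) (lift A)
lift (ex< t A)  = ex< (liftᵗ t) (lift A)

data RCA₀Ω (𝒮 : Specifications) {Γ : Ctx} : Formula (language 𝒮) Γ → Set where
  base        : ∀ {A} → RCA₀ω A → RCA₀Ω 𝒮 A

  st-resp     : ∀ {τ} (t u : Term _ Γ τ) → RCA₀Ω 𝒮 (st t ⊃ t ≐ u ⊃ st u)
  st-closed   : ∀ {τ} (t : Term (language 𝒮) [] τ) →
                RCA₀Ω 𝒮 (st (renᵗ fromClosed t))
  st-app      : ∀ {σ τ} (f : Term _ Γ (σ ⇒ τ)) (t : Term _ Γ σ) →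
                RCA₀Ω 𝒮 (st f ⊃ st t ⊃ st (f · t))
  st-below    : (t u : Term _ Γ nat) → RCA₀Ω 𝒮 (st u ⊃ t ≤ᶠ u ⊃ st t)

  -- φ(z, y), possibly with parameters; `z` is the last variable bound.
  idealize    : ∀ {σ τ} (φ : Formula (language 𝒮) (σ ∷ τ ∷ Γ)) → Internal φ →
                RCA₀Ω 𝒮
                  (allˢᵗ (σ *) (ex τ (all σ (v0 ∈ˢ v2 ⊃ ren (extᴿ (extᴿ there)) φ)))
                   ⊃ ex τ (allˢᵗ σ φ))

  -- φ(x, y), possibly with parameters; `y` is the last variable bound.
  HAC-int     : ∀ {ρ τ} (φ : Formula (language 𝒮) (τ ∷ ρ ∷ Γ)) → Internal φ →
                RCA₀Ω 𝒮
                  (allˢᵗ ρ (exˢᵗ τ φ)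
                   ⊃ exˢᵗ (ρ ⇒ τ *) (allˢᵗ ρ
                       (ex τ (v0 ∈ˢ v2 · v1 ∧ ren (extᴿ (extᴿ there)) φ))))

  PF-TP∀      : ∀ {τ} (φ : Formula (language 𝒮) (τ ∷ [])) → Internal φ →
                RCA₀Ω 𝒮 (ren fromClosed (allˢᵗ τ φ ⊃ all τ φ))

  constant    : (c : Functional 𝒮) →
                RCA₀Ω 𝒮 (ren fromClosed
                  (st (sym c)
                   ∧ allˢᵗ _ (lift (functionalSpec 𝒮 c) ˢᵗ ⊃ sym c ≈ v0)))

-- For AX of the form (∃Φ)A(Φ), the formula E-AXˢᵗ, given A.
E-st : ∀ {L Γ ρ τ} → Formula L ((ρ ⇒ τ) ∷ Γ) → Formula L Γ
E-st {ρ = ρ} A =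
  exˢᵗ _ (A ˢᵗ ∧ allˢᵗ ρ (allˢᵗ ρ (v1 ≈ v0 ⊃ v2 · v1 ≈ v2 · v0)))

∃² : ∀ {L} → Formula L []
∃² = ex 𝟐 ∃²-matrix

Π⁰₁-TRANS : ∀ {L} → Formula L []
Π⁰₁-TRANS =
  allˢᵗ 𝟏 (allˢᵗ nat (v1 · v0 ≐₀ num0) ⊃ all nat (v1 · v0 ≐₀ num0))

-- A 0/1-valued T represents the set of (codes of) sequences on which it is 0.
infix 18 _‾_∈ᵀ_

_‾_∈ᵀ_ : ∀ {L Γ} → Term L Γ 𝟏 → Term L Γ nat → Term L Γ 𝟏 → Formula L Γ
β ‾ n ∈ᵀ T = T · (initial · β · n) ≐₀ num0

-- T ≤₁ 1: T is 0/1-valued and the set it represents is closed under removal of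
-- the last entry (hence under initial segments) and has only entries 0 and 1.
BinaryTree : ∀ {L Γ} → Term L Γ 𝟏 → Formula L Γ
BinaryTree T =
  all nat (wkᵗ T · v0 ≤ᶠ num1)
  ∧ all nat (all nat
      (wkᵗ (wkᵗ T) · (snoc · v1 · v0) ≐₀ num0
       ⊃ wkᵗ (wkᵗ T) · v1 ≐₀ num0 ∧ v0 ≤ᶠ num1))

WKL* : ∀ {L} → Formula L []
WKL* =
  allˢᵗ 𝟏 (BinaryTree v0
    ⊃ allˢᵗ nat (exˢᵗ 𝟏 (v0 ‾ v1 ∈ᵀ v2))
    ⊃ exˢᵗ 𝟏 (all nat (v1 ‾ v0 ∈ᵀ v2)))

UWKL-matrix : ∀ {L} → Formula L ((𝟏 ⇒ 𝟏) ∷ [])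
UWKL-matrix =
  all 𝟏 (BinaryTree v0
    ⊃ all nat (ex 𝟏 (v0 ‾ v1 ∈ᵀ v2))
    ⊃ all nat ((v2 · v1) ‾ v0 ∈ᵀ v1))

E-UWKLˢᵗ : ∀ {L} → Formula L []
E-UWKLˢᵗ = E-st UWKL-matrix

{-# OPTIONS --safe #-}

-- All functionals needed are closed terms; naming them is a conservative
-- definitional extension.
--
-- (∃²)ˢᵗ → Π⁰₁-TRANS.  A standard witness of (∃²)ˢᵗ, normalised to the values 0, 1,
-- agrees on standard inputs with the constant Ξ for ∃².  Hence g x = 0 → Ξ g = 0 for
-- standard g and x, and by PF-TP∀ for all of them.  So an arbitrary zero of a
-- standard g yields Ξ g = 0, and thereby a standard zero.
--
-- Π⁰₁-TRANS → (∃²)ˢᵗ.  By transfer, every standard g with a zero has a standard one;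
-- HAC-int bounds it by a finite standard list Φ g, which can be searched.
--
-- Π⁰₁-TRANS → WKL*, E-UWKLˢᵗ.  Two applications of the functional φ of (∃²)ˢᵗ decide
-- whether a node of a standard tree is extended by nodes of every standard length
-- (finite 0/1-sequences being enumerated by their binary codes), and the
-- leftmost path through such nodes is primitive recursive in φ and the tree.
-- Transfer puts the entire path into the tree, and turns agreement of trees at
-- standard arguments into equality.
--
-- WKL* → Π⁰₁-TRANS.  Apply WKL* to the zero sequences, cut off at the first i
-- with f i ≠ 0: the path forces f to vanish everywhere.
--
-- E-UWKLˢᵗ → (∃²)ˢᵗ (Grilliot's trick).  Let i be the first entry of the path which Φ
-- finds in the tree of all constant 0/1-sequences.  Cut the branch of i off at the
-- first zero of g: then Φ still answers i on the tree for g if and only if g has no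
-- standard zero, by standard extensionality in one direction.

module Submission where

open import Defs
open import Data.Fin using (fromℕ<)
open import Data.List using (List; []; _∷_; length; lookup; map)
open import Data.List.Properties using (map-cong; map-∘)
open import Data.List.Membership.Propositional using (_∈_)
open import Data.List.Membership.Propositional.Properties using (∈-lookup; ∈-map⁺)
open import Data.List.Relation.Binary.Subset.Propositional using (_⊆_)
open import Data.List.Relation.Binary.Subset.Propositional.Properties using (∷⁺ʳ; map⁺)
open import Data.List.Relation.Unary.Any using (here; there)
open import Data.Maybe using (just; nothing)
open import Data.Nat using (ℕ; zero; suc; _<?_)
open import Data.Product using (_×_; _,_; proj₁; proj₂)
open import Data.Sum using (_⊎_; inj₁; inj₂)
open import Data.Unit using (tt)
open import Relation.Binary.PropositionalEquality
  using (_≡_; refl; cong; cong₂; subst; trans; module ≡-Reasoning)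
  renaming (sym to ≡-sym)
open import Relation.Nullary.Decidable using (True; toWitness)

private variable
  L : Signature
  Γ Γ₁ Γ₂ Γ₃ : Ctx
  σ τ ρ σ₁ σ₂ σ₃ σ₄ σ₅ σ₆ : Ty

-- Substitution

infixl 5 _▸_

ε : Sub L [] Γ
ε ()

-- Substitutions are listed as environments `ε ▸ t ▸ u`, at which a lemma proved for variables is
-- instantiated.
_▸_ : Sub L Γ Γ₁ → Term L Γ₁ σ → Sub L (σ ∷ Γ) Γ₁
(s ▸ t) (here refl) = t
(s ▸ t) (there x)   = s x

infix 4 _≗ˢ_

_≗ˢ_ : Sub L Γ Γ₁ → Sub L Γ Γ₁ → Set
_≗ˢ_ {Γ = Γ} s s′ = ∀ {τ} (x : τ ∈ Γ) → s x ≡ s′ x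

sub-congᵗ : {s s′ : Sub L Γ Γ₁} → s ≗ˢ s′ → (t : Term L Γ τ) → subᵗ s t ≡ subᵗ s′ t
sub-congᵗ e (var x) = e x
sub-congᵗ e (con c) = refl
sub-congᵗ e (sym c) = refl
sub-congᵗ e (t · u) = cong₂ _·_ (sub-congᵗ e t) (sub-congᵗ e u)

renᵗ≡subᵗ : (r : Ren Γ Γ₁) (t : Term L Γ τ) → renᵗ r t ≡ subᵗ (λ x → var (r x)) t
renᵗ≡subᵗ r (var x) = refl
renᵗ≡subᵗ r (con c) = refl
renᵗ≡subᵗ r (sym c) = refl
renᵗ≡subᵗ r (t · u) = cong₂ _·_ (renᵗ≡subᵗ r t) (renᵗ≡subᵗ r u)

sub-renᵗ : (s : Sub L Γ₁ Γ₂) (r : Ren Γ Γ₁) (t : Term L Γ τ) →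
           subᵗ s (renᵗ r t) ≡ subᵗ (λ x → s (r x)) t
sub-renᵗ s r (var x) = refl
sub-renᵗ s r (con c) = refl
sub-renᵗ s r (sym c) = refl
sub-renᵗ s r (t · u) = cong₂ _·_ (sub-renᵗ s r t) (sub-renᵗ s r u)

ren-subᵗ : (r : Ren Γ₁ Γ₂) (s : Sub L Γ Γ₁) (t : Term L Γ τ) →
           renᵗ r (subᵗ s t) ≡ subᵗ (λ x → renᵗ r (s x)) t
ren-subᵗ r s (var x) = refl
ren-subᵗ r s (con c) = refl
ren-subᵗ r s (sym c) = refl
ren-subᵗ r s (t · u) = cong₂ _·_ (ren-subᵗ r s t) (ren-subᵗ r s u)

sub-subᵗ : (s′ : Sub L Γ₁ Γ₂) (s : Sub L Γ Γ₁) (t : Term L Γ τ) →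
           subᵗ s′ (subᵗ s t) ≡ subᵗ (λ x → subᵗ s′ (s x)) t
sub-subᵗ s′ s (var x) = refl
sub-subᵗ s′ s (con c) = refl
sub-subᵗ s′ s (sym c) = refl
sub-subᵗ s′ s (t · u) = cong₂ _·_ (sub-subᵗ s′ s t) (sub-subᵗ s′ s u)

sub-idᵗ : (t : Term L Γ τ) → subᵗ var t ≡ t
sub-idᵗ (var x) = refl
sub-idᵗ (con c) = refl
sub-idᵗ (sym c) = refl
sub-idᵗ (t · u) = cong₂ _·_ (sub-idᵗ t) (sub-idᵗ u)

inst-wkᵗ : (u : Term L Γ σ) (t : Term L Γ τ) → subᵗ (inst u) (wkᵗ t) ≡ t
inst-wkᵗ u t = trans (sub-renᵗ (inst u) there t) (sub-idᵗ t)

ext-wkᵗ : (s : Sub L Γ Γ₁) (t : Term L Γ τ) →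
          subᵗ (extˢ {σ = σ} s) (wkᵗ t) ≡ wkᵗ (subᵗ s t)
ext-wkᵗ s t = trans (sub-renᵗ (extˢ s) there t) (≡-sym (ren-subᵗ there s t))

ext-cong : {s s′ : Sub L Γ Γ₁} → s ≗ˢ s′ → extˢ {σ = σ} s ≗ˢ extˢ s′
ext-cong e (here _)  = refl
ext-cong e (there x) = cong wkᵗ (e x)

ext-ren : (r : Ren Γ Γ₁) → (λ {τ} x → var {L} {τ = τ} (extᴿ {σ = σ} r x)) ≗ˢ extˢ (λ x → var (r x))
ext-ren r (here _)  = refl
ext-ren r (there x) = refl

ext-sub : (s′ : Sub L Γ₁ Γ₂) (s : Sub L Γ Γ₁) →
          (λ {τ} x → subᵗ {τ = τ} (extˢ {σ = σ} s′) (extˢ s x)) ≗ˢ extˢ (λ x → subᵗ s′ (s x))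
ext-sub s′ s (here _)  = refl
ext-sub s′ s (there x) = ext-wkᵗ s′ (s x)

ext-var : extˢ {L} {Γ} {Γ} {σ} var ≗ˢ var
ext-var (here _)  = refl
ext-var (there x) = refl

sub-cong : {s s′ : Sub L Γ Γ₁} → s ≗ˢ s′ → (A : Formula L Γ) → sub s A ≡ sub s′ A
sub-cong e (t ≐₀ u)   = cong₂ _≐₀_ (sub-congᵗ e t) (sub-congᵗ e u)
sub-cong e (st t)     = cong st (sub-congᵗ e t)
sub-cong e ⊥ᶠ         = refl
sub-cong e (A ∧ B)    = cong₂ _∧_ (sub-cong e A) (sub-cong e B)
sub-cong e (A ∨ B)    = cong₂ _∨_ (sub-cong e A) (sub-cong e B)
sub-cong e (A ⊃ B)    = cong₂ _⊃_ (sub-cong e A) (sub-cong e B)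
sub-cong e (all σ A)  = cong (all σ) (sub-cong (ext-cong e) A)
sub-cong e (ex σ A)   = cong (ex σ) (sub-cong (ext-cong e) A)
sub-cong e (all< t A) = cong₂ all< (sub-congᵗ e t) (sub-cong (ext-cong e) A)
sub-cong e (ex< t A)  = cong₂ ex< (sub-congᵗ e t) (sub-cong (ext-cong e) A)

ren≡sub : (r : Ren Γ Γ₁) (A : Formula L Γ) → ren r A ≡ sub (λ x → var (r x)) A
ren≡sub r (t ≐₀ u)   = cong₂ _≐₀_ (renᵗ≡subᵗ r t) (renᵗ≡subᵗ r u)
ren≡sub r (st t)     = cong st (renᵗ≡subᵗ r t)
ren≡sub r ⊥ᶠ         = refl
ren≡sub r (A ∧ B)    = cong₂ _∧_ (ren≡sub r A) (ren≡sub r B)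
ren≡sub r (A ∨ B)    = cong₂ _∨_ (ren≡sub r A) (ren≡sub r B)
ren≡sub r (A ⊃ B)    = cong₂ _⊃_ (ren≡sub r A) (ren≡sub r B)
ren≡sub r (all σ A)  = cong (all σ) (trans (ren≡sub (extᴿ r) A) (sub-cong (ext-ren r) A))
ren≡sub r (ex σ A)   = cong (ex σ) (trans (ren≡sub (extᴿ r) A) (sub-cong (ext-ren r) A))
ren≡sub r (all< t A) = cong₂ all< (renᵗ≡subᵗ r t) (trans (ren≡sub (extᴿ r) A) (sub-cong (ext-ren r) A))
ren≡sub r (ex< t A)  = cong₂ ex< (renᵗ≡subᵗ r t) (trans (ren≡sub (extᴿ r) A) (sub-cong (ext-ren r) A))

sub-sub : (s′ : Sub L Γ₁ Γ₂) (s : Sub L Γ Γ₁) (A : Formula L Γ) →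
          sub s′ (sub s A) ≡ sub (λ x → subᵗ s′ (s x)) A
sub-sub s′ s (t ≐₀ u)   = cong₂ _≐₀_ (sub-subᵗ s′ s t) (sub-subᵗ s′ s u)
sub-sub s′ s (st t)     = cong st (sub-subᵗ s′ s t)
sub-sub s′ s ⊥ᶠ         = refl
sub-sub s′ s (A ∧ B)    = cong₂ _∧_ (sub-sub s′ s A) (sub-sub s′ s B)
sub-sub s′ s (A ∨ B)    = cong₂ _∨_ (sub-sub s′ s A) (sub-sub s′ s B)
sub-sub s′ s (A ⊃ B)    = cong₂ _⊃_ (sub-sub s′ s A) (sub-sub s′ s B)
sub-sub s′ s (all σ A)  = cong (all σ) (trans (sub-sub (extˢ s′) (extˢ s) A) (sub-cong (ext-sub s′ s) A))
sub-sub s′ s (ex σ A)   = cong (ex σ) (trans (sub-sub (extˢ s′) (extˢ s) A) (sub-cong (ext-sub s′ s) A))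
sub-sub s′ s (all< t A) =
  cong₂ all< (sub-subᵗ s′ s t) (trans (sub-sub (extˢ s′) (extˢ s) A) (sub-cong (ext-sub s′ s) A))
sub-sub s′ s (ex< t A)  =
  cong₂ ex< (sub-subᵗ s′ s t) (trans (sub-sub (extˢ s′) (extˢ s) A) (sub-cong (ext-sub s′ s) A))

sub-id : (A : Formula L Γ) → sub var A ≡ A
sub-id (t ≐₀ u)   = cong₂ _≐₀_ (sub-idᵗ t) (sub-idᵗ u)
sub-id (st t)     = cong st (sub-idᵗ t)
sub-id ⊥ᶠ         = refl
sub-id (A ∧ B)    = cong₂ _∧_ (sub-id A) (sub-id B)
sub-id (A ∨ B)    = cong₂ _∨_ (sub-id A) (sub-id B)
sub-id (A ⊃ B)    = cong₂ _⊃_ (sub-id A) (sub-id B)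
sub-id (all σ A)  = cong (all σ) (trans (sub-cong ext-var A) (sub-id A))
sub-id (ex σ A)   = cong (ex σ) (trans (sub-cong ext-var A) (sub-id A))
sub-id (all< t A) = cong₂ all< (sub-idᵗ t) (trans (sub-cong ext-var A) (sub-id A))
sub-id (ex< t A)  = cong₂ ex< (sub-idᵗ t) (trans (sub-cong ext-var A) (sub-id A))

-- Saves repeated inductions on formulas: commutation laws such as `sub-inst` and `sub-choose`
-- reduce to a check on variables.
sub-square : {s₂ : Sub L Γ₁ Γ₃} {s₁ : Sub L Γ Γ₁} {s₂′ : Sub L Γ₂ Γ₃} {s₁′ : Sub L Γ Γ₂} →
             (∀ {τ} (x : τ ∈ Γ) → subᵗ s₂ (s₁ x) ≡ subᵗ s₂′ (s₁′ x)) →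
             (A : Formula L Γ) → sub s₂ (sub s₁ A) ≡ sub s₂′ (sub s₁′ A)
sub-square {s₂ = s₂} {s₁} {s₂′} {s₁′} e A =
  trans (sub-sub s₂ s₁ A) (trans (sub-cong e A) (≡-sym (sub-sub s₂′ s₁′ A)))

sub-ren : (s : Sub L Γ₁ Γ₂) (r : Ren Γ Γ₁) (A : Formula L Γ) →
          sub s (ren r A) ≡ sub (λ x → s (r x)) A
sub-ren s r A = trans (cong (sub s) (ren≡sub r A)) (sub-sub s _ A)

ren-sub : (r : Ren Γ₁ Γ₂) (s : Sub L Γ Γ₁) (A : Formula L Γ) →
          ren r (sub s A) ≡ sub (λ x → renᵗ r (s x)) A
ren-sub r s A =
  trans (ren≡sub r (sub s A))
        (trans (sub-sub _ s A) (sub-cong (λ x → ≡-sym (renᵗ≡subᵗ r (s x))) A))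

sub-ren-square : {s : Sub L Γ₁ Γ₃} {r : Ren Γ Γ₁} {r′ : Ren Γ₂ Γ₃} {s′ : Sub L Γ Γ₂} →
                 (∀ {τ} (x : τ ∈ Γ) → s (r x) ≡ renᵗ r′ (s′ x)) →
                 (A : Formula L Γ) → sub s (ren r A) ≡ ren r′ (sub s′ A)
sub-ren-square {s = s} {r} {r′} {s′} e A =
  trans (sub-ren s r A) (trans (sub-cong e A) (≡-sym (ren-sub r′ s′ A)))

ext-wk : (s : Sub L Γ Γ₁) (A : Formula L Γ) → sub (extˢ {σ = σ} s) (wk A) ≡ wk (sub s A)
ext-wk s A = sub-ren-square (λ _ → refl) A

sub-inst : (s : Sub L Γ Γ₁) (A : Formula L (σ ∷ Γ)) (t : Term L Γ σ) →
           sub s (A [ t ]) ≡ sub (extˢ s) A [ subᵗ s t ]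
sub-inst s A t = sub-square (λ { (here refl) → refl ; (there x) → ≡-sym (inst-wkᵗ _ (s x)) }) A

sub-successor : (s : Sub L Γ Γ₁) (A : Formula L (nat ∷ Γ)) →
                sub (extˢ s) (sub successor A) ≡ sub successor (sub (extˢ s) A)
sub-successor s A = sub-square
  (λ { (here refl) → refl
     ; (there x) → trans (renᵗ≡subᵗ there (s x)) (≡-sym (sub-renᵗ successor there (s x))) }) A

sub-choose : (s : Sub L Γ Γ₁) (A : Formula L (τ ∷ σ ∷ Γ)) →
             sub (extˢ (extˢ s)) (sub choose A) ≡ sub choose (sub (extˢ (extˢ s)) A)
sub-choose s A = sub-square
  (λ { (here refl) → refl ; (there (here refl)) → refl
     ; (there (there x)) →
         trans (cong wkᵗ (renᵗ≡subᵗ there (s x)))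
          (trans (ren-subᵗ there _ (s x))
           (≡-sym (trans (sub-renᵗ choose there (wkᵗ (s x))) (sub-renᵗ _ there (s x))))) }) A

-- The renaming is the one in `idealize` and `HAC-int`, which makes room for a variable below the
-- two bound in the scheme. Both schemes are thereby closed under substitution.
sub-insert : (s : Sub L Γ Γ₁) (A : Formula L (τ ∷ σ ∷ Γ)) →
             sub (extˢ (extˢ (extˢ {σ = ρ} s))) (ren (extᴿ (extᴿ there)) A)
             ≡ ren (extᴿ (extᴿ there)) (sub (extˢ (extˢ s)) A)
sub-insert s A = sub-ren-square
  (λ { (here refl) → refl ; (there (here refl)) → refl
     ; (there (there x)) → begin
         wkᵗ (wkᵗ (wkᵗ (s x)))  ≡⟨ cong wkᵗ (cong wkᵗ (renᵗ≡subᵗ there (s x))) ⟩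
         wkᵗ (wkᵗ (subᵗ (λ y → var (there y)) (s x))) ≡⟨ cong wkᵗ (ren-subᵗ there _ (s x)) ⟩
         wkᵗ (subᵗ (λ y → var (there (there y))) (s x)) ≡⟨ ren-subᵗ there _ (s x) ⟩
         subᵗ (λ y → var (there (there (there y)))) (s x) ≡⟨ ≡-sym (sub-renᵗ _ there (s x)) ⟩
         subᵗ (λ y → var (there (extᴿ there y))) (wkᵗ (s x)) ≡⟨ ≡-sym (sub-renᵗ _ there (wkᵗ (s x))) ⟩
         subᵗ (λ y → var (extᴿ (extᴿ there) y)) (wkᵗ (wkᵗ (s x))) ≡⟨ ≡-sym (renᵗ≡subᵗ _ (wkᵗ (wkᵗ (s x)))) ⟩
         renᵗ (extᴿ (extᴿ there)) (wkᵗ (wkᵗ (s x))) ∎ }) A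
  where open ≡-Reasoning

sub-closed : (s : Sub L Γ Γ₁) (A : Formula L []) → sub s (ren fromClosed A) ≡ ren fromClosed A
sub-closed s A =
  trans (sub-ren s fromClosed A) (trans (sub-cong (λ ()) A) (≡-sym (ren≡sub fromClosed A)))

sub-closedᵗ : (s : Sub L Γ Γ₁) (t : Term L [] τ) → subᵗ s (renᵗ fromClosed t) ≡ renᵗ fromClosed t
sub-closedᵗ s t =
  trans (sub-renᵗ s fromClosed t) (trans (sub-congᵗ (λ ()) t) (≡-sym (renᵗ≡subᵗ fromClosed t)))

sub-≐ : (s : Sub L Γ Γ₁) (t u : Term L Γ τ) → sub s (t ≐ u) ≡ (subᵗ s t ≐ subᵗ s u)
sub-≐ {τ = nat} s t u = refl
sub-≐ {τ = σ ⇒ τ} s t u =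
  cong (all σ) (trans (sub-≐ (extˢ s) (wkᵗ t · v0) (wkᵗ u · v0))
    (cong₂ (λ t′ u′ → t′ · v0 ≐ u′ · v0) (ext-wkᵗ s t) (ext-wkᵗ s u)))
sub-≐ {τ = σ *} s t u =
  cong (λ B → (con (len σ) · subᵗ s t ≐₀ con (len σ) · subᵗ s u) ∧ all< (con (len σ) · subᵗ s t) B)
    (trans (sub-≐ (extˢ s) (con (at σ) · wkᵗ t · v0) (con (at σ) · wkᵗ u · v0))
      (cong₂ (λ t′ u′ → con (at σ) · t′ · v0 ≐ con (at σ) · u′ · v0) (ext-wkᵗ s t) (ext-wkᵗ s u)))

sub-∈ˢ : (s : Sub L Γ Γ₁) (t : Term L Γ τ) (u : Term L Γ (τ *)) →
         sub s (t ∈ˢ u) ≡ (subᵗ s t ∈ˢ subᵗ s u)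
sub-∈ˢ {τ = τ} s t u =
  cong (ex< _) (trans (sub-≐ (extˢ s) (con (at τ) · wkᵗ u · v0) (wkᵗ t))
    (cong₂ (λ t′ u′ → con (at τ) · u′ · v0 ≐ t′) (ext-wkᵗ s t) (ext-wkᵗ s u)))

sub-internal : (s : Sub L Γ Γ₁) (A : Formula L Γ) → Internal A → Internal (sub s A)
sub-internal s (t ≐₀ u)   _       = tt
sub-internal s ⊥ᶠ         _       = tt
sub-internal s (A ∧ B)    (a , b) = sub-internal s A a , sub-internal s B b
sub-internal s (A ∨ B)    (a , b) = sub-internal s A a , sub-internal s B b
sub-internal s (A ⊃ B)    (a , b) = sub-internal s A a , sub-internal s B b
sub-internal s (all σ A)  a       = sub-internal (extˢ s) A a
sub-internal s (ex σ A)   a       = sub-internal (extˢ s) A a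
sub-internal s (all< t A) a       = sub-internal (extˢ s) A a
sub-internal s (ex< t A)  a       = sub-internal (extˢ s) A a

sub-quantifierFree : (s : Sub L Γ Γ₁) (A : Formula L Γ) → QuantifierFree A → QuantifierFree (sub s A)
sub-quantifierFree s (t ≐₀ u)   _       = tt
sub-quantifierFree s ⊥ᶠ         _       = tt
sub-quantifierFree s (A ∧ B)    (a , b) = sub-quantifierFree s A a , sub-quantifierFree s B b
sub-quantifierFree s (A ∨ B)    (a , b) = sub-quantifierFree s A a , sub-quantifierFree s B b
sub-quantifierFree s (A ⊃ B)    (a , b) = sub-quantifierFree s A a , sub-quantifierFree s B b

strengthen-wk : (t : Term L (σ ∷ Γ) τ) {u : Term L Γ τ} → strengthen t ≡ just u → t ≡ wkᵗ u
strengthen-wk (var (there x)) refl = refl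
strengthen-wk (con c) refl = refl
strengthen-wk (sym c) refl = refl
strengthen-wk (t · u) eq with strengthen t in p | strengthen u in q
strengthen-wk (t · u) refl | just t′ | just u′ = cong₂ _·_ (strengthen-wk t p) (strengthen-wk u q)

-- Reflexivity, weakening and substitution in derivations

module _ {T : Axioms L} where

  -- The theory is arbitrary because reflexivity is used both in `RCA₀Ω` and in its definitional
  -- extension.
  ≐-reflexive : (∀ {Γ} {A : Formula L Γ} → RCA₀ω A → T A) →
                ∀ {Γ} {Δ : List (Formula L Γ)} (t : Term L Γ τ) → T ∣ Δ ⊢ t ≐ t
  ≐-reflexive {τ = nat} ω t = axiom (ω (eq-refl t))
  ≐-reflexive {τ = σ ⇒ τ} ω t = allI (≐-reflexive ω _)
  ≐-reflexive {τ = σ *} ω t = ∧I (axiom (ω (eq-refl _)))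
    (⊃E (∧E₂ (axiom (ω (bounded∀ _ _)))) (allI (⊃I (≐-reflexive ω _))))

  weaken : ∀ {Γ} {Δ Δ′ : List (Formula L Γ)} {A} → Δ ⊆ Δ′ → T ∣ Δ ⊢ A → T ∣ Δ′ ⊢ A
  weaken f (axiom a)     = axiom a
  weaken f (hyp x)       = hyp (f x)
  weaken f (raa d)       = raa (weaken (∷⁺ʳ _ f) d)
  weaken f (⊃I d)        = ⊃I (weaken (∷⁺ʳ _ f) d)
  weaken f (⊃E d e)      = ⊃E (weaken f d) (weaken f e)
  weaken f (∧I d e)      = ∧I (weaken f d) (weaken f e)
  weaken f (∧E₁ d)       = ∧E₁ (weaken f d)
  weaken f (∧E₂ d)       = ∧E₂ (weaken f d)
  weaken f (∨I₁ d)       = ∨I₁ (weaken f d)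
  weaken f (∨I₂ d)       = ∨I₂ (weaken f d)
  weaken f (∨E d e e′)   = ∨E (weaken f d) (weaken (∷⁺ʳ _ f) e) (weaken (∷⁺ʳ _ f) e′)
  weaken f (allI d)      = allI (weaken (map⁺ wk f) d)
  weaken f (allE d t)    = allE (weaken f d) t
  weaken f (exI t d)     = exI t (weaken f d)
  weaken f (exE d e)     = exE (weaken f d) (weaken (∷⁺ʳ _ (map⁺ wk f)) e)

  module _ (closed : ∀ {Γ Γ₁} (s : Sub L Γ Γ₁) {A} → T A → T (sub s A)) where

    private
      map-ext-wk : ∀ {Γ Γ₁} (s : Sub L Γ Γ₁) (Δ : List (Formula L Γ)) →
                   map (sub (extˢ {σ = σ} s)) (map wk Δ) ≡ map wk (map (sub s) Δ)
      map-ext-wk s Δ =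
        trans (≡-sym (map-∘ Δ)) (trans (map-cong (ext-wk s) Δ) (map-∘ Δ))

    -- The quantifier rules weaken the hypotheses, so the substitution must commute with `wk` on
    -- whole lists of hypotheses.
    substitute : ∀ {Γ Γ₁} {Δ : List (Formula L Γ)} {A} (s : Sub L Γ Γ₁) →
                 T ∣ Δ ⊢ A → T ∣ map (sub s) Δ ⊢ sub s A
    substitute s (axiom a)   = axiom (closed s a)
    substitute s (hyp x)     = hyp (∈-map⁺ (sub s) x)
    substitute s (raa d)     = raa (substitute s d)
    substitute s (⊃I d)      = ⊃I (substitute s d)
    substitute s (⊃E d e)    = ⊃E (substitute s d) (substitute s e)
    substitute s (∧I d e)    = ∧I (substitute s d) (substitute s e)
    substitute s (∧E₁ d)     = ∧E₁ (substitute s d)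
    substitute s (∧E₂ d)     = ∧E₂ (substitute s d)
    substitute s (∨I₁ d)     = ∨I₁ (substitute s d)
    substitute s (∨I₂ d)     = ∨I₂ (substitute s d)
    substitute s (∨E d e e′) = ∨E (substitute s d) (substitute s e) (substitute s e′)
    substitute s (allI {A = A} d) =
      allI (subst (λ Δ → T ∣ Δ ⊢ sub (extˢ s) A) (map-ext-wk s _) (substitute (extˢ s) d))
    substitute s (allE {A = A} d t) =
      subst (T ∣ _ ⊢_) (≡-sym (sub-inst s A t)) (allE (substitute s d) (subᵗ s t))
    substitute s (exI {A = A} t d) =
      exI (subᵗ s t) (subst (T ∣ _ ⊢_) (sub-inst s A t) (substitute s d))
    substitute s (exE {A = A} {C} d e) =
      exE (substitute s d)
        (subst (λ Δ → T ∣ sub (extˢ s) A ∷ Δ ⊢ wk (sub s C)) (map-ext-wk s _)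
          (subst (T ∣ _ ⊢_) (ext-wk s C) (substitute (extˢ s) e)))

-- Every axiom is a scheme, so a substituted instance is again an instance. Rewriting is needed
-- where a scheme uses defined operations such as `≐` or weakening.
RCA₀ω-closed : ∀ {Γ Γ₁} (s : Sub L Γ Γ₁) {A} → RCA₀ω A → RCA₀ω (sub s A)
RCA₀ω-closed s (eq-refl t)      = eq-refl _
RCA₀ω-closed s (eq-sym t u)     = eq-sym _ _
RCA₀ω-closed s (eq-trans t u v) = eq-trans _ _ _
RCA₀ω-closed s (ext f t u)
  rewrite sub-≐ s t u | sub-≐ s (f · t) (f · u) = ext _ _ _
RCA₀ω-closed s (K-eq {σ} {τ} t u) rewrite sub-≐ s (con (K σ τ) · t · u) t = K-eq _ _
RCA₀ω-closed s (S-eq {ρ} {σ} {τ} t u v)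
  rewrite sub-≐ s (con (S ρ σ τ) · t · u · v) (t · v · (u · v)) = S-eq _ _ _
RCA₀ω-closed s (suc≢zero t)     = suc≢zero _
RCA₀ω-closed s (suc-inj t u)    = suc-inj _ _
RCA₀ω-closed s (R₀-zero t f)    = R₀-zero _ _
RCA₀ω-closed s (R₀-suc n t f)   = R₀-suc _ _ _
RCA₀ω-closed s (len-seg f n)    = len-seg _ _
RCA₀ω-closed s (at-seg {σ} f n i)
  rewrite sub-≐ s (con (at σ) · (con (seg σ) · f · n) · i) (f · i) = at-seg _ _ _
RCA₀ω-closed s (bounded∀ t A) rewrite ext-wkᵗ {σ = nat} s t = bounded∀ _ _
RCA₀ω-closed s (bounded∃ t A) rewrite ext-wkᵗ {σ = nat} s t = bounded∃ _ _
RCA₀ω-closed s (QF-IND A q)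
  rewrite sub-inst s A (con zero) | sub-successor s A =
  QF-IND _ (sub-quantifierFree (extˢ s) A q)
RCA₀ω-closed s (QF-AC¹⁰ A q)
  rewrite sub-choose s A = QF-AC¹⁰ _ (sub-quantifierFree (extˢ (extˢ s)) A q)

RCA₀Ω-closed : ∀ {𝒮 Γ Γ₁} (s : Sub (language 𝒮) Γ Γ₁) {A} → RCA₀Ω 𝒮 A → RCA₀Ω 𝒮 (sub s A)
RCA₀Ω-closed s (base a)       = base (RCA₀ω-closed s a)
RCA₀Ω-closed s (st-resp t u) rewrite sub-≐ s t u = st-resp _ _
RCA₀Ω-closed s (st-closed t) rewrite sub-closedᵗ s t = st-closed t
RCA₀Ω-closed s (st-app f t)   = st-app _ _
RCA₀Ω-closed s (st-below t u) = st-below _ _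
RCA₀Ω-closed s (idealize {σ} {τ} φ i)
  rewrite sub-insert {ρ = σ *} s φ
        | sub-∈ˢ (extˢ (extˢ (extˢ s))) (v0 {Γ = τ ∷ σ * ∷ _} {σ}) v2 =
  idealize _ (sub-internal (extˢ (extˢ s)) φ i)
RCA₀Ω-closed s (HAC-int {ρ} {τ} φ i)
  rewrite sub-insert {ρ = ρ ⇒ τ *} s φ
        | sub-∈ˢ (extˢ (extˢ (extˢ s))) (v0 {Γ = ρ ∷ (ρ ⇒ τ *) ∷ _} {τ}) (v2 · v1) =
  HAC-int _ (sub-internal (extˢ (extˢ s)) φ i)
RCA₀Ω-closed {𝒮} s (PF-TP∀ {τ} φ i) =
  subst (RCA₀Ω 𝒮) (≡-sym (sub-closed s (allˢᵗ τ φ ⊃ all τ φ))) (PF-TP∀ φ i)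
RCA₀Ω-closed {𝒮} s (constant c) =
  subst (RCA₀Ω 𝒮) (≡-sym (sub-closed s _)) (constant c)

-- Names for the closed terms

data Name : Set where
  plusᴺ triangleᴺ pairᴺ snocᴺ initialᴺ iteᴺ searchᴺ sumᴺ : Name
  parityᴺ halfᴺ doubleᴺ shiftᴺ codeᴺ bitsᴺ testᴺ nodeᴺ pathᴺ : Name
  probeᴺ isConstantᴺ treeᴺ branch₀ᴺ branch₁ᴺ : Name

nameType : Name → Ty
nameType plusᴺ       = nat ⇒ nat ⇒ nat
nameType triangleᴺ   = 𝟏
nameType pairᴺ       = nat ⇒ nat ⇒ nat
nameType snocᴺ       = nat ⇒ nat ⇒ nat
nameType initialᴺ    = 𝟏 ⇒ nat ⇒ nat
nameType iteᴺ        = nat ⇒ nat ⇒ nat ⇒ nat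
nameType searchᴺ     = 𝟏 ⇒ nat ⇒ nat
nameType sumᴺ        = 𝟏 ⇒ nat ⇒ nat
nameType parityᴺ     = 𝟏
nameType halfᴺ       = 𝟏
nameType doubleᴺ     = 𝟏
nameType shiftᴺ      = nat ⇒ nat ⇒ nat
nameType codeᴺ       = 𝟏 ⇒ nat ⇒ nat
nameType bitsᴺ       = nat ⇒ nat ⇒ 𝟏
nameType testᴺ       = 𝟏 ⇒ nat ⇒ nat ⇒ nat ⇒ 𝟏
nameType nodeᴺ       = (𝟏 ⇒ nat ⇒ nat ⇒ nat) ⇒ 𝟏 ⇒ 𝟏
nameType pathᴺ       = (𝟏 ⇒ nat ⇒ nat ⇒ nat) ⇒ 𝟏 ⇒ 𝟏
nameType probeᴺ      = nat ⇒ nat ⇒ 𝟏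
nameType isConstantᴺ = nat ⇒ 𝟏
nameType treeᴺ       = 𝟏 ⇒ 𝟏 ⇒ 𝟏
nameType branch₀ᴺ    = nat ⇒ 𝟏 ⇒ 𝟏
nameType branch₁ᴺ    = nat ⇒ 𝟏 ⇒ 𝟏

-- The definitional extension of the language by the named functionals.  As
-- symbols they stay put, and stay small, under substitution.
module _ (𝒮 : Specifications) where

  extendedArity : Functional 𝒮 ⊎ Name → Ty
  extendedArity (inj₁ c) = functionalType 𝒮 c
  extendedArity (inj₂ c) = nameType c

  extended : Signature
  extended = record { Sym = Functional 𝒮 ⊎ Name ; arity = extendedArity }

module Terms (𝒮 : Specifications) where

  Tm : Ctx → Ty → Set
  Tm = Term (extended 𝒮)

  Fm : Ctx → Set
  Fm = Formula (extended 𝒮)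

  Hyps : Ctx → Set
  Hyps Γ = List (Fm Γ)

  v3 : Tm (σ₁ ∷ σ₂ ∷ σ₃ ∷ σ₄ ∷ Γ) σ₄
  v3 = wkᵗ v2

  v4 : Tm (σ₁ ∷ σ₂ ∷ σ₃ ∷ σ₄ ∷ σ₅ ∷ Γ) σ₅
  v4 = wkᵗ v3

  v5 : Tm (σ₁ ∷ σ₂ ∷ σ₃ ∷ σ₄ ∷ σ₅ ∷ σ₆ ∷ Γ) σ₆
  v5 = wkᵗ v4

  ⌜_⌝ : (c : Name) → Tm Γ (nameType c)
  ⌜ c ⌝ = sym (inj₂ c)

  infixl 29 _⊕_

  _⊕_ : Tm Γ nat → Tm Γ nat → Tm Γ nat
  t ⊕ u = ⌜ plusᴺ ⌝ · t · u

  S′ : Tm Γ nat → Tm Γ nat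
  S′ t = con suc · t

  triangle⁺ parity half double : Tm Γ 𝟏
  triangle⁺ = ⌜ triangleᴺ ⌝
  parity   = ⌜ parityᴺ ⌝
  half     = ⌜ halfᴺ ⌝
  double   = ⌜ doubleᴺ ⌝

  pair⁺ snoc⁺ shift : Tm Γ (nat ⇒ nat ⇒ nat)
  pair⁺  = ⌜ pairᴺ ⌝
  snoc⁺  = ⌜ snocᴺ ⌝
  shift = ⌜ shiftᴺ ⌝

  initial⁺ search sum code : Tm Γ (𝟏 ⇒ nat ⇒ nat)
  initial⁺ = ⌜ initialᴺ ⌝
  search  = ⌜ searchᴺ ⌝
  sum     = ⌜ sumᴺ ⌝
  code    = ⌜ codeᴺ ⌝

  ite : Tm Γ (nat ⇒ nat ⇒ nat ⇒ nat)
  ite = ⌜ iteᴺ ⌝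

  bits probe : Tm Γ (nat ⇒ nat ⇒ 𝟏)
  bits  = ⌜ bitsᴺ ⌝
  probe = ⌜ probeᴺ ⌝

  test : Tm Γ (𝟏 ⇒ nat ⇒ nat ⇒ nat ⇒ 𝟏)
  test = ⌜ testᴺ ⌝

  node path : Tm Γ ((𝟏 ⇒ nat ⇒ nat ⇒ nat) ⇒ 𝟏 ⇒ 𝟏)
  node = ⌜ nodeᴺ ⌝
  path = ⌜ pathᴺ ⌝

  isConstant : Tm Γ (nat ⇒ 𝟏)
  isConstant = ⌜ isConstantᴺ ⌝

  tree : Tm Γ (𝟏 ⇒ 𝟏 ⇒ 𝟏)
  tree = ⌜ treeᴺ ⌝

  branch₀ branch₁ : Tm Γ (nat ⇒ 𝟏 ⇒ 𝟏)
  branch₀ = ⌜ branch₀ᴺ ⌝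
  branch₁ = ⌜ branch₁ᴺ ⌝

  sg not : Tm Γ nat → Tm Γ nat
  sg t  = ite · t · num0 · num1
  not t = num1 ∸ t

  dist : Tm Γ nat → Tm Γ nat → Tm Γ nat
  dist t u = (t ∸ u) ⊕ (u ∸ t)

  const : Tm Γ nat → Tm Γ 𝟏
  const b = con (K nat nat) · b

  infix 18 _‾_∈⁺_

  -- The mark `⁺` is put on copies of the notions of the theorem in which names replace closed terms
  -- such as `initial`. Expanding the names gives the originals back.
  _‾_∈⁺_ : Tm Γ 𝟏 → Tm Γ nat → Tm Γ 𝟏 → Fm Γ
  β ‾ n ∈⁺ T = T · (initial⁺ · β · n) ≐₀ num0

  BinaryTree⁺ : Tm Γ 𝟏 → Fm Γ
  BinaryTree⁺ T =
    all nat (wkᵗ T · v0 ≤ᶠ num1)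
    ∧ all nat (all nat
        (wkᵗ (wkᵗ T) · (snoc⁺ · v1 · v0) ≐₀ num0
         ⊃ wkᵗ (wkᵗ T) · v1 ≐₀ num0 ∧ v0 ≤ᶠ num1))

  WKL*⁺ : Fm []
  WKL*⁺ =
    allˢᵗ 𝟏 (BinaryTree⁺ v0
      ⊃ allˢᵗ nat (exˢᵗ 𝟏 (v0 ‾ v1 ∈⁺ v2))
      ⊃ exˢᵗ 𝟏 (all nat (v1 ‾ v0 ∈⁺ v2)))

  UWKL-matrix⁺ : Fm ((𝟏 ⇒ 𝟏) ∷ [])
  UWKL-matrix⁺ =
    all 𝟏 (BinaryTree⁺ v0
      ⊃ all nat (ex 𝟏 (v0 ‾ v1 ∈⁺ v2))
      ⊃ all nat ((v2 · v1) ‾ v0 ∈⁺ v1))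

  E-UWKLˢᵗ⁺ : Fm []
  E-UWKLˢᵗ⁺ = E-st UWKL-matrix⁺

  plusBody pairBody snocBody shiftBody isConstantBody : Tm (nat ∷ nat ∷ []) nat
  triangleBody parityBody halfBody doubleBody : Tm (nat ∷ []) nat
  initialBody searchBody sumBody codeBody : Tm (nat ∷ 𝟏 ∷ []) nat
  iteBody bitsBody probeBody : Tm (nat ∷ nat ∷ nat ∷ []) nat
  testBody : Tm (nat ∷ nat ∷ nat ∷ nat ∷ 𝟏 ∷ []) nat
  nodeBody pathBody : Tm (nat ∷ 𝟏 ∷ (𝟏 ⇒ nat ⇒ nat ⇒ nat) ∷ []) nat
  treeBody : Tm (nat ∷ 𝟏 ∷ 𝟏 ∷ []) nat
  branch₀Body branch₁Body : Tm (nat ∷ 𝟏 ∷ nat ∷ []) nat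

  plusBody     = con R₀ · v0 · v1 · lam (lam (S′ v1))
  triangleBody = con R₀ · v0 · num0 · lam (lam (v1 ⊕ S′ v0))
  pairBody     = triangle⁺ · (v1 ⊕ v0) ⊕ v0
  snocBody     = S′ (pair⁺ · v1 · v0)
  initialBody  = con R₀ · v0 · num0 · lam (lam (snoc⁺ · v1 · (v3 · v0)))

  -- ite · c · t · u is t if c = 0, and u otherwise.
  iteBody = con R₀ · v2 · v1 · lam (lam v2)

  -- The largest i < n with f i = 0, if there is one.
  searchBody = con R₀ · v0 · num0 · lam (lam (ite · (v3 · v0) · v0 · v1))

  sumBody    = con R₀ · v0 · num0 · lam (lam (v1 ⊕ v3 · v0))
  parityBody = con R₀ · v0 · num0 · lam (lam (not v1))
  halfBody   = con R₀ · v0 · num0 · lam (lam (v1 ⊕ parity · v0))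
  doubleBody = con R₀ · v0 · num0 · lam (lam (S′ (S′ v1)))
  shiftBody  = con R₀ · v0 · v1 · lam (lam (half · v1))

  -- The binary number β 0 … β (n-1), the last entry being the least significant.
  codeBody =
    con R₀ · v0 · num0 · lam (lam (ite · (v3 · v0) · (double · v1) · S′ (double · v1)))

  -- bits · n inverts code: the entries i < n of bits · n · j are the last n
  -- binary digits of j.
  bitsBody = parity · (shift · v1 · (v2 ∸ S′ v0))

  -- A zero j of test · T · n · s · k codes a node of T of length n whose initial
  -- segment of length k is s.
  testBody = v4 · (initial⁺ · (bits · v3 · v0) · v3) ⊕ dist (initial⁺ · (bits · v3 · v0) · v1) v2

  -- `M · T · s · k` is to be zero when the node `s` of length `k` is mortal. The next entry is 0 if
  -- the child with entry 0 is immortal, and 1 otherwise; children have length `S′ k`.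
  nodeBody = con R₀ · v0 · num0 · lam (lam (snoc⁺ · v1 · not (v4 · v3 · (snoc⁺ · v1 · num0) · S′ v0)))
  pathBody = not (v2 · v1 · (snoc⁺ · (node · v2 · v1 · v0) · num0) · S′ v0)

  -- A zero of `probe · b · s` is a length at which the constant sequence of entries `b` has the
  -- code `s`.
  probeBody = dist (initial⁺ · const v2 · v0) v1

  -- isConstant · b · s = 0 if and only if s codes ⟨b, …, b⟩.
  isConstantBody = probe · v1 · v0 · (search · (probe · v1 · v0) · S′ v0)

  -- The constant 0/1-sequences; those with entries b are cut off at a length
  -- determined by the first nonzero value of f_b.
  treeBody = ite · (isConstant · num0 · v0 ⊕ sum · v2 · v0) · num0
                 · sg (isConstant · num1 · v0 ⊕ sum · v1 · v0)

  -- Only the branch with entries `i` is cut off: `not` is nonzero exactly at the zeros of `g`. The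
  -- other branch gets the zero sequence and stays infinite.
  branch₀Body = ite · v2 · not (v1 · v0) · num0
  branch₁Body = ite · v2 · num0 · not (v1 · v0)

  definition : (c : Name) → Tm [] (nameType c)
  definition plusᴺ       = lam (lam plusBody)
  definition triangleᴺ   = lam triangleBody
  definition pairᴺ       = lam (lam pairBody)
  definition snocᴺ       = lam (lam snocBody)
  definition initialᴺ    = lam (lam initialBody)
  definition iteᴺ        = lam (lam (lam iteBody))
  definition searchᴺ     = lam (lam searchBody)
  definition sumᴺ        = lam (lam sumBody)
  definition parityᴺ     = lam parityBody
  definition halfᴺ       = lam halfBody
  definition doubleᴺ     = lam doubleBody
  definition shiftᴺ      = lam (lam shiftBody)
  definition codeᴺ       = lam (lam codeBody)
  definition bitsᴺ       = lam (lam (lam bitsBody))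
  definition testᴺ       = lam (lam (lam (lam (lam testBody))))
  definition nodeᴺ       = lam (lam (lam nodeBody))
  definition pathᴺ       = lam (lam (lam pathBody))
  definition probeᴺ      = lam (lam (lam probeBody))
  definition isConstantᴺ = lam (lam isConstantBody)
  definition treeᴺ       = lam (lam (lam treeBody))
  definition branch₀ᴺ    = lam (lam (lam branch₀Body))
  definition branch₁ᴺ    = lam (lam (lam branch₁Body))

  -- Expansion of the names, and conservativity

  default : ∀ τ → Term (language 𝒮) [] τ
  default nat     = con zero
  default (σ ⇒ τ) = con (K τ σ) · default τ
  default (σ *)   = con (seg σ) · (con (K σ nat) · default σ) · con zero

  -- The first argument bounds the depth of the unfolding of definitions (8 is
  -- enough, see `depth-suffices`); names beyond that depth become `default`.
  expandᵗ′ : ℕ → Tm Γ τ → Term (language 𝒮) Γ τ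
  expandᵗ′ n       (var x)        = var x
  expandᵗ′ n       (con c)        = con c
  expandᵗ′ n       (sym (inj₁ c)) = sym c
  expandᵗ′ zero    (sym (inj₂ c)) = renᵗ fromClosed (default (nameType c))
  expandᵗ′ (suc n) (sym (inj₂ c)) = renᵗ fromClosed (expandᵗ′ n (definition c))
  expandᵗ′ n       (t · u)        = expandᵗ′ n t · expandᵗ′ n u

  expandᵗ : Tm Γ τ → Term (language 𝒮) Γ τ
  expandᵗ = expandᵗ′ 8

  expand : Fm Γ → Formula (language 𝒮) Γ
  expand (t ≐₀ u)   = expandᵗ t ≐₀ expandᵗ u
  expand (st t)     = st (expandᵗ t)
  expand ⊥ᶠ         = ⊥ᶠ
  expand (A ∧ B)    = expand A ∧ expand B
  expand (A ∨ B)    = expand A ∨ expand B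
  expand (A ⊃ B)    = expand A ⊃ expand B
  expand (all σ A)  = all σ (expand A)
  expand (ex σ A)   = ex σ (expand A)
  expand (all< t A) = all< (expandᵗ t) (expand A)
  expand (ex< t A)  = ex< (expandᵗ t) (expand A)

  -- Names expand to closed terms, which no substitution affects.
  expand-subᵗ′ : ∀ n (s : Sub (extended 𝒮) Γ Γ₁) (t : Tm Γ τ) →
                 expandᵗ′ n (subᵗ s t) ≡ subᵗ (λ x → expandᵗ′ n (s x)) (expandᵗ′ n t)
  expand-subᵗ′ n s (var x)                = refl
  expand-subᵗ′ n s (con c)                = refl
  expand-subᵗ′ n s (sym (inj₁ c))         = refl
  expand-subᵗ′ zero s (sym (inj₂ c))      = ≡-sym (sub-closedᵗ _ (default (nameType c)))
  expand-subᵗ′ (suc n) s (sym (inj₂ c))   = ≡-sym (sub-closedᵗ _ (expandᵗ′ n (definition c)))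
  expand-subᵗ′ n s (t · u)                = cong₂ _·_ (expand-subᵗ′ n s t) (expand-subᵗ′ n s u)

  expand-subᵗ : (s : Sub (extended 𝒮) Γ Γ₁) (t : Tm Γ τ) →
                expandᵗ (subᵗ s t) ≡ subᵗ (λ x → expandᵗ (s x)) (expandᵗ t)
  expand-subᵗ = expand-subᵗ′ 8

  expand-renᵗ : (r : Ren Γ Γ₁) (t : Tm Γ τ) → expandᵗ (renᵗ r t) ≡ renᵗ r (expandᵗ t)
  expand-renᵗ r t = trans (cong expandᵗ (renᵗ≡subᵗ r t))
    (trans (expand-subᵗ _ t) (≡-sym (renᵗ≡subᵗ r (expandᵗ t))))

  expand-ext : (s : Sub (extended 𝒮) Γ Γ₁) →
               (λ {τ} x → expandᵗ {τ = τ} (extˢ {σ = σ} s x)) ≗ˢ extˢ (λ x → expandᵗ (s x))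
  expand-ext s (here _)  = refl
  expand-ext s (there x) = expand-renᵗ there (s x)

  expand-sub : (s : Sub (extended 𝒮) Γ Γ₁) (A : Fm Γ) →
               expand (sub s A) ≡ sub (λ x → expandᵗ (s x)) (expand A)
  expand-sub s (t ≐₀ u)   = cong₂ _≐₀_ (expand-subᵗ s t) (expand-subᵗ s u)
  expand-sub s (st t)     = cong st (expand-subᵗ s t)
  expand-sub s ⊥ᶠ         = refl
  expand-sub s (A ∧ B)    = cong₂ _∧_ (expand-sub s A) (expand-sub s B)
  expand-sub s (A ∨ B)    = cong₂ _∨_ (expand-sub s A) (expand-sub s B)
  expand-sub s (A ⊃ B)    = cong₂ _⊃_ (expand-sub s A) (expand-sub s B)
  expand-sub s (all σ A)  =
    cong (all σ) (trans (expand-sub (extˢ s) A) (sub-cong (expand-ext s) (expand A)))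
  expand-sub s (ex σ A)   =
    cong (ex σ) (trans (expand-sub (extˢ s) A) (sub-cong (expand-ext s) (expand A)))
  expand-sub s (all< t A) = cong₂ all< (expand-subᵗ s t)
    (trans (expand-sub (extˢ s) A) (sub-cong (expand-ext s) (expand A)))
  expand-sub s (ex< t A)  = cong₂ ex< (expand-subᵗ s t)
    (trans (expand-sub (extˢ s) A) (sub-cong (expand-ext s) (expand A)))

  expand-ren : (r : Ren Γ Γ₁) (A : Fm Γ) → expand (ren r A) ≡ ren r (expand A)
  expand-ren r A = trans (cong expand (ren≡sub r A))
    (trans (expand-sub _ A) (≡-sym (ren≡sub r (expand A))))

  expand-inst : (A : Fm (σ ∷ Γ)) (t : Tm Γ σ) → expand (A [ t ]) ≡ expand A [ expandᵗ t ]
  expand-inst A t = trans (expand-sub (inst t) A)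
    (sub-cong (λ { (here refl) → refl ; (there x) → refl }) (expand A))

  expand-≐ : (t u : Tm Γ τ) → expand (t ≐ u) ≡ (expandᵗ t ≐ expandᵗ u)
  expand-≐ {τ = nat} t u = refl
  expand-≐ {τ = σ ⇒ τ} t u = cong (all σ) (trans (expand-≐ (wkᵗ t · v0) (wkᵗ u · v0))
    (cong₂ (λ t′ u′ → t′ · v0 ≐ u′ · v0) (expand-renᵗ there t) (expand-renᵗ there u)))
  expand-≐ {τ = σ *} t u =
    cong (λ B → (con (len σ) · expandᵗ t ≐₀ con (len σ) · expandᵗ u) ∧ all< (con (len σ) · expandᵗ t) B)
    (trans (expand-≐ (con (at σ) · wkᵗ t · v0) (con (at σ) · wkᵗ u · v0))
      (cong₂ (λ t′ u′ → con (at σ) · t′ · v0 ≐ con (at σ) · u′ · v0)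
        (expand-renᵗ there t) (expand-renᵗ there u)))

  expand-quantifierFree : (A : Fm Γ) → QuantifierFree A → QuantifierFree (expand A)
  expand-quantifierFree (t ≐₀ u) _       = tt
  expand-quantifierFree ⊥ᶠ       _       = tt
  expand-quantifierFree (A ∧ B)  (a , b) = expand-quantifierFree A a , expand-quantifierFree B b
  expand-quantifierFree (A ∨ B)  (a , b) = expand-quantifierFree A a , expand-quantifierFree B b
  expand-quantifierFree (A ⊃ B)  (a , b) = expand-quantifierFree A a , expand-quantifierFree B b

  expand-axiom : {A : Fm Γ} → RCA₀ω A → RCA₀ω (expand A)
  expand-axiom (eq-refl t)      = eq-refl _
  expand-axiom (eq-sym t u)     = eq-sym _ _
  expand-axiom (eq-trans t u v) = eq-trans _ _ _
  expand-axiom (ext f t u)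
    rewrite expand-≐ t u | expand-≐ (f · t) (f · u) = ext _ _ _
  expand-axiom (K-eq {σ} {τ} t u) rewrite expand-≐ (con (K σ τ) · t · u) t = K-eq _ _
  expand-axiom (S-eq {ρ} {σ} {τ} t u v)
    rewrite expand-≐ (con (S ρ σ τ) · t · u · v) (t · v · (u · v)) = S-eq _ _ _
  expand-axiom (suc≢zero t)     = suc≢zero _
  expand-axiom (suc-inj t u)    = suc-inj _ _
  expand-axiom (R₀-zero t f)    = R₀-zero _ _
  expand-axiom (R₀-suc n t f)   = R₀-suc _ _ _
  expand-axiom (len-seg f n)    = len-seg _ _
  expand-axiom (at-seg {σ} f n i)
    rewrite expand-≐ (con (at σ) · (con (seg σ) · f · n) · i) (f · i) = at-seg _ _ _
  expand-axiom (bounded∀ t A) rewrite expand-renᵗ (there {x = nat}) t = bounded∀ _ _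
  expand-axiom (bounded∃ t A) rewrite expand-renᵗ (there {x = nat}) t = bounded∃ _ _
  expand-axiom (QF-IND A q)
    rewrite expand-inst A (con zero)
          | trans (expand-sub successor A)
                  (sub-cong {s′ = successor} (λ { (here refl) → refl ; (there x) → refl }) (expand A)) =
    QF-IND _ (expand-quantifierFree A q)
  expand-axiom (QF-AC¹⁰ A q)
    rewrite trans (expand-sub choose A)
                  (sub-cong {s′ = choose}
                    (λ { (here refl) → refl ; (there (here refl)) → refl ; (there (there x)) → refl })
                    (expand A)) =
    QF-AC¹⁰ _ (expand-quantifierFree A q)

  -- All formulas whose expansions are theorems are taken as axioms, so that conservativity is a
  -- plain induction on derivations.
  RCA₀Ω⁺ : Axioms (extended 𝒮)
  RCA₀Ω⁺ A = RCA₀Ω 𝒮 ∣ [] ⊢ expand A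

  RCA₀Ω⁺-closed : ∀ {Γ Γ₁} (s : Sub (extended 𝒮) Γ Γ₁) {A} → RCA₀Ω⁺ A → RCA₀Ω⁺ (sub s A)
  RCA₀Ω⁺-closed s {A} d =
    subst (RCA₀Ω 𝒮 ∣ [] ⊢_) (≡-sym (expand-sub s A)) (substitute RCA₀Ω-closed _ d)

  private
    map-expand-wk : (Δ : Hyps Γ) → map expand (map (wk {σ = σ}) Δ) ≡ map wk (map expand Δ)
    map-expand-wk Δ = trans (≡-sym (map-∘ Δ)) (trans (map-cong (expand-ren there) Δ) (map-∘ Δ))

  conservative : {Δ : Hyps Γ} {A : Fm Γ} → RCA₀Ω⁺ ∣ Δ ⊢ A → RCA₀Ω 𝒮 ∣ map expand Δ ⊢ expand A
  conservative (axiom a)   = weaken (λ ()) a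
  conservative (hyp x)     = hyp (∈-map⁺ expand x)
  conservative (raa d)     = raa (conservative d)
  conservative (⊃I d)      = ⊃I (conservative d)
  conservative (⊃E d e)    = ⊃E (conservative d) (conservative e)
  conservative (∧I d e)    = ∧I (conservative d) (conservative e)
  conservative (∧E₁ d)     = ∧E₁ (conservative d)
  conservative (∧E₂ d)     = ∧E₂ (conservative d)
  conservative (∨I₁ d)     = ∨I₁ (conservative d)
  conservative (∨I₂ d)     = ∨I₂ (conservative d)
  conservative (∨E d e e′) = ∨E (conservative d) (conservative e) (conservative e′)
  conservative {Δ = Δ} (allI {A = A} d) =
    allI (subst (λ Δ′ → RCA₀Ω 𝒮 ∣ Δ′ ⊢ expand A) (map-expand-wk Δ) (conservative d))
  conservative (allE {A = A} d t) =
    subst (RCA₀Ω 𝒮 ∣ _ ⊢_) (≡-sym (expand-inst A t)) (allE (conservative d) (expandᵗ t))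
  conservative (exI {A = A} t d) =
    exI (expandᵗ t) (subst (RCA₀Ω 𝒮 ∣ _ ⊢_) (expand-inst A t) (conservative d))
  conservative {Δ = Δ} (exE {A = A} {C} d e) =
    exE (conservative d)
      (subst (λ Δ′ → RCA₀Ω 𝒮 ∣ expand A ∷ Δ′ ⊢ wk (expand C)) (map-expand-wk Δ)
        (subst (RCA₀Ω 𝒮 ∣ _ ⊢_) (expand-ren there C) (conservative e)))

  -- The left side is what the name itself expands to, the right side what its definition expands
  -- to. Hence `unfold` is an instance of reflexivity.
  depth-suffices : (c : Name) → expandᵗ′ 7 (definition c) ≡ expandᵗ′ 8 (definition c)
  depth-suffices plusᴺ       = refl
  depth-suffices triangleᴺ   = refl
  depth-suffices pairᴺ       = refl
  depth-suffices snocᴺ       = refl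
  depth-suffices initialᴺ    = refl
  depth-suffices iteᴺ        = refl
  depth-suffices searchᴺ     = refl
  depth-suffices sumᴺ        = refl
  depth-suffices parityᴺ     = refl
  depth-suffices halfᴺ       = refl
  depth-suffices doubleᴺ     = refl
  depth-suffices shiftᴺ      = refl
  depth-suffices codeᴺ       = refl
  depth-suffices bitsᴺ       = refl
  depth-suffices testᴺ       = refl
  depth-suffices nodeᴺ       = refl
  depth-suffices pathᴺ       = refl
  depth-suffices probeᴺ      = refl
  depth-suffices isConstantᴺ = refl
  depth-suffices treeᴺ       = refl
  depth-suffices branch₀ᴺ    = refl
  depth-suffices branch₁ᴺ    = refl

module Derivations (𝒮 : Specifications) where
  open Terms 𝒮

  private variable
    Δ : Hyps Γ
    A B C D : Fm Γ

  -- Derived rules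

  infix 4 _⊩_

  _⊩_ : Hyps Γ → Fm Γ → Set
  Δ ⊩ A = RCA₀Ω⁺ ∣ Δ ⊢ A

  infixl 12 _∙_

  _∙_ : Δ ⊩ A ⊃ B → Δ ⊩ A → Δ ⊩ B
  _∙_ = ⊃E

  h0 : A ∷ Δ ⊩ A
  h0 = hyp (here refl)

  h1 : B ∷ A ∷ Δ ⊩ A
  h1 = hyp (there (here refl))

  h2 : C ∷ B ∷ A ∷ Δ ⊩ A
  h2 = hyp (there (there (here refl)))

  h3 : D ∷ C ∷ B ∷ A ∷ Δ ⊩ A
  h3 = hyp (there (there (there (here refl))))

  infix 40 #_

  #_ : ∀ {Γ} {Δ : Hyps Γ} n {n<len : True (n <? length Δ)} → Δ ⊩ lookup Δ (fromℕ< (toWitness n<len))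
  #_ n {n<len} = hyp (∈-lookup (fromℕ< (toWitness n<len)))

  w : Δ ⊩ A → B ∷ Δ ⊩ A
  w = weaken there

  exFalso : Δ ⊩ ⊥ᶠ → Δ ⊩ A
  exFalso d = raa (w d)

  excludedMiddle : (A : Fm Γ) → Δ ⊩ A ∨ ¬ᶠ A
  excludedMiddle A = raa (h0 ∙ ∨I₂ (⊃I (h1 ∙ ∨I₁ h0)))

  byCases : (A : Fm Γ) → A ∷ Δ ⊩ C → ¬ᶠ A ∷ Δ ⊩ C → Δ ⊩ C
  byCases A = ∨E (excludedMiddle A)

  -- Many lemmas are proved first, often as `closed`, for variables and without hypotheses, where
  -- weakenings and substitutions compute. This rule then instantiates them at arbitrary terms.
  use : [] ⊩ A → (s : Sub (extended 𝒮) Γ Γ₁) {Δ : Hyps Γ₁} → Δ ⊩ sub s A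
  use d s = weaken (λ ()) (substitute (λ s {A} → RCA₀Ω⁺-closed s {A}) s d)

  wk⊩ : Δ ⊩ A → map (wk {σ = σ}) Δ ⊩ wk A
  wk⊩ {Δ = Δ} {A = A} d =
    subst (_ ⊩_) (≡-sym (ren≡sub there A))
      (subst (_⊩ _) (map-cong (λ B → ≡-sym (ren≡sub there B)) Δ) (substitute (λ s {A} → RCA₀Ω⁺-closed s {A}) _ d))

  -- Inverse of `allI`: the weakened derivation is instantiated at the newly bound variable.
  under : Δ ⊩ all σ A → map wk Δ ⊩ A
  under {A = A} d =
    subst (_ ⊩_)
      (trans (sub-ren (inst v0) (extᴿ there) A)
        (trans (sub-cong (λ { (here refl) → refl ; (there x) → refl }) A) (sub-id A)))
      (allE (wk⊩ d) v0)

  fromBase : RCA₀ω A → Δ ⊩ A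
  fromBase a = axiom (axiom (base (expand-axiom a)))

  private
    <-congʳ : {i t u : Tm Γ nat} → Δ ⊩ t ≐₀ u → Δ ⊩ i <ᶠ t → Δ ⊩ i <ᶠ u
    <-congʳ e d = fromBase (eq-trans _ _ _)
      ∙ (fromBase (ext (monus · _) _ _) ∙ (fromBase (eq-sym _ _) ∙ e)) ∙ d

  ≐-refl : (t : Tm Γ τ) → Δ ⊩ t ≐ t
  ≐-refl = ≐-reflexive (λ a → axiom (base (expand-axiom a)))

  ≐-sym : (t u : Tm Γ τ) → Δ ⊩ t ≐ u → Δ ⊩ u ≐ t
  ≐-sym {τ = nat} t u d = fromBase (eq-sym _ _) ∙ d
  ≐-sym {τ = σ ⇒ τ} t u d = allI (≐-sym _ _ (under d))
  ≐-sym {τ = σ *} t u d =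
    ∧I u≡t (∧E₂ (fromBase (bounded∀ _ _)) ∙ allI (⊃I
      (≐-sym _ _ (w (under (∧E₁ (fromBase (bounded∀ _ _)) ∙ ∧E₂ d)) ∙ <-congʳ (w (wk⊩ u≡t)) h0))))
    where u≡t = fromBase (eq-sym _ _) ∙ ∧E₁ d

  ≐-trans : (t u v : Tm Γ τ) → Δ ⊩ t ≐ u → Δ ⊩ u ≐ v → Δ ⊩ t ≐ v
  ≐-trans {τ = nat} t u v d e = fromBase (eq-trans _ _ _) ∙ d ∙ e
  ≐-trans {τ = σ ⇒ τ} t u v d e = allI (≐-trans _ _ _ (under d) (under e))
  ≐-trans {τ = σ *} t u v d e =
    ∧I (fromBase (eq-trans _ _ _) ∙ ∧E₁ d ∙ ∧E₁ e)
      (∧E₂ (fromBase (bounded∀ _ _)) ∙ allI (⊃I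
        (≐-trans _ _ _
          (w (under (∧E₁ (fromBase (bounded∀ _ _)) ∙ ∧E₂ d)) ∙ h0)
          (w (under (∧E₁ (fromBase (bounded∀ _ _)) ∙ ∧E₂ e)) ∙ <-congʳ (w (wk⊩ (∧E₁ d))) h0))))

  ≐-app : (f g : Tm Γ (σ ⇒ τ)) (t : Tm Γ σ) → Δ ⊩ f ≐ g → Δ ⊩ f · t ≐ g · t
  ≐-app f g t d =
    subst (_ ⊩_)
      (trans (sub-≐ (inst t) (wkᵗ f · v0) (wkᵗ g · v0))
        (cong₂ (λ f′ g′ → f′ · t ≐ g′ · t) (inst-wkᵗ t f) (inst-wkᵗ t g)))
      (allE d t)

  -- Equational reasoning and bracket abstraction

  infix 4 _⊩_≅_

  -- A wrapper from which t and u can be inferred, unlike from the recursively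
  -- defined formula t ≐ u.
  record _⊩_≅_ (Δ : Hyps Γ) (t u : Tm Γ τ) : Set where
    constructor equation
    field formula : Δ ⊩ t ≐ u

  open _⊩_≅_ public

  ↑ : {t u : Tm Γ nat} → Δ ⊩ t ≐₀ u → Δ ⊩ t ≅ u
  ↑ = equation

  ↓ : {t u : Tm Γ nat} → Δ ⊩ t ≅ u → Δ ⊩ t ≐₀ u
  ↓ = formula

  rfl : {t : Tm Γ τ} → Δ ⊩ t ≅ t
  rfl = equation (≐-refl _)

  infix 30 _⁻¹

  _⁻¹ : {t u : Tm Γ τ} → Δ ⊩ t ≅ u → Δ ⊩ u ≅ t
  equation d ⁻¹ = equation (≐-sym _ _ d)

  infixr 20 _⨾_

  _⨾_ : {t u v : Tm Γ τ} → Δ ⊩ t ≅ u → Δ ⊩ u ≅ v → Δ ⊩ t ≅ v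
  equation d ⨾ equation e = equation (≐-trans _ _ _ d e)

  infixl 31 _⊛_

  _⊛_ : {f g : Tm Γ (σ ⇒ τ)} {t u : Tm Γ σ} → Δ ⊩ f ≅ g → Δ ⊩ t ≅ u → Δ ⊩ f · t ≅ g · u
  _⊛_ {f = f} {g} {t} {u} (equation d) (equation e) =
    equation (≐-trans _ (f · u) _ (fromBase (ext f t u) ∙ e) (≐-app f g u d))

  w≅ : {t u : Tm Γ τ} → Δ ⊩ t ≅ u → A ∷ Δ ⊩ t ≅ u
  w≅ (equation d) = equation (w d)

  -- The induction follows the clauses of `lam`; where `strengthen` succeeds the variable does not
  -- occur, and the equation for `K` suffices. The substitution `s` is included because definitions
  -- are used with their parameters filled in.
  β₁ : (s : Sub (extended 𝒮) Γ Γ₁) (t : Tm (σ ∷ Γ) τ) (u : Tm Γ₁ σ) {Δ : Hyps Γ₁} →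
       Δ ⊩ subᵗ s (lam t) · u ≅ subᵗ (s ▸ u) t
  β₁ s (var (here refl)) u = equation (fromBase (S-eq _ _ _)) ⨾ equation (fromBase (K-eq _ _))
  β₁ s (var (there x)) u = equation (fromBase (K-eq _ _))
  β₁ s (con c) u = equation (fromBase (K-eq _ _))
  β₁ s (sym c) u = equation (fromBase (K-eq _ _))
  β₁ s (t · t′) u {Δ} with strengthen (t · t′) in eq
  ... | just v  =
    subst (λ b → Δ ⊩ con (K _ _) · subᵗ s v · u ≅ b)
      (≡-sym (trans (cong (subᵗ (s ▸ u)) (strengthen-wk (t · t′) eq)) (sub-renᵗ (s ▸ u) there v)))
      (equation (fromBase (K-eq _ _)))
  ... | nothing = equation (fromBase (S-eq _ _ _)) ⨾ β₁ s t u ⊛ β₁ s t′ u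

  β₂ : (s : Sub (extended 𝒮) Γ Γ₁) (t : Tm (σ₁ ∷ σ ∷ Γ) τ) (u : Tm Γ₁ σ) (u₁ : Tm Γ₁ σ₁)
       {Δ : Hyps Γ₁} → Δ ⊩ subᵗ s (lam (lam t)) · u · u₁ ≅ subᵗ (s ▸ u ▸ u₁) t
  β₂ s t u u₁ = β₁ s (lam t) u ⊛ rfl ⨾ β₁ (s ▸ u) t u₁

  β₃ : (s : Sub (extended 𝒮) Γ Γ₁) (t : Tm (σ₂ ∷ σ₁ ∷ σ ∷ Γ) τ)
       (u : Tm Γ₁ σ) (u₁ : Tm Γ₁ σ₁) (u₂ : Tm Γ₁ σ₂) {Δ : Hyps Γ₁} →
       Δ ⊩ subᵗ s (lam (lam (lam t))) · u · u₁ · u₂ ≅ subᵗ (s ▸ u ▸ u₁ ▸ u₂) t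
  β₃ s t u u₁ u₂ = β₂ s (lam t) u u₁ ⊛ rfl ⨾ β₁ (s ▸ u ▸ u₁) t u₂

  recZero : (t : Tm Γ nat) (f : Tm Γ (nat ⇒ nat ⇒ nat)) → Δ ⊩ con R₀ · num0 · t · f ≅ t
  recZero t f = ↑ (fromBase (R₀-zero t f))

  recSuc : (n t : Tm Γ nat) (f : Tm Γ (nat ⇒ nat ⇒ nat)) →
           Δ ⊩ con R₀ · (con suc · n) · t · f ≅ f · (con R₀ · n · t · f) · n
  recSuc n t f = ↑ (fromBase (R₀-suc n t f))

  induct : (A : Fm (nat ∷ Γ)) {q : QuantifierFree A} →
           Δ ⊩ A [ con zero ] → A ∷ map wk Δ ⊩ sub successor A → Δ ⊩ all nat A
  induct A {q} z s = fromBase (QF-IND A q) ∙ ∧I z (allI (⊃I s))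

  induction : (A : Fm (nat ∷ Γ)) {q : QuantifierFree A} →
              [] ⊩ A [ con zero ] → A ∷ [] ⊩ sub successor A → [] ⊩ A
  induction A {q} z s = under (induct A {q} z s)

  unfold : (c : Name) {Δ : Hyps Γ} → Δ ⊩ ⌜ c ⌝ ≅ subᵗ ε (definition c)
  unfold {Γ = Γ} c = equation (axiom (subst (RCA₀Ω 𝒮 ∣ [] ⊢_)
    (≡-sym (trans (expand-≐ {Γ = Γ} ⌜ c ⌝ (subᵗ ε (definition c)))
      (cong (expandᵗ {Γ} ⌜ c ⌝ ≐_) same)))
    (≐-reflexive base _)))
    where
    same : expandᵗ (subᵗ ε (definition c)) ≡ expandᵗ {Γ} ⌜ c ⌝
    same = trans (expand-subᵗ ε (definition c))
      (trans (sub-congᵗ (λ ()) (expandᵗ (definition c)))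
        (trans (≡-sym (renᵗ≡subᵗ fromClosed (expandᵗ (definition c))))
          (cong (renᵗ fromClosed) (≡-sym (depth-suffices c)))))

  δ₁ : {f : Tm Γ (σ ⇒ τ)} (b : Tm (σ ∷ []) τ) → Δ ⊩ f ≅ subᵗ ε (lam b) → (t : Tm Γ σ) → Δ ⊩ f · t ≅ subᵗ (ε ▸ t) b
  δ₁ b e t = e ⊛ rfl ⨾ β₁ ε b t

  δ₂ : {f : Tm Γ (σ ⇒ σ₁ ⇒ τ)} (b : Tm (σ₁ ∷ σ ∷ []) τ) → Δ ⊩ f ≅ subᵗ ε (lam (lam b)) →
       (t : Tm Γ σ) (u : Tm Γ σ₁) → Δ ⊩ f · t · u ≅ subᵗ (ε ▸ t ▸ u) b
  δ₂ b e t u = e ⊛ rfl ⊛ rfl ⨾ β₂ ε b t u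

  δ₃ : {f : Tm Γ (σ ⇒ σ₁ ⇒ σ₂ ⇒ τ)} (b : Tm (σ₂ ∷ σ₁ ∷ σ ∷ []) τ) → Δ ⊩ f ≅ subᵗ ε (lam (lam (lam b))) →
       (t : Tm Γ σ) (u : Tm Γ σ₁) (v : Tm Γ σ₂) → Δ ⊩ f · t · u · v ≅ subᵗ (ε ▸ t ▸ u ▸ v) b
  δ₃ b e t u v = e ⊛ rfl ⊛ rfl ⊛ rfl ⨾ β₃ ε b t u v

  st-application : {f : Tm Γ (σ ⇒ τ)} {t : Tm Γ σ} → Δ ⊩ st f → Δ ⊩ st t → Δ ⊩ st (f · t)
  st-application {f = f} {t} d e = axiom (axiom (st-app (expandᵗ f) (expandᵗ t))) ∙ d ∙ e

  st-≤ : {t u : Tm Γ nat} → Δ ⊩ st u → Δ ⊩ t ≤ᶠ u → Δ ⊩ st t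
  st-≤ {t = t} {u} d e = axiom (axiom (st-below (expandᵗ t) (expandᵗ u))) ∙ d ∙ e

  st-con : {c : Con τ} → Δ ⊩ st {Γ = Γ} (con c)
  st-con = axiom (axiom (st-closed (con _)))

  st-name : {c : Name} → Δ ⊩ st {Γ = Γ} ⌜ c ⌝
  st-name {c = c} = axiom (axiom (st-closed (expandᵗ′ 7 (definition c))))

  -- Constants and names denote closed terms, which are standard, and application preserves
  -- standardness.
  st-term : (s : Sub (extended 𝒮) Γ Γ₁) {Δ : Hyps Γ₁} →
            (∀ {τ} (x : τ ∈ Γ) → Δ ⊩ st (s x)) → (t : Tm Γ τ) → Δ ⊩ st (subᵗ s t)
  st-term s d (var x)        = d x
  st-term s d (con c)        = st-con
  st-term s d (sym (inj₁ c)) = axiom (axiom (st-closed (sym c)))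
  st-term s d (sym (inj₂ c)) = st-name {c = c}
  st-term s d (t · u)        = st-application (st-term s d t) (st-term s d u)

  -- Arithmetic

  S-cong : {t u : Tm Γ nat} → Δ ⊩ t ≅ u → Δ ⊩ S′ t ≅ S′ u
  S-cong e = rfl ⊛ e

  recSucβ : (s : Sub (extended 𝒮) Γ Γ₁) (g : Tm (nat ∷ nat ∷ Γ) nat) (n t : Tm Γ₁ nat)
            {Δ : Hyps Γ₁} → let f = subᵗ s (lam (lam g)) in
            Δ ⊩ con R₀ · S′ n · t · f ≅ subᵗ (s ▸ con R₀ · n · t · f ▸ n) g
  recSucβ s g n t = recSuc _ _ _ ⨾ β₂ s g _ _

  private
    monusBody : Tm (nat ∷ nat ∷ []) nat
    monusBody = con R₀ · v0 · v1 · lam (lam (pred · v1))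

    predBody : Tm (nat ∷ []) nat
    predBody = con R₀ · v0 · num0 · lam (lam v0)
  plus-zero : (t : Tm Γ nat) → Δ ⊩ t ⊕ num0 ≅ t
  plus-zero t = δ₂ plusBody (unfold plusᴺ) t num0 ⨾ recZero _ _

  plus-suc : (t u : Tm Γ nat) → Δ ⊩ t ⊕ S′ u ≅ S′ (t ⊕ u)
  plus-suc t u =
    δ₂ plusBody (unfold plusᴺ) t (S′ u) ⨾ recSucβ ε (con suc · v1) _ _ ⨾ S-cong (δ₂ plusBody (unfold plusᴺ) t u ⁻¹)

  pred-zero : Δ ⊩ pred {Γ = Γ} · num0 ≅ num0
  pred-zero = β₁ ε predBody num0 ⨾ recZero _ _

  pred-suc : (t : Tm Γ nat) → Δ ⊩ pred · S′ t ≅ t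
  pred-suc t = β₁ ε predBody (S′ t) ⨾ recSucβ ε v0 _ _

  monus-zero : (t : Tm Γ nat) → Δ ⊩ t ∸ num0 ≅ t
  monus-zero t = β₂ ε monusBody t num0 ⨾ recZero _ _

  monus-suc : (t u : Tm Γ nat) → Δ ⊩ t ∸ S′ u ≅ pred · (t ∸ u)
  monus-suc t u =
    β₂ ε monusBody t (S′ u) ⨾ recSucβ ε (pred · v1) _ _ ⨾ rfl ⊛ (β₂ ε monusBody t u ⁻¹)

  suc≢0 : {t : Tm Γ nat} → Δ ⊩ S′ t ≅ num0 → Δ ⊩ ⊥ᶠ
  suc≢0 e = fromBase (suc≢zero _) ∙ ↓ e

  S-inj : {t u : Tm Γ nat} → Δ ⊩ S′ t ≅ S′ u → Δ ⊩ t ≅ u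
  S-inj e = ↑ (fromBase (suc-inj _ _) ∙ ↓ e)

  suc-monus-suc : (t u : Tm Γ nat) → Δ ⊩ S′ t ∸ S′ u ≅ t ∸ u
  suc-monus-suc t u = ↑ (use
    (induction (S′ v1 ∸ S′ v0 ≐₀ v1 ∸ v0)
      (↓ (monus-suc _ _ ⨾ rfl ⊛ monus-zero _ ⨾ pred-suc _ ⨾ monus-zero _ ⁻¹))
      (↓ (monus-suc _ _ ⨾ rfl ⊛ ↑ h0 ⨾ monus-suc _ _ ⁻¹)))
    (ε ▸ t ▸ u))

  zero-monus : (t : Tm Γ nat) → Δ ⊩ num0 ∸ t ≅ num0
  zero-monus t = ↑ (use
    (induction (num0 ∸ v0 ≐₀ num0)
      (↓ (monus-zero _))
      (↓ (monus-suc _ _ ⨾ rfl ⊛ ↑ h0 ⨾ pred-zero)))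
    (ε ▸ t))

  monus-self : (t : Tm Γ nat) → Δ ⊩ t ∸ t ≅ num0
  monus-self t = ↑ (use
    (induction (v0 ∸ v0 ≐₀ num0)
      (↓ (monus-zero _))
      (↓ (suc-monus-suc _ _ ⨾ ↑ h0)))
    (ε ▸ t))

  suc-monus-self : (t : Tm Γ nat) → Δ ⊩ S′ t ∸ t ≅ num1
  suc-monus-self t = ↑ (use
    (induction (S′ v0 ∸ v0 ≐₀ num1)
      (↓ (monus-zero _))
      (↓ (suc-monus-suc _ _ ⨾ ↑ h0)))
    (ε ▸ t))

  zeroOrSuc : (t : Tm Γ nat) →
              t ≐₀ num0 ∷ Δ ⊩ C → t ≐₀ S′ (pred · t) ∷ Δ ⊩ C → Δ ⊩ C
  zeroOrSuc t = ∨E (use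
    (induction (v0 ≐₀ num0 ∨ v0 ≐₀ S′ (pred · v0))
      (∨I₁ (↓ rfl))
      (∨I₂ (↓ (S-cong (pred-suc _ ⁻¹)))))
    (ε ▸ t))

  nonzero : {t : Tm Γ nat} → Δ ⊩ ¬ᶠ (t ≐₀ num0) → Δ ⊩ t ≅ S′ (pred · t)
  nonzero {t = t} d = ↑ (zeroOrSuc t (exFalso (w d ∙ h0)) h0)

  zero-plus : (t : Tm Γ nat) → Δ ⊩ num0 ⊕ t ≅ t
  zero-plus t = ↑ (use
    (induction (num0 ⊕ v0 ≐₀ v0)
      (↓ (plus-zero _))
      (↓ (plus-suc _ _ ⨾ S-cong (↑ h0))))
    (ε ▸ t))

  suc-plus : (t u : Tm Γ nat) → Δ ⊩ S′ t ⊕ u ≅ S′ (t ⊕ u)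
  suc-plus t u = ↑ (use
    (induction (S′ v1 ⊕ v0 ≐₀ S′ (v1 ⊕ v0))
      (↓ (plus-zero _ ⨾ S-cong (plus-zero _ ⁻¹)))
      (↓ (plus-suc _ _ ⨾ S-cong (↑ h0 ⨾ plus-suc _ _ ⁻¹))))
    (ε ▸ t ▸ u))

  plus-comm : (t u : Tm Γ nat) → Δ ⊩ t ⊕ u ≅ u ⊕ t
  plus-comm t u = ↑ (use
    (induction (v1 ⊕ v0 ≐₀ v0 ⊕ v1)
      (↓ (plus-zero _ ⨾ zero-plus _ ⁻¹))
      (↓ (plus-suc _ _ ⨾ S-cong (↑ h0) ⨾ suc-plus _ _ ⁻¹)))
    (ε ▸ t ▸ u))

  infixl 31 _⊞_

  _⊞_ : {t t′ u u′ : Tm Γ nat} → Δ ⊩ t ≅ t′ → Δ ⊩ u ≅ u′ → Δ ⊩ t ⊕ u ≅ t′ ⊕ u′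
  d ⊞ e = rfl ⊛ d ⊛ e

  infixl 31 _⊟_

  _⊟_ : {t t′ u u′ : Tm Γ nat} → Δ ⊩ t ≅ t′ → Δ ⊩ u ≅ u′ → Δ ⊩ t ∸ u ≅ t′ ∸ u′
  d ⊟ e = rfl ⊛ d ⊛ e

  plus-assoc : (t u v : Tm Γ nat) → Δ ⊩ t ⊕ u ⊕ v ≅ t ⊕ (u ⊕ v)
  plus-assoc t u v = ↑ (use
    (induction (v2 ⊕ v1 ⊕ v0 ≐₀ v2 ⊕ (v1 ⊕ v0))
      (↓ (plus-zero _ ⨾ rfl ⊞ (plus-zero _ ⁻¹)))
      (↓ (plus-suc _ _ ⨾ S-cong (↑ h0) ⨾ plus-suc _ _ ⁻¹ ⨾ rfl ⊞ (plus-suc _ _ ⁻¹))))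
    (ε ▸ t ▸ u ▸ v))

  monus-plus : (t u : Tm Γ nat) → Δ ⊩ t ∸ (t ⊕ u) ≅ num0
  monus-plus t u = ↑ (use
    (induction (v1 ∸ (v1 ⊕ v0) ≐₀ num0)
      (↓ (rfl ⊟ plus-zero _ ⨾ monus-self _))
      (↓ (rfl ⊟ plus-suc _ _ ⨾ monus-suc _ _ ⨾ rfl ⊛ ↑ h0 ⨾ pred-zero)))
    (ε ▸ t ▸ u))

  plus-monus : (t u : Tm Γ nat) → Δ ⊩ (t ⊕ u) ∸ u ≅ t
  plus-monus t u = ↑ (use
    (induction ((v1 ⊕ v0) ∸ v0 ≐₀ v1)
      (↓ (monus-zero _ ⨾ plus-zero _))
      (↓ (plus-suc _ _ ⊟ rfl ⨾ suc-monus-suc _ _ ⨾ ↑ h0)))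
    (ε ▸ t ▸ u))

  plus-cancelʳ : {t u v : Tm Γ nat} → Δ ⊩ t ⊕ v ≅ u ⊕ v → Δ ⊩ t ≅ u
  plus-cancelʳ e = plus-monus _ _ ⁻¹ ⨾ e ⊟ rfl ⨾ plus-monus _ _

  plus-cancelˡ : {t u v : Tm Γ nat} → Δ ⊩ v ⊕ t ≅ v ⊕ u → Δ ⊩ t ≅ u
  plus-cancelˡ e = plus-cancelʳ (plus-comm _ _ ⨾ e ⨾ plus-comm _ _)

  plus≡0ʳ : {t u : Tm Γ nat} → Δ ⊩ t ⊕ u ≅ num0 → Δ ⊩ u ≅ num0
  plus≡0ʳ {t = t} {u} e = ↑ (zeroOrSuc u h0
    (exFalso (suc≢0 (plus-suc _ _ ⁻¹ ⨾ rfl ⊞ (↑ h0 ⁻¹) ⨾ w≅ e))))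

  plus≡0ˡ : {t u : Tm Γ nat} → Δ ⊩ t ⊕ u ≅ num0 → Δ ⊩ t ≅ num0
  plus≡0ˡ e = plus≡0ʳ (plus-comm _ _ ⨾ e)

  plus-0-0 : {t u : Tm Γ nat} → Δ ⊩ t ≅ num0 → Δ ⊩ u ≅ num0 → Δ ⊩ t ⊕ u ≅ num0
  plus-0-0 d e = d ⊞ e ⨾ plus-zero _

  ≤-intro : {t u : Tm Γ nat} (v : Tm Γ nat) → Δ ⊩ t ⊕ v ≅ u → Δ ⊩ t ≤ᶠ u
  ≤-intro v e = ↓ (rfl ⊟ (e ⁻¹) ⨾ monus-plus _ _)

  -- Induction on `t` for fixed `u`. With `≤-intro`, this turns the order, defined by cut-off
  -- subtraction, into the existence of a summand.
  ≤-difference : {t u : Tm Γ nat} → Δ ⊩ t ≤ᶠ u → Δ ⊩ t ⊕ (u ∸ t) ≅ u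
  ≤-difference {t = t} {u} d = ↑ (use
    (induction (v0 ≤ᶠ v1 ⊃ v0 ⊕ (v1 ∸ v0) ≐₀ v1)
      (⊃I (↓ (zero-plus _ ⨾ monus-zero _)))
      (⊃I (let ih : S′ v0 ≤ᶠ v1 ∷ (v0 ≤ᶠ v1 ⊃ v0 ⊕ (v1 ∸ v0) ≐₀ v1) ∷ [] ⊩ v0 ⊕ (v1 ∸ v0) ≅ v1
               ih = ↑ (h1 ∙ ↓ (suc-monus-suc _ _ ⁻¹ ⨾ monus-suc _ _ ⨾ rfl ⊛ ↑ h0 ⨾ pred-zero))
           in zeroOrSuc (v1 ∸ v0)
        -- A zero difference would make `u` equal to `t`, against `S′ t ≤ᶠ u`.
        (exFalso (suc≢0 (suc-monus-self _ ⁻¹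
          ⨾ rfl ⊟ (plus-zero _ ⁻¹ ⨾ rfl ⊞ (↑ h0 ⁻¹) ⨾ w≅ ih) ⨾ ↑ h1)))
        (↓ (rfl ⊞ monus-suc _ _ ⨾ suc-plus _ _ ⨾ plus-suc _ _ ⁻¹ ⨾ rfl ⊞ (↑ h0 ⁻¹) ⨾ w≅ ih)))))
    (ε ▸ u ▸ t) ∙ d)

  ≤-refl : {t : Tm Γ nat} → Δ ⊩ t ≤ᶠ t
  ≤-refl = ↓ (monus-self _)

  0≤ : {t : Tm Γ nat} → Δ ⊩ num0 ≤ᶠ t
  0≤ = ↓ (zero-monus _)

  ≤0 : {t : Tm Γ nat} → Δ ⊩ t ≤ᶠ num0 → Δ ⊩ t ≅ num0
  ≤0 d = monus-zero _ ⁻¹ ⨾ ↑ d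

  ≤-trans : {t u v : Tm Γ nat} → Δ ⊩ t ≤ᶠ u → Δ ⊩ u ≤ᶠ v → Δ ⊩ t ≤ᶠ v
  ≤-trans d e = ≤-intro _ (plus-assoc _ _ _ ⁻¹ ⨾ ≤-difference d ⊞ rfl ⨾ ≤-difference e)

  ≤-reflexive : {t u : Tm Γ nat} → Δ ⊩ t ≅ u → Δ ⊩ t ≤ᶠ u
  ≤-reflexive e = ↓ (e ⊟ rfl ⨾ monus-self _)

  ≤-plus : {t u : Tm Γ nat} → Δ ⊩ t ≤ᶠ t ⊕ u
  ≤-plus = ↓ (monus-plus _ _)

  ≤-plusʳ : {t u : Tm Γ nat} → Δ ⊩ u ≤ᶠ t ⊕ u
  ≤-plusʳ = ≤-intro _ (plus-comm _ _)

  ≤-suc : {t : Tm Γ nat} → Δ ⊩ t ≤ᶠ S′ t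
  ≤-suc = ≤-intro num1 (plus-suc _ _ ⨾ S-cong (plus-zero _))

  S≤S : {t u : Tm Γ nat} → Δ ⊩ t ≤ᶠ u → Δ ⊩ S′ t ≤ᶠ S′ u
  S≤S d = ↓ (suc-monus-suc _ _ ⨾ ↑ d)

  S≤S⁻¹ : {t u : Tm Γ nat} → Δ ⊩ S′ t ≤ᶠ S′ u → Δ ⊩ t ≤ᶠ u
  S≤S⁻¹ d = ↓ (suc-monus-suc _ _ ⁻¹ ⨾ ↑ d)

  <-irrefl : {t : Tm Γ nat} → Δ ⊩ t <ᶠ t → Δ ⊩ ⊥ᶠ
  <-irrefl d = suc≢0 (suc-monus-self _ ⁻¹ ⨾ ↑ d)

  ≤-cases : {t u : Tm Γ nat} → Δ ⊩ t ≤ᶠ u → t <ᶠ u ∷ Δ ⊩ C → t ≐₀ u ∷ Δ ⊩ C → Δ ⊩ C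
  ≤-cases {t = t} {u} d c c′ = zeroOrSuc (u ∸ t)
    (⊃E (w (⊃I c′)) (↓ (plus-zero _ ⁻¹ ⨾ rfl ⊞ (↑ h0 ⁻¹) ⨾ w≅ (≤-difference d))))
    (⊃E (w (⊃I c))
      (≤-intro (pred · (u ∸ t))
        (suc-plus _ _ ⨾ plus-suc _ _ ⁻¹ ⨾ rfl ⊞ (↑ h0 ⁻¹) ⨾ w≅ (≤-difference d))))

  <-or-≥ : (t u : Tm Γ nat) → t <ᶠ u ∷ Δ ⊩ C → u ≤ᶠ t ∷ Δ ⊩ C → Δ ⊩ C
  <-or-≥ t u = ∨E (use
    (induction (v0 <ᶠ v1 ∨ v1 ≤ᶠ v0)
      (zeroOrSuc v0 (∨I₂ (≤-reflexive (↑ h0)))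
        (∨I₁ (↓ (rfl ⊟ ↑ h0 ⨾ suc-monus-suc _ _ ⨾ zero-monus _))))
      (∨E h0
        (≤-cases h0 (∨I₁ h0) (∨I₂ (≤-reflexive (↑ h0 ⁻¹))))
        (∨I₂ (≤-trans h0 ≤-suc))))
    (ε ▸ u ▸ t))

  -- Pairing and codes of sequences

  triangle-suc : (t : Tm Γ nat) → Δ ⊩ triangle⁺ · S′ t ≅ triangle⁺ · t ⊕ S′ t
  triangle-suc t =
    δ₁ triangleBody (unfold triangleᴺ) (S′ t) ⨾ recSucβ ε (v1 ⊕ S′ v0) _ _
    ⨾ (δ₁ triangleBody (unfold triangleᴺ) t ⁻¹) ⊞ rfl

  pair-eq : (t u : Tm Γ nat) → Δ ⊩ pair⁺ · t · u ≅ triangle⁺ · (t ⊕ u) ⊕ u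
  pair-eq t u = δ₂ pairBody (unfold pairᴺ) t u

  snoc-eq : (t u : Tm Γ nat) → Δ ⊩ snoc⁺ · t · u ≅ S′ (pair⁺ · t · u)
  snoc-eq t u = δ₂ snocBody (unfold snocᴺ) t u

  initial-zero : (β : Tm Γ 𝟏) → Δ ⊩ initial⁺ · β · num0 ≅ num0
  initial-zero β = δ₂ initialBody (unfold initialᴺ) β num0 ⨾ recZero _ _

  initial-suc : (β : Tm Γ 𝟏) (n : Tm Γ nat) →
                Δ ⊩ initial⁺ · β · S′ n ≅ snoc⁺ · (initial⁺ · β · n) · (β · n)
  initial-suc β n =
    δ₂ initialBody (unfold initialᴺ) β (S′ n)
    ⨾ recSucβ (ε ▸ β) (snoc⁺ · v1 · (v2 · v0)) _ _
    ⨾ rfl ⊛ (δ₂ initialBody (unfold initialᴺ) β n ⁻¹) ⊛ rfl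

  ≤-triangle : {t : Tm Γ nat} → Δ ⊩ t ≤ᶠ triangle⁺ · t
  ≤-triangle {t = t} = zeroOrSuc t
    (≤-trans (≤-reflexive (↑ h0)) 0≤)
    (≤-trans (≤-reflexive (↑ h0))
      (≤-trans ≤-plusʳ (≤-reflexive (triangle-suc _ ⁻¹ ⨾ rfl ⊛ (↑ h0 ⁻¹)))))

  triangle-mono : {t u : Tm Γ nat} → Δ ⊩ t ≤ᶠ u → Δ ⊩ triangle⁺ · t ≤ᶠ triangle⁺ · u
  triangle-mono {t = t} {u} d =
    ≤-trans
      (use (induction (triangle⁺ · v1 ≤ᶠ triangle⁺ · (v1 ⊕ v0))
        (≤-reflexive (rfl ⊛ (plus-zero _ ⁻¹)))
        (≤-trans h0 (≤-trans ≤-plus (≤-reflexive (triangle-suc _ ⁻¹ ⨾ rfl ⊛ (plus-suc _ _ ⁻¹))))))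
        (ε ▸ t ▸ (u ∸ t)))
      (≤-reflexive (rfl ⊛ ≤-difference d))

  private
    -- A pair on the diagonal of sum `a ⊕ b` lies below the triangular number of the next diagonal,
    -- which is at most that of `c ⊕ d`.
    pair-clash : {a b c d : Tm Γ nat} →
                 Δ ⊩ a ⊕ b <ᶠ c ⊕ d → Δ ⊩ pair⁺ · a · b ≅ pair⁺ · c · d → Δ ⊩ ⊥ᶠ
    pair-clash {a = a} {b} {c} {d} lt e = <-irrefl
      (≤-trans (≤-intro {t = S′ (triangle⁺ · (a ⊕ b) ⊕ b)} a
        (suc-plus _ _ ⨾ S-cong (plus-assoc _ _ _ ⨾ rfl ⊞ plus-comm _ _)
          ⨾ plus-suc _ _ ⁻¹ ⨾ triangle-suc _ ⁻¹))
      (≤-trans (triangle-mono lt)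
      (≤-trans (≤-plus {u = d})
        (≤-reflexive (pair-eq _ _ ⁻¹ ⨾ e ⁻¹ ⨾ pair-eq _ _)))))

  -- A strict inequality of the sums, in either direction, is refuted by `pair-clash`; equal sums
  -- allow the triangular numbers to be cancelled.
  pair-injʳ : {a b c d : Tm Γ nat} → Δ ⊩ pair⁺ · a · b ≅ pair⁺ · c · d → Δ ⊩ a ⊕ b ≅ c ⊕ d × Δ ⊩ b ≅ d
  pair-injʳ {a = a} {b} {c} {d} e = sums , plus-cancelˡ
      (rfl ⊛ (rfl ⊛ (sums ⁻¹)) ⊛ rfl ⨾ pair-eq a b ⁻¹ ⨾ e ⨾ pair-eq c d)
    where
    sums = ↑ (<-or-≥ (a ⊕ b) (c ⊕ d)
      (exFalso (pair-clash h0 (w≅ e)))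
      (≤-cases h0
        (exFalso (pair-clash h0 (w≅ (w≅ e ⁻¹))))
        (↓ (↑ h0 ⁻¹))))

  snoc-inj : {a b c d : Tm Γ nat} → Δ ⊩ snoc⁺ · a · b ≅ snoc⁺ · c · d → Δ ⊩ a ≅ c × Δ ⊩ b ≅ d
  snoc-inj {a = a} {b} {c} {d} e =
    plus-cancelʳ (proj₁ equal ⨾ rfl ⊞ (proj₂ equal ⁻¹)) , proj₂ equal
    where
    equal = pair-injʳ {a = a} {b} {c} {d} (S-inj (snoc-eq a b ⁻¹ ⨾ e ⨾ snoc-eq c d))

  snoc≢0 : {a b : Tm Γ nat} → Δ ⊩ snoc⁺ · a · b ≅ num0 → Δ ⊩ ⊥ᶠ
  snoc≢0 e = suc≢0 (snoc-eq _ _ ⁻¹ ⨾ e)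

  <-snoc : {a b : Tm Γ nat} → Δ ⊩ a <ᶠ snoc⁺ · a · b
  <-snoc = ≤-trans (S≤S (≤-trans ≤-plus (≤-trans ≤-triangle ≤-plus)))
    (≤-reflexive (S-cong (pair-eq _ _ ⁻¹) ⨾ snoc-eq _ _ ⁻¹))

  -- Each appended entry raises the code. Codes therefore bound lengths, and can serve as bounds for
  -- searches and sums.
  ≤-initial : (β : Tm Γ 𝟏) (n : Tm Γ nat) → Δ ⊩ n ≤ᶠ initial⁺ · β · n
  ≤-initial β n = use
    (induction (v0 ≤ᶠ initial⁺ · v1 · v0)
      0≤
      (≤-trans (S≤S h0) (≤-trans <-snoc (≤-reflexive (initial-suc _ _ ⁻¹)))))
    (ε ▸ β ▸ n)

  ite-zero : {c t u : Tm Γ nat} → Δ ⊩ c ≅ num0 → Δ ⊩ ite · c · t · u ≅ t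
  ite-zero e = rfl ⊛ e ⊛ rfl ⊛ rfl ⨾ δ₃ iteBody (unfold iteᴺ) _ _ _ ⨾ recZero _ _

  ite-suc : {c d t u : Tm Γ nat} → Δ ⊩ c ≅ S′ d → Δ ⊩ ite · c · t · u ≅ u
  ite-suc {t = t} {u} e = rfl ⊛ e ⊛ rfl ⊛ rfl ⨾ δ₃ iteBody (unfold iteᴺ) _ _ _ ⨾ recSucβ (ε ▸ t ▸ u) v2 _ _

  sg≡0 : {t : Tm Γ nat} → Δ ⊩ sg t ≅ num0 → Δ ⊩ t ≅ num0
  sg≡0 {t = t} e = ↑ (zeroOrSuc t h0 (exFalso (suc≢0 (ite-suc (↑ h0) ⁻¹ ⨾ w≅ e))))

  sg≤1 : {t : Tm Γ nat} → Δ ⊩ sg t ≤ᶠ num1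
  sg≤1 {t = t} = zeroOrSuc t
    (≤-trans (≤-reflexive (ite-zero (↑ h0))) 0≤)
    (≤-reflexive (ite-suc (↑ h0)))

  not-zero : {t : Tm Γ nat} → Δ ⊩ t ≅ num0 → Δ ⊩ not t ≅ num1
  not-zero e = rfl ⊟ e ⨾ monus-zero _

  not-suc : {t u : Tm Γ nat} → Δ ⊩ t ≅ S′ u → Δ ⊩ not t ≅ num0
  not-suc e = rfl ⊟ e ⨾ suc-monus-suc _ _ ⨾ zero-monus _

  not≡0 : {t : Tm Γ nat} → Δ ⊩ not t ≅ num0 → Δ ⊩ ¬ᶠ (t ≐₀ num0)
  not≡0 e = ⊃I (suc≢0 (not-zero (↑ h0) ⁻¹ ⨾ w≅ e))

  ≤1-cases : {t : Tm Γ nat} → Δ ⊩ t ≤ᶠ num1 → t ≐₀ num0 ∷ Δ ⊩ C → t ≐₀ num1 ∷ Δ ⊩ C → Δ ⊩ C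
  ≤1-cases d c c′ = ≤-cases d (⊃E (w (⊃I c)) (↓ (≤0 (S≤S⁻¹ h0)))) c′

  dist≡0 : {t u : Tm Γ nat} → Δ ⊩ dist t u ≅ num0 → Δ ⊩ t ≅ u
  dist≡0 {t = t} {u} e =
    plus-zero _ ⁻¹ ⨾ rfl ⊞ (plus≡0ʳ e ⁻¹) ⨾ ≤-difference (↓ (plus≡0ˡ {t = t ∸ u} e))

  dist-refl : {t u : Tm Γ nat} → Δ ⊩ t ≅ u → Δ ⊩ dist t u ≅ num0
  dist-refl e = plus-0-0 (↑ (≤-reflexive e)) (↑ (≤-reflexive (e ⁻¹)))

  -- Bounded search and sums

  search-suc : (f : Tm Γ 𝟏) (n : Tm Γ nat) →
               Δ ⊩ search · f · S′ n ≅ ite · (f · n) · n · (search · f · n)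
  search-suc f n =
    δ₂ searchBody (unfold searchᴺ) f (S′ n)
    ⨾ recSucβ (ε ▸ f) (ite · (v2 · v0) · v0 · v1) _ _
    ⨾ rfl ⊛ (δ₂ searchBody (unfold searchᴺ) f n ⁻¹)

  -- Induction on `n`: a zero at the last place is returned; otherwise `i` lies before that place
  -- and the earlier result is kept.
  search-finds : {f : Tm Γ 𝟏} {i n : Tm Γ nat} → Δ ⊩ i <ᶠ n → Δ ⊩ f · i ≅ num0 →
                 Δ ⊩ f · (search · f · n) ≅ num0
  search-finds {f = f} {i} {n} lt e = ↑ (use
    (induction (v1 <ᶠ v0 ⊃ v2 · v1 ≐₀ num0 ⊃ v2 · (search · v2 · v0) ≐₀ num0)
      (⊃I (exFalso (suc≢0 (≤0 h0))))
      (⊃I (⊃I (zeroOrSuc (v2 · v0)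
        (↓ (rfl ⊛ (search-suc _ _ ⨾ ite-zero (↑ h0)) ⨾ ↑ h0))
        (≤-cases (S≤S⁻¹ h2)
          (↓ (rfl ⊛ (search-suc _ _ ⨾ ite-suc (↑ h1)) ⨾ ↑ (w h3 ∙ h0 ∙ h2)))
          (exFalso (suc≢0 (↑ h1 ⁻¹ ⨾ rfl ⊛ (↑ h0 ⁻¹) ⨾ ↑ h2))))))))
    (ε ▸ f ▸ i ▸ n) ∙ lt ∙ ↓ e)

  sum-zero : (f : Tm Γ 𝟏) → Δ ⊩ sum · f · num0 ≅ num0
  sum-zero f = δ₂ sumBody (unfold sumᴺ) f num0 ⨾ recZero _ _

  sum-suc : (f : Tm Γ 𝟏) (n : Tm Γ nat) → Δ ⊩ sum · f · S′ n ≅ sum · f · n ⊕ f · n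
  sum-suc f n =
    δ₂ sumBody (unfold sumᴺ) f (S′ n)
    ⨾ recSucβ (ε ▸ f) (v1 ⊕ (v2 · v0)) _ _
    ⨾ (δ₂ sumBody (unfold sumᴺ) f n ⁻¹) ⊞ rfl

  sum≡0-≤ : {f : Tm Γ 𝟏} {m n : Tm Γ nat} → Δ ⊩ m ≤ᶠ n → Δ ⊩ sum · f · n ≅ num0 →
            Δ ⊩ sum · f · m ≅ num0
  sum≡0-≤ {f = f} {m} {n} le e = ↑ (use
    (induction (sum · v2 · (v1 ⊕ v0) ≐₀ num0 ⊃ sum · v2 · v1 ≐₀ num0)
      (⊃I (↓ (rfl ⊛ (plus-zero _ ⁻¹) ⨾ ↑ h0)))
      (⊃I (h1 ∙ ↓ (plus≡0ˡ (sum-suc _ _ ⁻¹ ⨾ rfl ⊛ (plus-suc _ _ ⁻¹) ⨾ ↑ h0)))))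
    (ε ▸ f ▸ m ▸ (n ∸ m)) ∙ ↓ (rfl ⊛ ≤-difference le ⨾ e))

  -- A vanishing sum is a quantifier-free way to say that `f` is zero below `n`.
  sum≡0-< : {f : Tm Γ 𝟏} {m n : Tm Γ nat} → Δ ⊩ m <ᶠ n → Δ ⊩ sum · f · n ≅ num0 →
            Δ ⊩ f · m ≅ num0
  sum≡0-< lt e = plus≡0ʳ (sum-suc _ _ ⁻¹ ⨾ sum≡0-≤ lt e)

  private
    ren-inst : (A : Fm (nat ∷ Γ)) (t : Tm Γ nat) →
               ren (extᴿ (there {x = σ})) A [ wkᵗ t ] ≡ wk (A [ t ])
    ren-inst A t = sub-ren-square (λ { (here refl) → refl ; (there x) → refl }) A

    ren-inst-var : (A : Fm (nat ∷ Γ)) → ren (extᴿ there) A [ v0 ] ≡ A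
    ren-inst-var A = trans (sub-ren (inst v0) (extᴿ there) A)
      (trans (sub-cong (λ { (here refl) → refl ; (there x) → refl }) A) (sub-id A))

    ren-successor : (r : Ren Γ Γ₁) (A : Fm (nat ∷ Γ)) →
                    sub successor (ren (extᴿ r) A) ≡ ren (extᴿ r) (sub successor A)
    ren-successor r A = sub-ren-square (λ { (here refl) → refl ; (there x) → refl }) A

  -- The induction formula is relativised to the numbers up to a standard one.
  st-induction : (A : Fm (nat ∷ Γ)) {q : QuantifierFree A} →
                 Δ ⊩ A [ num0 ] → Δ ⊩ allˢᵗ nat (A ⊃ sub successor A) → Δ ⊩ allˢᵗ nat A
  st-induction {Γ = Γ} {Δ = Δ} A {q} z s = allI (⊃I
    (subst (_ ⊩_) (ren-inst-var A)
      (allE (fromBase (QF-IND (v0 ≤ᶠ v1 ⊃ A′) (tt , q′)) ∙ ∧I base′ (allI (⊃I (⊃I step)))) v0 ∙ ≤-refl)))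
    where
    A′ : Fm (nat ∷ nat ∷ Γ)
    A′ = ren (extᴿ there) A

    q′ : QuantifierFree A′
    q′ = subst QuantifierFree (≡-sym (ren≡sub (extᴿ there) A)) (sub-quantifierFree _ A q)

    base′ : st v0 ∷ map wk Δ ⊩ num0 ≤ᶠ v0 ⊃ A′ [ num0 ]
    base′ = ⊃I (w (w (subst (_ ⊩_) (≡-sym (ren-inst A num0)) (wk⊩ z))))

    step : S′ v0 ≤ᶠ v1 ∷ (v0 ≤ᶠ v1 ⊃ A′) ∷ st v1 ∷ map wk (map wk Δ) ⊩ sub successor A′
    step = subst (S′ v0 ≤ᶠ v1 ∷ (v0 ≤ᶠ v1 ⊃ A′) ∷ st v1 ∷ map wk (map wk Δ) ⊩_) (≡-sym (ren-successor there A))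
      (w (w (w (under (wk⊩ s))))
        ∙ (st-≤ h2 (≤-trans ≤-suc h0))
        ∙ (h1 ∙ ≤-trans ≤-suc h0))

  -- Binary codes

  parity-zero : Δ ⊩ parity {Γ} · num0 ≅ num0
  parity-zero = δ₁ parityBody (unfold parityᴺ) num0 ⨾ recZero _ _

  parity-suc : (t : Tm Γ nat) → Δ ⊩ parity · S′ t ≅ not (parity · t)
  parity-suc t = δ₁ parityBody (unfold parityᴺ) (S′ t) ⨾ recSucβ ε (not v1) _ _ ⨾ rfl ⊟ (δ₁ parityBody (unfold parityᴺ) t ⁻¹)

  half-zero : Δ ⊩ half {Γ} · num0 ≅ num0
  half-zero = δ₁ halfBody (unfold halfᴺ) num0 ⨾ recZero _ _

  half-suc : (t : Tm Γ nat) → Δ ⊩ half · S′ t ≅ half · t ⊕ parity · t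
  half-suc t = δ₁ halfBody (unfold halfᴺ) (S′ t) ⨾ recSucβ ε (v1 ⊕ parity · v0) _ _ ⨾ (δ₁ halfBody (unfold halfᴺ) t ⁻¹) ⊞ rfl

  double-zero : Δ ⊩ double {Γ} · num0 ≅ num0
  double-zero = δ₁ doubleBody (unfold doubleᴺ) num0 ⨾ recZero _ _

  double-suc : (t : Tm Γ nat) → Δ ⊩ double · S′ t ≅ S′ (S′ (double · t))
  double-suc t =
    δ₁ doubleBody (unfold doubleᴺ) (S′ t) ⨾ recSucβ ε (S′ (S′ v1)) _ _ ⨾ S-cong (S-cong (δ₁ doubleBody (unfold doubleᴺ) t ⁻¹))

  parity-double : (t : Tm Γ nat) → Δ ⊩ parity · (double · t) ≅ num0
  parity-double t = ↑ (use
    (induction (parity · (double · v0) ≐₀ num0)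
      (↓ (rfl ⊛ double-zero ⨾ parity-zero))
      (↓ (rfl ⊛ double-suc _ ⨾ parity-suc _ ⨾ rfl ⊟ (parity-suc _ ⨾ not-zero (↑ h0)) ⨾ monus-self _)))
    (ε ▸ t))

  parity-suc-double : (t : Tm Γ nat) → Δ ⊩ parity · S′ (double · t) ≅ num1
  parity-suc-double t = parity-suc _ ⨾ not-zero (parity-double t)

  -- The equation for `double · t` is a hypothesis because this is also used inside the induction
  -- that proves it.
  half-suc-double : {t : Tm Γ nat} → Δ ⊩ half · (double · t) ≅ t → Δ ⊩ half · S′ (double · t) ≅ t
  half-suc-double e = half-suc _ ⨾ e ⊞ parity-double _ ⨾ plus-zero _

  half-double : (t : Tm Γ nat) → Δ ⊩ half · (double · t) ≅ t
  half-double t = ↑ (use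
    (induction (half · (double · v0) ≐₀ v0)
      (↓ (rfl ⊛ double-zero ⨾ half-zero))
      (↓ (rfl ⊛ double-suc _ ⨾ half-suc _ ⨾ half-suc-double (↑ h0) ⊞ parity-suc-double _
          ⨾ plus-suc _ _ ⨾ S-cong (plus-zero _))))
    (ε ▸ t))

  shift-zero : (t : Tm Γ nat) → Δ ⊩ shift · t · num0 ≅ t
  shift-zero t = δ₂ shiftBody (unfold shiftᴺ) t num0 ⨾ recZero _ _

  shift-suc : (t u : Tm Γ nat) → Δ ⊩ shift · t · S′ u ≅ half · (shift · t · u)
  shift-suc t u =
    δ₂ shiftBody (unfold shiftᴺ) t (S′ u) ⨾ recSucβ ε (half · v1) _ _ ⨾ rfl ⊛ (δ₂ shiftBody (unfold shiftᴺ) t u ⁻¹)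

  shift-half : (t u : Tm Γ nat) → Δ ⊩ shift · (half · t) · u ≅ half · (shift · t · u)
  shift-half t u = ↑ (use
    (induction (shift · (half · v1) · v0 ≐₀ half · (shift · v1 · v0))
      (↓ (shift-zero _ ⨾ rfl ⊛ (shift-zero _ ⁻¹)))
      (↓ (shift-suc _ _ ⨾ rfl ⊛ (↑ h0 ⨾ shift-suc _ _ ⁻¹))))
    (ε ▸ t ▸ u))

  code-suc : (β : Tm Γ 𝟏) (n : Tm Γ nat) → Δ ⊩ code · β · S′ n
    ≅ ite · (β · n) · (double · (code · β · n)) · S′ (double · (code · β · n))
  code-suc β n =
    δ₂ codeBody (unfold codeᴺ) β (S′ n)
    ⨾ recSucβ (ε ▸ β) (ite · (v2 · v0) · (double · v1) · S′ (double · v1)) _ _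
    ⨾ rfl ⊛ (rfl ⊛ (δ₂ codeBody (unfold codeᴺ) β n ⁻¹)) ⊛ S-cong (rfl ⊛ (δ₂ codeBody (unfold codeᴺ) β n ⁻¹))

  half-code : (β : Tm Γ 𝟏) (n : Tm Γ nat) → Δ ⊩ half · (code · β · S′ n) ≅ code · β · n
  half-code β n = ↑ (zeroOrSuc (β · n)
    (↓ (rfl ⊛ (code-suc _ _ ⨾ ite-zero (↑ h0)) ⨾ half-double _))
    (↓ (rfl ⊛ (code-suc _ _ ⨾ ite-suc (↑ h0)) ⨾ half-suc-double (half-double _))))

  parity-code : {β : Tm Γ 𝟏} {n : Tm Γ nat} → Δ ⊩ β · n ≤ᶠ num1 →
                Δ ⊩ parity · (code · β · S′ n) ≅ β · n
  parity-code d = ↑ (≤1-cases d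
    (↓ (rfl ⊛ (code-suc _ _ ⨾ ite-zero (↑ h0)) ⨾ parity-double _ ⨾ ↑ h0 ⁻¹))
    (↓ (rfl ⊛ (code-suc _ _ ⨾ ite-suc (↑ h0)) ⨾ parity-suc-double _ ⨾ ↑ h0 ⁻¹)))

  -- Each halving drops the last binary digit, by `half-code`.
  shift-code : (β : Tm Γ 𝟏) (m n : Tm Γ nat) → Δ ⊩ shift · (code · β · (m ⊕ n)) · n ≅ code · β · m
  shift-code β m n = ↑ (use
    (induction (shift · (code · v2 · (v1 ⊕ v0)) · v0 ≐₀ code · v2 · v1)
      (↓ (shift-zero _ ⨾ rfl ⊛ plus-zero _))
      -- The additional halving is moved inside, where it removes the last digit.
      (↓ (shift-suc _ _ ⨾ shift-half _ _ ⁻¹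
          ⨾ rfl ⊛ (rfl ⊛ (rfl ⊛ plus-suc _ _) ⨾ half-code _ _) ⊛ rfl ⨾ ↑ h0)))
    (ε ▸ β ▸ m ▸ n))

  -- Dropping `n ∸ S′ i` digits leaves the code of the first `S′ i` entries, whose parity is the
  -- entry at `i`.
  bits-code : {β : Tm Γ 𝟏} {i n : Tm Γ nat} → Δ ⊩ i <ᶠ n → Δ ⊩ β · i ≤ᶠ num1 →
              Δ ⊩ bits · n · (code · β · n) · i ≅ β · i
  bits-code {β = β} {i} {n} lt d =
    δ₃ bitsBody (unfold bitsᴺ) n (code · β · n) i
    ⨾ rfl ⊛ (rfl ⊛ (rfl ⊛ (≤-difference lt ⁻¹)) ⊛ rfl ⨾ shift-code β (S′ i) (n ∸ S′ i))
    ⨾ parity-code d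

  initial-bits-code : {β : Tm Γ 𝟏} {k n : Tm Γ nat} →
    Δ ⊩ all nat (v0 <ᶠ wkᵗ n ⊃ wkᵗ β · v0 ≤ᶠ num1) → Δ ⊩ k ≤ᶠ n →
    Δ ⊩ initial⁺ · (bits · n · (code · β · n)) · k ≅ initial⁺ · β · k
  initial-bits-code {β = β} {k} {n} d le = ↑ (use closed (ε ▸ β ▸ n ▸ k) ∙ d ∙ le)
    where
    binary : Fm (nat ∷ 𝟏 ∷ [])
    binary = all nat (v0 <ᶠ v1 ⊃ v2 · v0 ≤ᶠ num1)

    closed : [] ⊩ wk binary
      ⊃ v0 ≤ᶠ v1 ⊃ initial⁺ · (bits · v1 · (code · v2 · v1)) · v0 ≐₀ initial⁺ · v2 · v0
    -- The assumption of binary entries contains a quantifier, so it is a hypothesis of the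
    -- induction and not a part of the induction formula.
    closed = ⊃I (under (induct
      (v0 ≤ᶠ v1 ⊃ initial⁺ · (bits · v1 · (code · v2 · v1)) · v0 ≐₀ initial⁺ · v2 · v0)
      (⊃I (↓ (initial-zero _ ⨾ initial-zero _ ⁻¹)))
      (⊃I (↓ (initial-suc _ _
        ⨾ rfl ⊛ ↑ (h1 ∙ ≤-trans ≤-suc h0) ⊛ bits-code h0 (allE h2 v0 ∙ h0)
        ⨾ initial-suc _ _ ⁻¹)))))

  -- The leftmost path

  infixl 30 _·ˢ_

  _·ˢ_ : {f : Tm Γ (σ ⇒ τ)} {t : Tm Γ σ} → Δ ⊩ st f → Δ ⊩ st t → Δ ⊩ st (f · t)
  _·ˢ_ = st-application

  closedˢ : (t : Tm [] τ) → Δ ⊩ st {Γ = Γ} (subᵗ ε t)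
  closedˢ = st-term ε (λ ())

  zeroˢ : Δ ⊩ st {Γ = Γ} num0
  zeroˢ = st-con

  sucˢ : {t : Tm Γ nat} → Δ ⊩ st t → Δ ⊩ st (S′ t)
  sucˢ d = st-con ·ˢ d

  plusˢ : {t u : Tm Γ nat} → Δ ⊩ st t → Δ ⊩ st u → Δ ⊩ st (t ⊕ u)
  plusˢ d e = st-name ·ˢ d ·ˢ e

  monusˢ : {t u : Tm Γ nat} → Δ ⊩ st t → Δ ⊩ st u → Δ ⊩ st (t ∸ u)
  monusˢ d e = closedˢ monus ·ˢ d ·ˢ e

  snocˢ : {t u : Tm Γ nat} → Δ ⊩ st t → Δ ⊩ st u → Δ ⊩ st (snoc⁺ · t · u)
  snocˢ d e = st-name ·ˢ d ·ˢ e

  initialˢ : {β : Tm Γ 𝟏} {n : Tm Γ nat} → Δ ⊩ st β → Δ ⊩ st n → Δ ⊩ st (initial⁺ · β · n)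
  initialˢ d e = st-name ·ˢ d ·ˢ e

  <ˢ : {t u : Tm Γ nat} → Δ ⊩ st u → Δ ⊩ t <ᶠ u → Δ ⊩ st t
  <ˢ d e = st-≤ d (≤-trans ≤-suc e)

  ∃²At : Tm Γ 𝟐 → Fm Γ
  ∃²At φ = allˢᵗ 𝟏 (exˢᵗ nat (v1 · v0 ≐₀ num0) ⟺ wkᵗ φ · v0 ≐₀ num0)

  TreeAt : Tm Γ 𝟏 → Fm Γ
  TreeAt T = BinaryTree⁺ T ˢᵗ

  InfiniteAt : Tm Γ 𝟏 → Fm Γ
  InfiniteAt T = allˢᵗ nat (exˢᵗ 𝟏 (v0 ‾ v1 ∈⁺ wkᵗ (wkᵗ T)))

  ∃²-intro : {φ : Tm Γ 𝟐} {g : Tm Γ 𝟏} {x : Tm Γ nat} → Δ ⊩ ∃²At φ → Δ ⊩ st g → Δ ⊩ st x →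
             Δ ⊩ g · x ≅ num0 → Δ ⊩ φ · g ≅ num0
  ∃²-intro {φ = φ} {g} {x} d sg sx e = ↑ (use closed (ε ▸ φ ▸ g ▸ x) ∙ d ∙ sg ∙ sx ∙ ↓ e)
    where
    closed : [] ⊩ ∃²At v2 ⊃ st {Γ = nat ∷ 𝟏 ∷ 𝟐 ∷ []} v1 ⊃ st v0 ⊃ v1 · v0 ≐₀ num0 ⊃ v2 · v1 ≐₀ num0
    closed = ⊃I (⊃I (⊃I (⊃I (∧E₁ (allE h3 v1 ∙ h2) ∙ exI v0 (∧I h1 h0)))))

  ∃²-elim : {φ : Tm Γ 𝟐} {g : Tm Γ 𝟏} → Δ ⊩ ∃²At φ → Δ ⊩ st g →
            Δ ⊩ φ · g ≅ num0 → Δ ⊩ exˢᵗ nat (wkᵗ g · v0 ≐₀ num0)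
  ∃²-elim {φ = φ} {g} d sg e = use closed (ε ▸ φ ▸ g) ∙ d ∙ sg ∙ ↓ e
    where
    closed : [] ⊩ ∃²At v1 ⊃ st {Γ = 𝟏 ∷ 𝟐 ∷ []} v0 ⊃ v1 · v0 ≐₀ num0 ⊃ exˢᵗ nat (v1 · v0 ≐₀ num0)
    closed = ⊃I (⊃I (⊃I (∧E₂ (allE h2 v0 ∙ h1) ∙ h0)))

  tree-parent : {T : Tm Γ 𝟏} {s x : Tm Γ nat} → Δ ⊩ TreeAt T → Δ ⊩ st s → Δ ⊩ st x →
                Δ ⊩ T · (snoc⁺ · s · x) ≅ num0 → Δ ⊩ T · s ≐₀ num0 ∧ x ≤ᶠ num1
  tree-parent {T = T} {s} {x} d ss sx e = use closed (ε ▸ T ▸ s ▸ x) ∙ d ∙ ss ∙ sx ∙ ↓ e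
    where
    closed : [] ⊩ TreeAt v2 ⊃ st {Γ = nat ∷ nat ∷ 𝟏 ∷ []} v1 ⊃ st v0
      ⊃ v2 · (snoc⁺ · v1 · v0) ≐₀ num0 ⊃ v2 · v1 ≐₀ num0 ∧ v0 ≤ᶠ num1
    closed = ⊃I (⊃I (⊃I (allE (allE (∧E₂ h2) v1 ∙ h1) v0 ∙ h0)))

  tree-initial-suc : {T β : Tm Γ 𝟏} {n : Tm Γ nat} → Δ ⊩ TreeAt T → Δ ⊩ st β → Δ ⊩ st n →
                     Δ ⊩ T · (initial⁺ · β · S′ n) ≅ num0 →
                     Δ ⊩ T · (initial⁺ · β · n) ≐₀ num0 ∧ β · n ≤ᶠ num1
  tree-initial-suc d sβ sn e =
    tree-parent d (initialˢ sβ sn) (sβ ·ˢ sn) (rfl ⊛ (initial-suc _ _ ⁻¹) ⨾ e)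

  -- Standard induction on `d`, as `TreeAt` permits removal of the last entry only at standard
  -- arguments.
  tree-down : {T β : Tm Γ 𝟏} {k d : Tm Γ nat} → Δ ⊩ TreeAt T → Δ ⊩ st β → Δ ⊩ st k → Δ ⊩ st d →
              Δ ⊩ T · (initial⁺ · β · (k ⊕ d)) ≅ num0 → Δ ⊩ T · (initial⁺ · β · k) ≅ num0
  tree-down {T = T} {β} {k} {d} tree sβ sk sd e =
    ↑ (use closed (ε ▸ T ▸ β ▸ k ▸ d) ∙ tree ∙ sβ ∙ sk ∙ sd ∙ ↓ e)
    where
    closed : [] ⊩ TreeAt v3 ⊃ st {Γ = nat ∷ nat ∷ 𝟏 ∷ 𝟏 ∷ []} v2 ⊃ st v1 ⊃ st v0
      ⊃ v2 ‾ v1 ⊕ v0 ∈⁺ v3 ⊃ v2 ‾ v1 ∈⁺ v3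
    closed = ⊃I (⊃I (⊃I (⊃I (allE (st-induction (v3 ‾ v2 ⊕ v0 ∈⁺ v4 ⊃ v3 ‾ v2 ∈⁺ v4)
      (⊃I (↓ (rfl ⊛ (rfl ⊛ (plus-zero _ ⁻¹)) ⨾ ↑ h0)))
      (allI (⊃I (⊃I (⊃I (h1 ∙
        ∧E₁ (tree-initial-suc {n = v2 ⊕ v0} (# 6) (# 5) (plusˢ (# 4) h2)
          (rfl ⊛ (rfl ⊛ (plus-suc _ _ ⁻¹)) ⨾ ↑ h0)))))))) v0 ∙ h0))))

  test-eq : (T : Tm Γ 𝟏) (n s k j : Tm Γ nat) → Δ ⊩ test · T · n · s · k · j
    ≅ T · (initial⁺ · (bits · n · j) · n) ⊕ dist (initial⁺ · (bits · n · j) · k) s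
  test-eq T n s k j =
    δ₃ (lam (lam testBody)) (unfold testᴺ) T n s ⊛ rfl ⊛ rfl ⨾ β₂ (ε ▸ T ▸ n ▸ s) testBody k j

  testˢ : {T : Tm Γ 𝟏} {n s k : Tm Γ nat} → Δ ⊩ st T → Δ ⊩ st n → Δ ⊩ st s → Δ ⊩ st k →
          Δ ⊩ st (test · T · n · s · k)
  testˢ dT dn ds dk = st-name ·ˢ dT ·ˢ dn ·ˢ ds ·ˢ dk

  Extendible : Tm Γ 𝟏 → Tm Γ nat → Tm Γ nat → Tm Γ nat → Fm Γ
  Extendible T n s k = exˢᵗ 𝟏 (v0 ‾ wkᵗ n ∈⁺ wkᵗ T ∧ initial⁺ · v0 · wkᵗ k ≐₀ wkᵗ s)

  extendible : {T β : Tm Γ 𝟏} {n s k : Tm Γ nat} → Δ ⊩ st β →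
               Δ ⊩ T · (initial⁺ · β · n) ≅ num0 → Δ ⊩ initial⁺ · β · k ≅ s → Δ ⊩ Extendible T n s k
  extendible {T = T} {β} {n} {s} {k} sβ e e′ =
    use closed (ε ▸ T ▸ β ▸ n ▸ s ▸ k) ∙ sβ ∙ ↓ e ∙ ↓ e′
    where
    closed : [] ⊩ st {Γ = nat ∷ nat ∷ nat ∷ 𝟏 ∷ 𝟏 ∷ []} v3 ⊃ v3 ‾ v2 ∈⁺ v4
      ⊃ initial⁺ · v3 · v0 ≐₀ v1 ⊃ Extendible v4 v2 v1 v0
    closed = ⊃I (⊃I (⊃I (exI v3 (∧I h2 (∧I h1 h0)))))

  private
    initial-binary : {T β : Tm Γ 𝟏} {n : Tm Γ nat} → Δ ⊩ TreeAt T → Δ ⊩ st β → Δ ⊩ st n →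
      Δ ⊩ T · (initial⁺ · β · n) ≅ num0 → Δ ⊩ all nat (v0 <ᶠ wkᵗ n ⊃ wkᵗ β · v0 ≤ᶠ num1)
    initial-binary {T = T} {β} {n} tree sβ sn e = use closed (ε ▸ T ▸ β ▸ n) ∙ tree ∙ sβ ∙ sn ∙ ↓ e
      where
      closed : [] ⊩ TreeAt v2 ⊃ st {Γ = nat ∷ 𝟏 ∷ 𝟏 ∷ []} v1 ⊃ st v0 ⊃ v1 ‾ v0 ∈⁺ v2
        ⊃ all nat (v0 <ᶠ v1 ⊃ v2 · v0 ≤ᶠ num1)
      closed = ⊃I (⊃I (⊃I (⊃I (allI (⊃I (∧E₂ (tree-initial-suc (# 4) (# 3) (<ˢ (# 2) h0)
        (tree-down (# 4) (# 3) (sucˢ (<ˢ (# 2) h0)) (monusˢ (# 2) (sucˢ (<ˢ (# 2) h0)))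
          (rfl ⊛ (rfl ⊛ ≤-difference h0) ⨾ ↑ h1)))))))))

  -- `W` stands for `test`, of which only this specification and standardness enter the construction
  -- of `mortal`. The first half assumes `k ≤ᶠ n` because a code of length `n` yields only the
  -- entries below `n`.
  Decides : Tm Γ 𝟐 → Tm Γ (𝟏 ⇒ nat ⇒ nat ⇒ nat ⇒ 𝟏) → Tm Γ 𝟏 → Tm Γ nat → Tm Γ nat → Tm Γ nat → Fm Γ
  Decides φ W T n s k =
    (k ≤ᶠ n ⊃ Extendible T n s k ⊃ φ · (W · T · n · s · k) ≐₀ num0)
    ∧ (φ · (W · T · n · s · k) ≐₀ num0 ⊃ Extendible T n s k)

  -- An extension `β` gives the zero `code · β · n` of the test; conversely a zero `j` gives the
  -- extension `bits · n · j`.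
  test-decides :
    [] ⊩ ∃²At v4 ⊃ TreeAt v3 ⊃ st {Γ = nat ∷ nat ∷ nat ∷ 𝟏 ∷ 𝟐 ∷ []} v3 ⊃ st v2 ⊃ st v1 ⊃ st v0
    ⊃ Decides v4 test v3 v2 v1 v0
  test-decides = ⊃I (⊃I (⊃I (⊃I (⊃I (⊃I (∧I
    (⊃I (⊃I (exE h0 (↓ (∃²-intro (# 8) (testˢ (# 6) (# 5) (# 4) (# 3))
        (st-name ·ˢ ∧E₁ h0 ·ˢ # 5)
        (test-eq _ _ _ _ _ ⨾ plus-0-0
          (rfl ⊛ initial-bits-code (initial-binary (# 7) (∧E₁ h0) (# 5) (↑ (∧E₁ (∧E₂ h0)))) ≤-refl
            ⨾ ↑ (∧E₁ (∧E₂ h0)))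
          (dist-refl (initial-bits-code
              (initial-binary (# 7) (∧E₁ h0) (# 5) (↑ (∧E₁ (∧E₂ h0)))) (# 2)
            ⨾ ↑ (∧E₂ (∧E₂ h0))))))))))
    (⊃I (exE (∃²-elim (# 6) (testˢ (# 4) h3 h2 h1) (↑ h0))
        (exI (bits · v3 · v0) (∧I (st-name ·ˢ # 4 ·ˢ ∧E₁ h0)
          (∧I (↓ (plus≡0ˡ (test-eq _ _ _ _ _ ⁻¹ ⨾ ↑ (∧E₂ h0))))
              (↓ (dist≡0 (plus≡0ʳ (test-eq _ _ _ _ _ ⁻¹ ⨾ ↑ (∧E₂ h0))))))))))))))))

  infixl 5 _▹_

  _▹_ : {s : Sub (extended 𝒮) Γ Γ₁} {t : Tm Γ₁ σ} {Δ : Hyps Γ₁} →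
        (∀ {τ} (x : τ ∈ Γ) → Δ ⊩ st (s x)) → Δ ⊩ st t → ∀ {τ} (x : τ ∈ σ ∷ Γ) → Δ ⊩ st ((s ▸ t) x)
  (d ▹ e) (here refl) = e
  (d ▹ e) (there x)   = d x

  noVars : ∀ {Δ : Hyps Γ} {τ} (x : τ ∈ []) → Δ ⊩ st (ε x)
  noVars ()

  private
    cutoffBody : Tm (nat ∷ nat ∷ nat ∷ 𝟏 ∷ (𝟏 ⇒ nat ⇒ nat ⇒ nat ⇒ 𝟏) ∷ 𝟐 ∷ []) nat
    cutoffBody = not (v5 · (v4 · v3 · (v1 ⊕ v0) · v2 · v1))

  module _ (φ : Tm Γ 𝟐) (W : Tm Γ (𝟏 ⇒ nat ⇒ nat ⇒ nat ⇒ 𝟏)) where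

    -- A zero m of cutoff certifies that the node s of length k has no extension
    -- in T of length k + m.
    cutoff : Tm Γ 𝟏 → Tm Γ nat → Tm Γ nat → Tm Γ 𝟏
    cutoff T s k = subᵗ (ε ▸ φ ▸ W ▸ T ▸ s ▸ k) (lam cutoffBody)

    -- The second application of `φ`: a zero value says that for some standard length the node has
    -- no extension. The first application is inside `cutoff`.
    mortal : Tm Γ (𝟏 ⇒ nat ⇒ nat ⇒ nat)
    mortal = subᵗ (ε ▸ φ ▸ W) (lam (lam (lam (v4 · lam cutoffBody))))

    cutoff-eq : (T : Tm Γ 𝟏) (s k m : Tm Γ nat) →
                Δ ⊩ cutoff T s k · m ≅ not (φ · (W · T · (k ⊕ m) · s · k))
    cutoff-eq T s k m = β₁ (ε ▸ φ ▸ W ▸ T ▸ s ▸ k) cutoffBody m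

    mortal-eq : (T : Tm Γ 𝟏) (s k : Tm Γ nat) → Δ ⊩ mortal · T · s · k ≅ φ · cutoff T s k
    mortal-eq T s k = β₃ (ε ▸ φ ▸ W) (v4 · lam cutoffBody) T s k

  Mortality : Tm Γ (𝟏 ⇒ nat ⇒ nat ⇒ nat) → Tm Γ 𝟏 → Tm Γ nat → Tm Γ nat → Fm Γ
  Mortality M T s k =
    (¬ᶠ (M · T · s · k ≐₀ num0) ⊃ allˢᵗ nat (Extendible (wkᵗ T) (wkᵗ k ⊕ v0) (wkᵗ s) (wkᵗ k)))
    ∧ (M · T · s · k ≐₀ num0 ⊃ exˢᵗ nat (¬ᶠ Extendible (wkᵗ T) (wkᵗ k ⊕ v0) (wkᵗ s) (wkᵗ k)))

  -- If the inner value of `φ` at some `m` were nonzero, `m` would be a zero of `cutoff` and the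
  -- outer value zero. Conversely, a standard zero of `cutoff` gives a nonzero inner value, which
  -- excludes an extension.
  mortality :
    [] ⊩ ∃²At v4 ⊃ st {Γ = nat ∷ nat ∷ 𝟏 ∷ _ ∷ 𝟐 ∷ []} v4 ⊃ st v3 ⊃ st v2 ⊃ st v1 ⊃ st v0
    ⊃ allˢᵗ nat (Decides v5 v4 v3 v0 v2 v1)
    ⊃ Mortality (mortal v4 v3) v2 v1 v0
  mortality = ⊃I (⊃I (⊃I (⊃I (⊃I (⊃I (⊃I (∧I
    (⊃I (allI (⊃I (byCases (v5 · (v4 · v3 · (v1 ⊕ v0) · v2 · v1) ≐₀ num0)
      (∧E₂ (allE (# 3) (v1 ⊕ v0) ∙ plusˢ (# 4) (# 1)) ∙ h0)
      (exFalso (# 2 ∙ ↓ (mortal-eq v5 v4 v3 v2 v1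
        ⨾ ∃²-intro (# 9)
            (st-term (ε ▸ v5 ▸ v4 ▸ v3 ▸ v2 ▸ v1) (noVars ▹ # 8 ▹ # 7 ▹ # 6 ▹ # 5 ▹ # 4) (lam cutoffBody)) (# 1)
            (cutoff-eq v5 v4 v3 v2 v1 v0 ⨾ not-suc (nonzero h0)))))))))
    (⊃I (exE (∃²-elim (# 7) (st-term (ε ▸ v4 ▸ v3 ▸ v2 ▸ v1 ▸ v0) (noVars ▹ # 6 ▹ # 5 ▹ # 4 ▹ # 3 ▹ # 2) (lam cutoffBody))
          (mortal-eq v4 v3 v2 v1 v0 ⁻¹ ⨾ ↑ h0))
      (exI v0 (∧I (∧E₁ h0) (⊃I
        (not≡0 (cutoff-eq v5 v4 v3 v2 v1 v0 ⁻¹ ⨾ ↑ (∧E₂ h1))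
          ∙ (∧E₁ (allE (# 3) (v1 ⊕ v0) ∙ plusˢ (# 4) (∧E₁ h1)) ∙ ≤-plus ∙ h0))))))))))))))

  MortalitySpec : Tm Γ (𝟏 ⇒ nat ⇒ nat ⇒ nat) → Tm Γ 𝟏 → Fm Γ
  MortalitySpec M T = allˢᵗ nat (allˢᵗ nat (Mortality (wkᵗ (wkᵗ M)) (wkᵗ (wkᵗ T)) v1 v0))

  private
    DecidesAll : Tm Γ 𝟐 → Tm Γ (𝟏 ⇒ nat ⇒ nat ⇒ nat ⇒ 𝟏) → Fm Γ
    DecidesAll φ W = allˢᵗ 𝟏 (TreeAt v0 ⊃ allˢᵗ nat (allˢᵗ nat (allˢᵗ nat
      (Decides (wkᵗ (wkᵗ (wkᵗ (wkᵗ φ)))) (wkᵗ (wkᵗ (wkᵗ (wkᵗ W)))) v3 v0 v2 v1))))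

    -- The existential quantifier lets the construction of the path work with a variable in place of
    -- the large term `mortal`.
    SomeMortality : Fm Γ
    SomeMortality = exˢᵗ (𝟏 ⇒ nat ⇒ nat ⇒ nat) (allˢᵗ 𝟏 (TreeAt v0 ⊃ MortalitySpec v1 v0))

    mortality-from : [] ⊩ ∃²At v1 ⊃ st {Γ = _ ∷ 𝟐 ∷ []} v1 ⊃ st v0 ⊃ DecidesAll v1 v0 ⊃ SomeMortality
    mortality-from = ⊃I (⊃I (⊃I (⊃I (exI (mortal v1 v0)
      (∧I (st-term (ε ▸ v1 ▸ v0) (noVars ▹ h2 ▹ h1) (lam (lam (lam (v4 · lam cutoffBody)))))
        (allI (⊃I (⊃I (allI (⊃I (allI (⊃I
          (use mortality (ε ▸ v4 ▸ v3 ▸ v2 ▸ v1 ▸ v0) ∙ # 7 ∙ # 6 ∙ # 5 ∙ # 3 ∙ # 1 ∙ # 0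
            ∙ (allE (allE (allE (# 4) v2 ∙ # 3 ∙ # 2) v1 ∙ # 1) v0 ∙ # 0))))))))))))))

  someMortality : {φ : Tm Γ 𝟐} → Δ ⊩ ∃²At φ → Δ ⊩ st φ → Δ ⊩ SomeMortality
  someMortality {φ = φ} d sφ = use closed (ε ▸ φ) ∙ d ∙ sφ
    where
    closed : [] ⊩ ∃²At {𝟐 ∷ []} v0 ⊃ st v0 ⊃ SomeMortality
    closed = ⊃I (⊃I (use mortality-from (ε ▸ v0 ▸ test) ∙ h1 ∙ h0 ∙ closedˢ test
      ∙ allI (⊃I (⊃I (allI (⊃I (allI (⊃I (allI (⊃I
         (use test-decides (ε ▸ v4 ▸ v3 ▸ v0 ▸ v2 ▸ v1)
           ∙ # 6 ∙ # 3 ∙ # 4 ∙ # 0 ∙ # 2 ∙ # 1)))))))))))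

  module _ (M : Tm Γ (𝟏 ⇒ nat ⇒ nat ⇒ nat)) (T : Tm Γ 𝟏) where

    node-zero : Δ ⊩ node · M · T · num0 ≅ num0
    node-zero = δ₃ nodeBody (unfold nodeᴺ) M T num0 ⨾ recZero _ _

    path-eq : (k : Tm Γ nat) →
              Δ ⊩ path · M · T · k ≅ not (M · T · (snoc⁺ · (node · M · T · k) · num0) · S′ k)
    path-eq k = δ₃ pathBody (unfold pathᴺ) M T k

    node-suc : (k : Tm Γ nat) →
               Δ ⊩ node · M · T · S′ k ≅ snoc⁺ · (node · M · T · k) · (path · M · T · k)
    node-suc k =
      δ₃ nodeBody (unfold nodeᴺ) M T (S′ k)
      ⨾ recSucβ (ε ▸ M ▸ T) (snoc⁺ · v1 · not (v3 · v2 · (snoc⁺ · v1 · num0) · S′ v0)) _ _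
      ⨾ rfl ⊛ node-eq ⊛ (rfl ⊟ (rfl ⊛ (rfl ⊛ node-eq ⊛ rfl) ⊛ rfl) ⨾ path-eq k ⁻¹)
      where
      node-eq = δ₃ nodeBody (unfold nodeᴺ) M T k ⁻¹

  initial-path : (M : Tm Γ (𝟏 ⇒ nat ⇒ nat ⇒ nat)) (T : Tm Γ 𝟏) (k : Tm Γ nat) →
                 Δ ⊩ initial⁺ · (path · M · T) · k ≅ node · M · T · k
  initial-path M T k = ↑ (use
    (induction (initial⁺ · (path · v2 · v1) · v0 ≐₀ node · v2 · v1 · v0)
      (↓ (initial-zero _ ⨾ node-zero _ _ ⁻¹))
      (↓ (initial-suc _ _ ⨾ rfl ⊛ ↑ h0 ⊛ rfl ⨾ node-suc _ _ _ ⁻¹)))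
    (ε ▸ M ▸ T ▸ k))

  -- `β` is long enough to pass both bounds. Its entry at `k` is 0 or 1, and cutting `β` back to the
  -- bound of that child gives an extension which was excluded.
  no-branching : {T β : Tm Γ 𝟏} {s k m₀ m₁ : Tm Γ nat} →
    Δ ⊩ TreeAt T → Δ ⊩ st β → Δ ⊩ st k → Δ ⊩ st m₀ → Δ ⊩ st m₁ →
    Δ ⊩ T · (initial⁺ · β · (k ⊕ S′ (m₀ ⊕ m₁))) ≅ num0 → Δ ⊩ initial⁺ · β · k ≅ s →
    Δ ⊩ ¬ᶠ Extendible T (S′ k ⊕ m₀) (snoc⁺ · s · num0) (S′ k) →
    Δ ⊩ ¬ᶠ Extendible T (S′ k ⊕ m₁) (snoc⁺ · s · num1) (S′ k) → Δ ⊩ ⊥ᶠ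
  no-branching {T = T} {β} {s} {k} {m₀} {m₁} tree sβ sk s₀ s₁ e e′ d₀ d₁ =
    ≤1-cases (∧E₂ (tree-initial-suc tree sβ sk
        (tree-down tree sβ (sucˢ sk) (plusˢ s₀ s₁) (rfl ⊛ (rfl ⊛ (suc-plus _ _ ⨾ plus-suc _ _ ⁻¹)) ⨾ e))))
      (w d₀ ∙ extendible (w sβ)
        (w≅ (tree-down tree sβ (plusˢ (sucˢ sk) s₀) s₁
          (rfl ⊛ (rfl ⊛ (plus-assoc _ _ _ ⨾ suc-plus _ _ ⨾ plus-suc _ _ ⁻¹)) ⨾ e)))
        (initial-suc _ _ ⨾ rfl ⊛ w≅ e′ ⊛ ↑ h0))
      (w d₁ ∙ extendible (w sβ)
        (w≅ (tree-down tree sβ (plusˢ (sucˢ sk) s₁) s₀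
          (rfl ⊛ (rfl ⊛ (plus-assoc _ _ _ ⨾ rfl ⊞ plus-comm _ _ ⨾ suc-plus _ _ ⨾ plus-suc _ _ ⁻¹)) ⨾ e)))
        (initial-suc _ _ ⨾ rfl ⊛ w≅ e′ ⊛ ↑ h0))

  immortal-child : {M : Tm Γ (𝟏 ⇒ nat ⇒ nat ⇒ nat)} {T : Tm Γ 𝟏} {s k : Tm Γ nat} →
    Δ ⊩ MortalitySpec M T → Δ ⊩ TreeAt T → Δ ⊩ st s → Δ ⊩ st k →
    Δ ⊩ ¬ᶠ (M · T · s · k ≐₀ num0) →
    Δ ⊩ M · T · (snoc⁺ · s · num0) · S′ k ≅ num0 →
    Δ ⊩ ¬ᶠ (M · T · (snoc⁺ · s · num1) · S′ k ≐₀ num0)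
  immortal-child {M = M} {T} {s} {k} spec tree ss sk d e =
    use closed (ε ▸ M ▸ T ▸ s ▸ k) ∙ spec ∙ tree ∙ ss ∙ sk ∙ d ∙ ↓ e
    where
    closed : [] ⊩ MortalitySpec {nat ∷ nat ∷ 𝟏 ∷ _ ∷ []} v3 v2 ⊃ TreeAt v2 ⊃ st v1 ⊃ st v0
      ⊃ ¬ᶠ (v3 · v2 · v1 · v0 ≐₀ num0)
      ⊃ v3 · v2 · (snoc⁺ · v1 · num0) · S′ v0 ≐₀ num0
      ⊃ ¬ᶠ (v3 · v2 · (snoc⁺ · v1 · num1) · S′ v0 ≐₀ num0)
    closed = ⊃I (⊃I (⊃I (⊃I (⊃I (⊃I (⊃I
      (exE (∧E₂ (allE (allE (# 6) (snoc⁺ · v1 · num0) ∙ snocˢ (# 4) zeroˢ) (S′ v0) ∙ sucˢ (# 3)) ∙ # 1)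
      (exE (∧E₂ (allE (allE (# 7) (snoc⁺ · v2 · num1) ∙ snocˢ (# 5) (sucˢ zeroˢ)) (S′ v1) ∙ sucˢ (# 4)) ∙ # 1)
      (exE (allE (∧E₁ (allE (allE (# 8) v3 ∙ # 6) v2 ∙ # 5) ∙ # 4) (S′ (v1 ⊕ v0))
             ∙ sucˢ (plusˢ (∧E₁ (# 1)) (∧E₁ (# 0))))
        (no-branching (# 8) (∧E₁ h0) (# 6) (∧E₁ h2) (∧E₁ h1)
          (↑ (∧E₁ (∧E₂ h0))) (↑ (∧E₂ (∧E₂ h0))) (∧E₂ h2) (∧E₂ h1)))))))))))

  -- If the child with entry 0 is mortal, the path takes entry 1, which is safe by `immortal-child`;
  -- otherwise it takes entry 0.
  immortal-node : {M : Tm Γ (𝟏 ⇒ nat ⇒ nat ⇒ nat)} {T : Tm Γ 𝟏} {k : Tm Γ nat} →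
    Δ ⊩ MortalitySpec M T → Δ ⊩ TreeAt T → Δ ⊩ st M → Δ ⊩ st T → Δ ⊩ st k →
    Δ ⊩ ¬ᶠ (M · T · (node · M · T · k) · k ≐₀ num0) →
    Δ ⊩ ¬ᶠ (M · T · (node · M · T · S′ k) · S′ k ≐₀ num0)
  immortal-node {M = M} {T} {k} spec tree sM sT sk d = ⊃I
    (byCases (M · T · (snoc⁺ · (node · M · T · k) · num0) · S′ k ≐₀ num0)
      (immortal-child (w (w spec)) (w (w tree)) (st-name ·ˢ w (w sM) ·ˢ w (w sT) ·ˢ w (w sk))
          (w (w sk)) (w (w d)) (↑ h0)
        ∙ ↓ (rfl ⊛ ((node-suc M T k ⨾ rfl ⊛ (path-eq M T k ⨾ not-zero (↑ h0))) ⁻¹) ⊛ rfl ⨾ ↑ h1))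
      (h0 ∙ ↓ (rfl ⊛ ((node-suc M T k ⨾ rfl ⊛ (path-eq M T k ⨾ not-suc (nonzero h0))) ⁻¹) ⊛ rfl ⨾ ↑ h1)))

  -- Expressed by `M`, immortality is quantifier-free, so standard induction applies. An immortal
  -- node has an extension of its own length, namely itself, and so lies in the tree.
  path-in-tree : {M : Tm Γ (𝟏 ⇒ nat ⇒ nat ⇒ nat)} {T : Tm Γ 𝟏} →
    Δ ⊩ MortalitySpec M T → Δ ⊩ TreeAt T → Δ ⊩ InfiniteAt T → Δ ⊩ st M → Δ ⊩ st T →
    Δ ⊩ allˢᵗ nat ((wkᵗ (path · M · T)) ‾ v0 ∈⁺ wkᵗ T)
  path-in-tree {M = M} {T} spec tree infinite sM sT =
    use closed (ε ▸ M ▸ T) ∙ spec ∙ tree ∙ infinite ∙ sM ∙ sT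
    where
    Γ′ : Ctx
    Γ′ = 𝟏 ∷ (𝟏 ⇒ nat ⇒ nat ⇒ nat) ∷ []

    Δ′ : Hyps Γ′
    Δ′ = st v0 ∷ st v1 ∷ InfiniteAt v0 ∷ TreeAt v0 ∷ MortalitySpec v1 v0 ∷ []

    nodeˢ : ∀ {Δ} → Δ ⊩ st v2 → Δ ⊩ st v1 → Δ ⊩ st v0 →
            Δ ⊩ st {Γ = nat ∷ Γ′} (node · v2 · v1 · v0)
    nodeˢ sM sT sk = st-name ·ˢ sM ·ˢ sT ·ˢ sk

    immortal : Δ′ ⊩ allˢᵗ nat (¬ᶠ (v2 · v1 · (node · v2 · v1 · v0) · v0 ≐₀ num0))
    immortal = st-induction (¬ᶠ (v2 · v1 · (node · v2 · v1 · v0) · v0 ≐₀ num0))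
      -- A mortal root would exclude sequences of some standard length from an infinite tree.
      (⊃I (exE (∧E₂ (allE (allE (# 5) (node · v1 · v0 · num0) ∙ (st-name ·ˢ # 2 ·ˢ # 1 ·ˢ zeroˢ))
                       num0 ∙ zeroˢ) ∙ h0)
        (exE (allE (# 4) v0 ∙ ∧E₁ h0)
          (∧E₂ h1 ∙ extendible (∧E₁ h0) (rfl ⊛ (rfl ⊛ zero-plus _) ⨾ ↑ (∧E₂ h0))
            (initial-zero _ ⨾ node-zero _ _ ⁻¹)))))
      (allI (⊃I (⊃I (immortal-node (# 6) (# 5) (# 3) (# 2) (# 1) h0))))

    closed : [] ⊩ MortalitySpec {Γ′} v1 v0 ⊃ TreeAt v0 ⊃ InfiniteAt v0 ⊃ st v1 ⊃ st v0
      ⊃ allˢᵗ nat ((path · v2 · v1) ‾ v0 ∈⁺ v1)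
    closed = ⊃I (⊃I (⊃I (⊃I (⊃I (⊃I (allI (⊃I
      (exE (allE (∧E₁ (allE (allE (# 6) (node · v2 · v1 · v0) ∙ nodeˢ (# 3) (# 2) (# 0)) v0 ∙ # 0)
              ∙ (allE (# 1) v0 ∙ # 0)) num0 ∙ zeroˢ)
        (↓ (rfl ⊛ (initial-path _ _ _ ⨾ ↑ (∧E₂ (∧E₂ h0)) ⁻¹ ⨾ rfl ⊛ (plus-zero _ ⁻¹))
          ⨾ ↑ (∧E₁ (∧E₂ h0))))))) ∙ immortal)))))

  -- Trees of constant sequences

  const-eq : (b n : Tm Γ nat) → Δ ⊩ const b · n ≅ b
  const-eq b n = equation (fromBase (K-eq b n))

  probe-eq : (b s n : Tm Γ nat) → Δ ⊩ probe · b · s · n ≅ dist (initial⁺ · const b · n) s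
  probe-eq b s n = δ₃ probeBody (unfold probeᴺ) b s n

  -- A code bounds its length, so the search up to `s` meets `n`.
  constant-intro : {b s n : Tm Γ nat} → Δ ⊩ initial⁺ · const b · n ≅ s → Δ ⊩ isConstant · b · s ≅ num0
  constant-intro {b = b} {s} {n} e =
    δ₂ isConstantBody (unfold isConstantᴺ) b s
    ⨾ search-finds (S≤S (≤-trans (≤-initial (const b) n) (≤-reflexive e)))
        (probe-eq b s n ⨾ dist-refl e)

  constant-elim : {b s : Tm Γ nat} → Δ ⊩ isConstant · b · s ≅ num0 →
                  Δ ⊩ initial⁺ · const b · (search · (probe · b · s) · S′ s) ≅ s
  constant-elim {b = b} {s} e = dist≡0 (probe-eq b s _ ⁻¹ ⨾ δ₂ isConstantBody (unfold isConstantᴺ) b s ⁻¹ ⨾ e)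

  -- The code is nonzero, so the length found is a successor, and injectivity of `snoc⁺` splits off
  -- the last entry.
  constant-snoc : {b s x : Tm Γ nat} → Δ ⊩ isConstant · b · (snoc⁺ · s · x) ≅ num0 →
                  Δ ⊩ isConstant · b · s ≐₀ num0 ∧ x ≐₀ b
  constant-snoc {b = b} {s} {x} e = zeroOrSuc n
    (exFalso (snoc≢0 (w≅ (constant-elim e ⁻¹) ⨾ rfl ⊛ ↑ h0 ⨾ initial-zero _)))
    (let equal = snoc-inj (rfl ⊛ rfl ⊛ (const-eq b (pred · n) ⁻¹) ⨾ initial-suc _ _ ⁻¹
                    ⨾ rfl ⊛ (↑ h0 ⁻¹) ⨾ w≅ (constant-elim e))
     in ∧I (↓ (constant-intro (proj₁ equal))) (↓ (proj₂ equal ⁻¹)))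
    where
    n = search · (probe · b · (snoc⁺ · s · x)) · S′ (snoc⁺ · s · x)

  module _ (f₀ f₁ : Tm Γ 𝟏) (s : Tm Γ nat) where

    tree-eq : Δ ⊩ tree · f₀ · f₁ · s
      ≅ ite · (isConstant · num0 · s ⊕ sum · f₀ · s) · num0 · sg (isConstant · num1 · s ⊕ sum · f₁ · s)
    tree-eq = δ₃ treeBody (unfold treeᴺ) f₀ f₁ s

  tree-introˡ : {f₀ f₁ : Tm Γ 𝟏} {s : Tm Γ nat} → Δ ⊩ isConstant · num0 · s ≅ num0 →
                Δ ⊩ sum · f₀ · s ≅ num0 → Δ ⊩ tree · f₀ · f₁ · s ≅ num0
  tree-introˡ d e = tree-eq _ _ _ ⨾ ite-zero (plus-0-0 d e)

  tree-introʳ : {f₀ f₁ : Tm Γ 𝟏} {s : Tm Γ nat} → Δ ⊩ isConstant · num1 · s ≅ num0 →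
                Δ ⊩ sum · f₁ · s ≅ num0 → Δ ⊩ tree · f₀ · f₁ · s ≅ num0
  tree-introʳ {f₀ = f₀} {f₁} {s} d e = ↑ (zeroOrSuc (isConstant · num0 · s ⊕ sum · f₀ · s)
    (↓ (tree-eq f₀ f₁ s ⨾ ite-zero (↑ h0)))
    (↓ (tree-eq f₀ f₁ s ⨾ ite-suc (↑ h0) ⨾ ite-zero (w≅ (plus-0-0 d e)))))

  tree-elim : {f₀ f₁ : Tm Γ 𝟏} {s : Tm Γ nat} → Δ ⊩ tree · f₀ · f₁ · s ≅ num0 →
    isConstant · num0 · s ≐₀ num0 ∧ sum · f₀ · s ≐₀ num0 ∷ Δ ⊩ C →
    isConstant · num1 · s ≐₀ num0 ∧ sum · f₁ · s ≐₀ num0 ∷ Δ ⊩ C → Δ ⊩ C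
  tree-elim {f₀ = f₀} {f₁} {s} e c₀ c₁ = zeroOrSuc (isConstant · num0 · s ⊕ sum · f₀ · s)
    (w (⊃I c₀) ∙ ∧I (↓ (plus≡0ˡ (↑ h0))) (↓ (plus≡0ʳ (↑ h0))))
    (w (⊃I c₁) ∙ ∧I (↓ (plus≡0ˡ e₁)) (↓ (plus≡0ʳ e₁)))
    where
    e₁ = sg≡0 (ite-suc (↑ h0) ⁻¹ ⨾ tree-eq f₀ f₁ s ⁻¹ ⨾ w≅ e)

  tree-binary : (f₀ f₁ : Tm Γ 𝟏) → Δ ⊩ BinaryTree⁺ (tree · f₀ · f₁)
  tree-binary f₀ f₁ = use closed (ε ▸ f₀ ▸ f₁)
    where
    closed : [] ⊩ BinaryTree⁺ {Γ = 𝟏 ∷ 𝟏 ∷ []} (tree · v1 · v0)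
    closed = ∧I
      (allI (≤-trans (≤-reflexive (tree-eq v2 v1 v0))
        (zeroOrSuc (isConstant · num0 · v0 ⊕ sum · v2 · v0)
          (≤-trans (≤-reflexive (ite-zero (↑ h0))) 0≤)
          (≤-trans (≤-reflexive (ite-suc (↑ h0))) sg≤1))))
      (allI (allI (⊃I (tree-elim {f₀ = v3} {v2} {snoc⁺ · v1 · v0} (↑ h0)
        (∧I (↓ (tree-introˡ (↑ (∧E₁ (constant-snoc (↑ (∧E₁ h0)))))
                  (sum≡0-≤ (≤-trans ≤-suc <-snoc) (↑ (∧E₂ h0)))))
            (≤-trans (≤-reflexive (↑ (∧E₂ (constant-snoc (↑ (∧E₁ h0)))))) 0≤))
        (∧I (↓ (tree-introʳ (↑ (∧E₁ (constant-snoc (↑ (∧E₁ h0)))))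
                  (sum≡0-≤ (≤-trans ≤-suc <-snoc) (↑ (∧E₂ h0)))))
            (≤-reflexive (↑ (∧E₂ (constant-snoc (↑ (∧E₁ h0)))))))))))

  sum-st≡0 : {f : Tm Γ 𝟏} {n : Tm Γ nat} → Δ ⊩ allˢᵗ nat (wkᵗ f · v0 ≐₀ num0) → Δ ⊩ st n →
             Δ ⊩ sum · f · n ≅ num0
  sum-st≡0 {f = f} {n} d sn = ↑ (use closed (ε ▸ f ▸ n) ∙ d ∙ sn)
    where
    closed : [] ⊩ allˢᵗ nat (v2 · v0 ≐₀ num0) ⊃ st {Γ = nat ∷ 𝟏 ∷ []} v0 ⊃ sum · v1 · v0 ≐₀ num0
    closed = ⊃I (⊃I (allE (st-induction (sum · v2 · v0 ≐₀ num0)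
      (↓ (sum-zero _))
      (allI (⊃I (⊃I (↓ (sum-suc _ _ ⨾ plus-0-0 (↑ h0) (↑ (allE h3 v0 ∙ h1)))))))) v0 ∙ h0))

  treeˢ : {f₀ f₁ : Tm Γ 𝟏} → Δ ⊩ st f₀ → Δ ⊩ st f₁ → Δ ⊩ st (tree · f₀ · f₁)
  treeˢ d e = st-name ·ˢ d ·ˢ e

  constˢ : {b : Tm Γ nat} → Δ ⊩ st b → Δ ⊩ st (const b)
  constˢ d = st-con ·ˢ d

  tree-contains-zeros : {f₀ f₁ : Tm Γ 𝟏} {n : Tm Γ nat} → Δ ⊩ allˢᵗ nat (wkᵗ f₀ · v0 ≐₀ num0) →
    Δ ⊩ st n → Δ ⊩ const num0 ‾ n ∈⁺ (tree · f₀ · f₁)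
  tree-contains-zeros d sn =
    ↓ (tree-introˡ (constant-intro rfl) (sum-st≡0 d (initialˢ (constˢ zeroˢ) sn)))

  tree-contains-ones : {f₀ f₁ : Tm Γ 𝟏} {n : Tm Γ nat} → Δ ⊩ allˢᵗ nat (wkᵗ f₁ · v0 ≐₀ num0) →
    Δ ⊩ st n → Δ ⊩ const num1 ‾ n ∈⁺ (tree · f₀ · f₁)
  tree-contains-ones d sn =
    ↓ (tree-introʳ (constant-intro rfl) (sum-st≡0 d (initialˢ (constˢ (sucˢ zeroˢ)) sn)))

  WKL*→TRANS : WKL*⁺ ∷ [] ⊩ Π⁰₁-TRANS
  WKL*→TRANS = allI (⊃I (⊃I (allI
    -- Both branches are controlled by `f`, so it does not matter which of them the path follows.
    (exE (allE (# 2) (tree · v1 · v1) ∙ treeˢ (# 1) (# 1) ∙ tree-binary v1 v1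
           ∙ allI (⊃I (exI (const num0) (∧I (constˢ zeroˢ) (tree-contains-zeros (# 1) h0)))))
      -- The segment of length `S′ v1` has a code above the arbitrary number `v1`, so the vanishing
      -- sum includes the value of `f` there.
      (let vanishes : {Δ : Hyps (𝟏 ∷ nat ∷ 𝟏 ∷ [])} → Δ ⊩ sum · v2 · (initial⁺ · v0 · S′ v1) ≐₀ num0 →
             Δ ⊩ v2 · v1 ≐₀ num0
           vanishes d = ↓ (sum≡0-< (≤-initial v0 (S′ v1)) (↑ d))
       in tree-elim {s = initial⁺ · v0 · S′ v1} (↑ (allE (∧E₂ h0) (S′ v1)))
            (vanishes (∧E₂ h0)) (vanishes (∧E₂ h0)))))))

  -- Grilliot's trick

  PathAt : Tm Γ 𝟏 → Tm Γ 𝟏 → Fm Γ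
  PathAt α T = allˢᵗ nat (wkᵗ α ‾ v0 ∈⁺ wkᵗ T)

  pathAt : {α T : Tm Γ 𝟏} {n : Tm Γ nat} → Δ ⊩ PathAt α T → Δ ⊩ st n →
           Δ ⊩ T · (initial⁺ · α · n) ≅ num0
  pathAt {α = α} {T} {n} d sn = ↑ (use closed (ε ▸ α ▸ T ▸ n) ∙ d ∙ sn)
    where
    closed : [] ⊩ PathAt v2 v1 ⊃ st {Γ = nat ∷ 𝟏 ∷ 𝟏 ∷ []} v0 ⊃ v2 ‾ v0 ∈⁺ v1
    closed = ⊃I (⊃I (allE h1 v0 ∙ h0))

  path-suc : {f₀ f₁ α : Tm Γ 𝟏} {k : Tm Γ nat} → Δ ⊩ PathAt α (tree · f₀ · f₁) → Δ ⊩ st k →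
             Δ ⊩ α · S′ k ≅ α · k
  path-suc {α = α} {k} d sk = ↑ (tree-elim (pathAt d (sucˢ (sucˢ sk))) same same)
    where
    same : ∀ {Δ b A} → isConstant · b · (initial⁺ · α · S′ (S′ k)) ≐₀ num0 ∧ A ∷ Δ ⊩ α · S′ k ≐₀ α · k
    same {b = b} = ↓ (↑ (∧E₂ last) ⨾ ↑ (∧E₂ butLast) ⁻¹)
      where
      last = constant-snoc {b = b} (rfl ⊛ (initial-suc α (S′ k) ⁻¹) ⨾ ↑ (∧E₁ h0))
      butLast = constant-snoc {b = b} (rfl ⊛ (initial-suc α k ⁻¹) ⨾ ↑ (∧E₁ last))

  path-constant : {f₀ f₁ α : Tm Γ 𝟏} {k : Tm Γ nat} → Δ ⊩ PathAt α (tree · f₀ · f₁) → Δ ⊩ st k →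
                  Δ ⊩ α · k ≅ α · num0
  path-constant {f₀ = f₀} {f₁} {α} {k} d sk = ↑ (use closed (ε ▸ f₀ ▸ f₁ ▸ α ▸ k) ∙ d ∙ sk)
    where
    closed : [] ⊩ PathAt v1 (tree · v3 · v2) ⊃ st {Γ = nat ∷ 𝟏 ∷ 𝟏 ∷ 𝟏 ∷ []} v0
      ⊃ v1 · v0 ≐₀ v1 · num0
    closed = ⊃I (⊃I (allE (st-induction (v2 · v0 ≐₀ v2 · num0) (↓ rfl)
      (allI (⊃I (⊃I (↓ (path-suc {f₀ = v4} {v3} (# 3) (# 1) ⨾ ↑ h0)))))) v0 ∙ h0))

  -- The segment of length `S′ k` lies on one of the branches. This fixes the constant value of the
  -- path, and the vanishing sum reaches beyond `k`.
  path-value : {f₀ f₁ α : Tm Γ 𝟏} {k : Tm Γ nat} → Δ ⊩ PathAt α (tree · f₀ · f₁) → Δ ⊩ st k →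
    α · num0 ≐₀ num0 ∧ f₀ · k ≐₀ num0 ∷ Δ ⊩ C → α · num0 ≐₀ num1 ∧ f₁ · k ≐₀ num0 ∷ Δ ⊩ C → Δ ⊩ C
  path-value {Δ = Δ} {f₀ = f₀} {f₁} {α} {k} d sk c₀ c₁ =
    tree-elim (pathAt d (sucˢ sk))
      (w (⊃I c₀) ∙ case f₀) (w (⊃I c₁) ∙ case f₁)
    where
    case : ∀ {b} f → isConstant · b · (initial⁺ · α · S′ k) ≐₀ num0
                     ∧ sum · f · (initial⁺ · α · S′ k) ≐₀ num0 ∷ Δ ⊩ α · num0 ≐₀ b ∧ f · k ≐₀ num0
    case {b} f = ∧I
      (↓ (w≅ (path-constant d sk) ⁻¹
        ⨾ ↑ (∧E₂ (constant-snoc {b = b} (rfl ⊛ (initial-suc α k ⁻¹) ⨾ ↑ (∧E₁ h0))))))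
      (↓ (sum≡0-< (≤-initial α (S′ k)) (↑ (∧E₂ h0))))

  -- Both constant branches are infinite if g has no zero; otherwise only the
  -- one with entries different from i is.
  family : Tm Γ nat → Tm Γ 𝟏 → Tm Γ 𝟏
  family i g = tree · (branch₀ · i · g) · (branch₁ · i · g)

  familyˢ : {i : Tm Γ nat} {g : Tm Γ 𝟏} → Δ ⊩ st i → Δ ⊩ st g → Δ ⊩ st (family i g)
  familyˢ d e = treeˢ (st-name ·ˢ d ·ˢ e) (st-name ·ˢ d ·ˢ e)

  module _ {i : Tm Γ nat} {g : Tm Γ 𝟏} {n : Tm Γ nat} where

    branch₀-zero : Δ ⊩ i ≅ num0 → Δ ⊩ branch₀ · i · g · n ≅ not (g · n)
    branch₀-zero e = δ₃ branch₀Body (unfold branch₀ᴺ) i g n ⨾ ite-zero e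

    branch₀-one : Δ ⊩ i ≅ num1 → Δ ⊩ branch₀ · i · g · n ≅ num0
    branch₀-one e = δ₃ branch₀Body (unfold branch₀ᴺ) i g n ⨾ ite-suc e

    branch₁-zero : Δ ⊩ i ≅ num0 → Δ ⊩ branch₁ · i · g · n ≅ num0
    branch₁-zero e = δ₃ branch₁Body (unfold branch₁ᴺ) i g n ⨾ ite-zero e

    branch₁-one : Δ ⊩ i ≅ num1 → Δ ⊩ branch₁ · i · g · n ≅ not (g · n)
    branch₁-one e = δ₃ branch₁Body (unfold branch₁ᴺ) i g n ⨾ ite-suc e

    branches-vanish : Δ ⊩ i ≤ᶠ num1 → Δ ⊩ ¬ᶠ (g · n ≐₀ num0) →
                      Δ ⊩ branch₀ · i · g · n ≐₀ num0 ∧ branch₁ · i · g · n ≐₀ num0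
    branches-vanish d e = ≤1-cases d
      (∧I (↓ (branch₀-zero (↑ h0) ⨾ not-suc (nonzero (w e)))) (↓ (branch₁-zero (↑ h0))))
      (∧I (↓ (branch₀-one (↑ h0))) (↓ (branch₁-one (↑ h0) ⨾ not-suc (nonzero (w e)))))

  -- The witnesses come from the constant branch with entries different from `i`, which is never cut
  -- off.
  family-infinite : {i : Tm Γ nat} {g : Tm Γ 𝟏} → Δ ⊩ i ≤ᶠ num1 → Δ ⊩ InfiniteAt (family i g)
  family-infinite {i = i} {g} d = use closed (ε ▸ i ▸ g) ∙ d
    where
    closed : [] ⊩ v1 ≤ᶠ num1 ⊃ InfiniteAt {𝟏 ∷ nat ∷ []} (family v1 v0)
    closed = ⊃I (≤1-cases h0
      (allI (⊃I (exI (const num1) (∧I (constˢ (sucˢ zeroˢ))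
        (tree-contains-ones (allI (⊃I (↓ (branch₁-zero {i = v3} {v2} {v0} (↑ (# 2)))))) h0)))))
      (allI (⊃I (exI (const num0) (∧I (constˢ zeroˢ)
        (tree-contains-zeros (allI (⊃I (↓ (branch₀-one {i = v3} {v2} {v0} (↑ (# 2)))))) h0))))))

  zero-detected : {i x : Tm Γ nat} {g α : Tm Γ 𝟏} → Δ ⊩ PathAt α (family i g) → Δ ⊩ st x →
                  Δ ⊩ g · x ≅ num0 → Δ ⊩ α · num0 ≅ i → Δ ⊩ ⊥ᶠ
  zero-detected {i = i} {x} {g} d sx e e′ = path-value d sx
    (suc≢0 (w≅ (not-zero e) ⁻¹ ⨾ branch₀-zero (w≅ e′ ⁻¹ ⨾ ↑ (∧E₁ h0)) ⁻¹ ⨾ ↑ (∧E₂ h0)))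
    (suc≢0 (w≅ (not-zero e) ⁻¹ ⨾ branch₁-one (w≅ e′ ⁻¹ ⨾ ↑ (∧E₁ h0)) ⁻¹ ⨾ ↑ (∧E₂ h0)))

  fullTree : Tm Γ 𝟏
  fullTree = tree · const num0 · const num0

  -- Without standard zeros of `g`, the sequences that cut off the branches vanish at standard
  -- arguments, and so do their sums up to a standard code.
  family≈full : {i s : Tm Γ nat} {g : Tm Γ 𝟏} → Δ ⊩ i ≤ᶠ num1 →
    Δ ⊩ ¬ᶠ exˢᵗ nat (wkᵗ g · v0 ≐₀ num0) → Δ ⊩ st s → Δ ⊩ family i g · s ≅ fullTree · s
  family≈full {i = i} {s} {g} d e ss = ↑ (use closed (ε ▸ i ▸ g ▸ s) ∙ d ∙ e ∙ ss)
    where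
    vanish : {Δ : Hyps (nat ∷ nat ∷ 𝟏 ∷ nat ∷ [])} → Δ ⊩ v3 ≤ᶠ num1 →
             Δ ⊩ ¬ᶠ exˢᵗ nat (v3 · v0 ≐₀ num0) → Δ ⊩ st v0 →
             Δ ⊩ branch₀ · v3 · v2 · v0 ≐₀ num0 ∧ branch₁ · v3 · v2 · v0 ≐₀ num0
    vanish d e sn = branches-vanish d (⊃I (w e ∙ exI v0 (∧I (w sn) h0)))

    closed : [] ⊩ v2 ≤ᶠ num1 ⊃ ¬ᶠ exˢᵗ nat (v2 · v0 ≐₀ num0) ⊃ st {Γ = nat ∷ 𝟏 ∷ nat ∷ []} v0
      ⊃ family v2 v1 · v0 ≐₀ fullTree · v0
    closed = ⊃I (⊃I (⊃I (↓ (tree-eq _ _ _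
      ⨾ rfl ⊛ (rfl ⊞ (sum-st≡0 (allI (⊃I (∧E₁ (vanish (# 3) (# 2) h0)))) h0 ⨾ zeroSum))
            ⊛ rfl
            ⊛ (rfl ⊛ (rfl ⊞ (sum-st≡0 (allI (⊃I (∧E₂ (vanish (# 3) (# 2) h0)))) h0 ⨾ zeroSum)) ⊛ rfl ⊛ rfl)
      ⨾ tree-eq _ _ _ ⁻¹))))
      where
      zeroSum = sum-st≡0 (allI (⊃I (↓ (const-eq _ _)))) h0 ⁻¹

  treeAt : {T : Tm Γ 𝟏} → Δ ⊩ BinaryTree⁺ T → Δ ⊩ TreeAt T
  treeAt {T = T} d = use closed (ε ▸ T) ∙ d
    where
    closed : [] ⊩ BinaryTree⁺ {Γ = 𝟏 ∷ []} v0 ⊃ TreeAt v0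
    closed = ⊃I (∧I (allI (⊃I (allE (∧E₁ (# 1)) v0)))
      (allI (⊃I (allI (⊃I (allE (allE (∧E₂ (# 2)) v1) v0))))))

  UWKLAt ExtensionalAt : Tm Γ (𝟏 ⇒ 𝟏) → Fm Γ
  UWKLAt Φ = allˢᵗ 𝟏 (TreeAt v0 ⊃ InfiniteAt v0 ⊃ PathAt (wkᵗ Φ · v0) v0)
  ExtensionalAt Φ = allˢᵗ 𝟏 (allˢᵗ 𝟏 (v1 ≈ v0 ⊃ wkᵗ (wkᵗ Φ) · v1 ≈ wkᵗ (wkᵗ Φ) · v0))

  uwkl-path : {Φ : Tm Γ (𝟏 ⇒ 𝟏)} {T : Tm Γ 𝟏} → Δ ⊩ UWKLAt Φ → Δ ⊩ st T → Δ ⊩ BinaryTree⁺ T →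
              Δ ⊩ InfiniteAt T → Δ ⊩ PathAt (Φ · T) T
  uwkl-path {Φ = Φ} {T} d sT bT iT = use closed (ε ▸ Φ ▸ T) ∙ d ∙ sT ∙ treeAt bT ∙ iT
    where
    closed : [] ⊩ UWKLAt v1 ⊃ st {Γ = 𝟏 ∷ (𝟏 ⇒ 𝟏) ∷ []} v0 ⊃ TreeAt v0 ⊃ InfiniteAt v0 ⊃ PathAt (v1 · v0) v0
    closed = ⊃I (⊃I (⊃I (⊃I (allE h3 v0 ∙ h2 ∙ h1 ∙ h0))))

  private
    detectorBody : Tm (𝟏 ∷ nat ∷ (𝟏 ⇒ 𝟏) ∷ []) nat
    detectorBody = not (dist (v2 · family v1 v0 · num0) v1)

  -- The functional sought in `∃²`: it is zero when the answer of `Φ` on the tree for `g` differs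
  -- from `i`.
  detector : Tm Γ (𝟏 ⇒ 𝟏) → Tm Γ nat → Tm Γ 𝟐
  detector Φ i = subᵗ (ε ▸ Φ ▸ i) (lam detectorBody)

  detector-eq : (Φ : Tm Γ (𝟏 ⇒ 𝟏)) (i : Tm Γ nat) (g : Tm Γ 𝟏) →
                Δ ⊩ detector Φ i · g ≅ not (dist (Φ · family i g · num0) i)
  detector-eq Φ i g = β₁ (ε ▸ Φ ▸ i) detectorBody g

  fullTree-infinite : Δ ⊩ InfiniteAt {Γ} fullTree
  fullTree-infinite = use closed ε
    where
    closed : [] ⊩ InfiniteAt {[]} fullTree
    closed = allI (⊃I (exI (const num0) (∧I (constˢ zeroˢ)
      (tree-contains-zeros (allI (⊃I (↓ (const-eq _ _)))) h0))))

  fullTreeˢ : Δ ⊩ st {Γ = Γ} fullTree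
  fullTreeˢ = treeˢ (constˢ zeroˢ) (constˢ zeroˢ)

  root≤1 : {Φ : Tm Γ (𝟏 ⇒ 𝟏)} → Δ ⊩ UWKLAt Φ → Δ ⊩ st Φ → Δ ⊩ Φ · fullTree · num0 ≤ᶠ num1
  root≤1 d sΦ = ∧E₂ (tree-initial-suc (treeAt (tree-binary _ _)) (sΦ ·ˢ fullTreeˢ) zeroˢ
    (pathAt (uwkl-path d fullTreeˢ (tree-binary _ _) fullTree-infinite) (sucˢ zeroˢ)))

  E-UWKL→∃² : E-UWKLˢᵗ⁺ ∷ [] ⊩ ∃² ˢᵗ
  E-UWKL→∃² = exE h0 (use detects (ε ▸ v0 ▸ v0 · fullTree · num0)
      ∙ ∧E₁ (∧E₂ h0) ∙ ∧E₂ (∧E₂ h0) ∙ ∧E₁ h0 ∙ (∧E₁ h0 ·ˢ fullTreeˢ ·ˢ zeroˢ) ∙ ↓ rfl)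
    where
    -- The entry `i` is a variable tied to its value by an equation; it is instantiated only when
    -- `detects` is used.
    detects : [] ⊩ UWKLAt v1 ⊃ ExtensionalAt v1 ⊃ st {Γ = nat ∷ (𝟏 ⇒ 𝟏) ∷ []} v1 ⊃ st v0
      ⊃ v0 ≐₀ v1 · fullTree · num0 ⊃ exˢᵗ 𝟐 (∃²At v0)
    detects = ⊃I (⊃I (⊃I (⊃I (⊃I (exI (detector v1 v0)
      (∧I (st-term (ε ▸ v1 ▸ v0) (noVars ▹ # 2 ▹ # 1) (lam detectorBody))
        (allI (⊃I (∧I
          (⊃I (exE h0 (↓ (detector-eq v3 v2 v1 ⨾ not-suc (nonzero (⊃I
            (zero-detected {i = v2} {v0} {v1} (uwkl-path (# 8) (familyˢ (# 5) (# 3)) (tree-binary _ _)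
                (family-infinite (≤-trans (≤-reflexive (↑ (# 4))) (root≤1 (# 8) (# 6)))))
              (∧E₁ (# 1)) (↑ (∧E₂ (# 1))) (dist≡0 (↑ h0)))))))))
          -- If `g` had no standard zero, the tree for `g` would agree with the full tree at
          -- standard arguments, and extensionality would make the answer `i`.
          (⊃I (raa (not≡0 (detector-eq v2 v1 v0 ⁻¹ ⨾ ↑ (# 1)) ∙ ↓ (dist-refl
            (↑ (allE (allE (allE (# 6) (family v1 v0) ∙ familyˢ (# 4) (# 2)) fullTree ∙ fullTreeˢ
                ∙ allI (⊃I (↓ (family≈full (≤-trans (≤-reflexive (↑ (# 4))) (root≤1 (# 8) (# 6))) (# 1) (# 0)))))
                num0 ∙ zeroˢ)
              ⨾ ↑ (# 3) ⁻¹))))))))))))))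

  -- Transfer and (∃²)

  Transfer : Fm Γ
  Transfer = allˢᵗ 𝟏 (allˢᵗ nat (v1 · v0 ≐₀ num0) ⊃ all nat (v1 · v0 ≐₀ num0))

  transfer : {f : Tm Γ 𝟏} (n : Tm Γ nat) → Δ ⊩ Transfer → Δ ⊩ st f →
             Δ ⊩ allˢᵗ nat (wkᵗ f · v0 ≐₀ num0) → Δ ⊩ f · n ≅ num0
  transfer {f = f} n d sf e = ↑ (use closed (ε ▸ f ▸ n) ∙ d ∙ sf ∙ e)
    where
    closed : [] ⊩ Transfer ⊃ st {Γ = nat ∷ 𝟏 ∷ []} v1 ⊃ allˢᵗ nat (v2 · v0 ≐₀ num0) ⊃ v1 · v0 ≐₀ num0
    closed = ⊃I (⊃I (⊃I (allE (allE h2 v1 ∙ h1 ∙ h0) v0)))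

  complement : Tm Γ 𝟏 → Tm Γ 𝟏
  complement f = subᵗ (ε ▸ f) (lam (not (v1 · v0)))

  complement-eq : (f : Tm Γ 𝟏) (n : Tm Γ nat) → Δ ⊩ complement f · n ≅ not (f · n)
  complement-eq f n = β₁ (ε ▸ f) (not (v1 · v0)) n

  complementˢ : {f : Tm Γ 𝟏} → Δ ⊩ st f → Δ ⊩ st (complement f)
  complementˢ {f = f} d = st-term (ε ▸ f) (noVars ▹ d) (lam (not (v1 · v0)))

  Ξ : Tm Γ 𝟐
  Ξ = sym (inj₁ exists²)

  private
    sgBody : Tm (𝟏 ∷ 𝟐 ∷ []) nat
    sgBody = sg (v1 · v0)

    -- The axiom for `Ξ` speaks of functionals satisfying `∃²-spec` relative to the standard
    -- objects, which bounds the values by 1.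
    normalised : Tm Γ 𝟐 → Tm Γ 𝟐
    normalised φ = subᵗ (ε ▸ φ) (lam sgBody)

    normalised-eq : (φ : Tm Γ 𝟐) (g : Tm Γ 𝟏) → Δ ⊩ normalised φ · g ≅ sg (φ · g)
    normalised-eq φ g = β₁ (ε ▸ φ) sgBody g

    Ξ-axiom : [] ⊩ st {Γ = []} Ξ ∧ allˢᵗ 𝟐 (∃²-spec ˢᵗ ⊃ Ξ ≈ v0)
    Ξ-axiom = axiom (axiom (Defs.constant exists²))

    Ξ-agrees : [] ⊩ st {Γ = 𝟏 ∷ 𝟐 ∷ []} v1 ⊃ ∃²At v1 ⊃ st v0 ⊃ Ξ · v0 ≐₀ sg (v1 · v0)
    Ξ-agrees = ⊃I (⊃I (⊃I (↓
      (↑ (allE (allE (∧E₂ (use Ξ-axiom ε)) (normalised v1)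
            ∙ st-term (ε ▸ v1) (noVars ▹ # 2) (lam sgBody)
            ∙ ∧I (allI (⊃I (∧I
                   (⊃I (exE h0 (↓ (normalised-eq v3 v1
                     ⨾ ite-zero (∃²-intro (# 4) (# 2) (∧E₁ h0) (↑ (∧E₂ h0)))))))
                   (⊃I (∃²-elim (# 3) (# 1) (sg≡0 (normalised-eq v2 v0 ⁻¹ ⨾ ↑ h0)))))))
                 (allI (⊃I (≤-trans (≤-reflexive (normalised-eq v2 v0)) sg≤1))))
          v0 ∙ # 0) ⨾ normalised-eq v1 v0))))

    Ξ-decides : [] ⊩ st {Γ = 𝟐 ∷ []} v0 ⊃ ∃²At v0 ⊃ ∃²At Ξ
    Ξ-decides = ⊃I (⊃I (allI (⊃I (∧I
      (⊃I (exE h0 (↓ (agrees (# 4) (# 3) (# 2)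
        ⨾ ite-zero (∃²-intro (# 3) (# 2) (∧E₁ h0) (↑ (∧E₂ h0)))))))
      (⊃I (∃²-elim (# 2) (# 1) (sg≡0 (agrees (# 3) (# 2) (# 1) ⁻¹ ⨾ ↑ h0))))))))
      where
      agrees : {φ : Tm Γ 𝟐} {g : Tm Γ 𝟏} → Δ ⊩ st φ → Δ ⊩ ∃²At φ → Δ ⊩ st g →
               Δ ⊩ Ξ · g ≅ sg (φ · g)
      agrees {φ = φ} {g} sφ d sg′ = ↑ (use Ξ-agrees (ε ▸ φ ▸ g) ∙ sφ ∙ d ∙ sg′)

    tail : Tm Γ 𝟏 → Tm Γ 𝟏
    tail h = subᵗ (ε ▸ h) (lam (v1 · S′ v0))

    tail-eq : (h : Tm Γ 𝟏) (n : Tm Γ nat) → Δ ⊩ tail h · n ≅ h · S′ n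
    tail-eq h n = β₁ (ε ▸ h) (v1 · S′ v0) n

    consBody : Tm (nat ∷ 𝟏 ∷ nat ∷ []) nat
    consBody = con R₀ · v0 · v2 · lam (lam (v3 · v0))

    cons : Tm Γ nat → Tm Γ 𝟏 → Tm Γ 𝟏
    cons x g = subᵗ (ε ▸ x ▸ g) (lam consBody)

    cons-zero : (x : Tm Γ nat) (g : Tm Γ 𝟏) → Δ ⊩ cons x g · num0 ≅ x
    cons-zero x g = β₁ (ε ▸ x ▸ g) consBody num0 ⨾ recZero _ _

    cons-suc : (x : Tm Γ nat) (g : Tm Γ 𝟏) (n : Tm Γ nat) → Δ ⊩ cons x g · S′ n ≅ g · n
    cons-suc x g n = β₁ (ε ▸ x ▸ g) consBody (S′ n) ⨾ recSucβ (ε ▸ x ▸ g) (v2 · v0) _ _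

    -- PF-TP∀ concerns a single variable, so g and x are merged into one sequence.
    Detects : Fm (𝟏 ∷ Γ)
    Detects = v0 · S′ (v0 · num0) ≐₀ num0 ⊃ Ξ · tail v0 ≐₀ num0

    -- `Ξ` is a constant and not a parameter, so `PF-TP∀` applies to `Detects`. For a standard
    -- sequence, its first entry is a standard number and `∃²-intro` is available.
    Ξ-detects : [] ⊩ ∃²At {Γ = []} Ξ ⊃ all 𝟏 Detects
    Ξ-detects = ⊃I (axiom (axiom (PF-TP∀ (expand Detects) _))
      ∙ allI (⊃I (⊃I (↓ (∃²-intro {x = v0 · num0} (# 2)
          (st-term (ε ▸ v0) (noVars ▹ # 1) (lam (v1 · S′ v0))) (# 1 ·ˢ zeroˢ)
          (tail-eq v0 (v0 · num0) ⨾ ↑ h0))))))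

    Ξ-detects-all : [] ⊩ all 𝟏 Detects ⊃ v1 · v0 ≐₀ num0 ⊃ Ξ {nat ∷ 𝟏 ∷ []} · v1 ≐₀ num0
    Ξ-detects-all = ⊃I (⊃I (↓ (rfl ⊛ (tail-cons ⁻¹)
      ⨾ ↑ (allE (# 1) (cons v0 v1) ∙ ↓ (rfl ⊛ S-cong (cons-zero v0 v1) ⨾ cons-suc v0 v1 v0 ⨾ ↑ h0)))))
      where
      tail-cons : {Δ : Hyps (nat ∷ 𝟏 ∷ [])} → Δ ⊩ tail (cons v0 v1) ≅ v1
      tail-cons = equation (allI (↓ (tail-eq (cons v1 v2) v0 ⨾ cons-suc v1 v2 v0)))

  ∃²→TRANS : ∃² ˢᵗ ∷ [] ⊩ Π⁰₁-TRANS
  ∃²→TRANS = exE h0 (⊃I (⊃I (allI (⊃I (⊃I (allI (raa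
      -- A number at which `f` is not zero is a zero of the complement; `Ξ` detects it and yields a
      -- standard one, against the assumption on `f`.
      (exE (∃²-elim {φ = Ξ} (# 4) (complementˢ (# 2))
              (↑ (use Ξ-detects-all (ε ▸ complement v1 ▸ v0) ∙ # 3
                 ∙ ↓ (complement-eq v1 v0 ⨾ not-suc (nonzero h0)))))
        (not≡0 (complement-eq v2 v0 ⁻¹ ⨾ ↑ (∧E₂ h0)) ∙ (allE (# 2) v0 ∙ ∧E₁ h0)))))))))
    ∙ Ξ∃² ∙ (use Ξ-detects ε ∙ Ξ∃²))
    where
    Ξ∃² : {Δ : Hyps (𝟐 ∷ [])} → st v0 ∧ ∃²At v0 ∷ Δ ⊩ ∃²At Ξ
    Ξ∃² = use Ξ-decides (ε ▸ v0) ∙ ∧E₁ h0 ∙ ∧E₂ h0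

  private
    -- The implication makes the choice total, and the unrelativised quantifier keeps the formula
    -- internal, as `HAC-int` requires.
    ZeroIfAny : Fm (nat ∷ 𝟏 ∷ Γ)
    ZeroIfAny = ex nat (v2 · v0 ≐₀ num0) ⊃ v1 · v0 ≐₀ num0

    candidatesBody : Tm (nat ∷ 𝟏 ∷ (𝟏 ⇒ nat *) ∷ []) nat
    candidatesBody = v1 · (con (at nat) · (v2 · v1) · v0)

    selectorBody : Tm (𝟏 ∷ (𝟏 ⇒ nat *) ∷ []) nat
    selectorBody =
      v0 · (con (at nat) · (v1 · v0) · (search · lam candidatesBody · (con (len nat) · (v1 · v0))))

    module _ (Φ : Tm Γ (𝟏 ⇒ nat *)) where

      candidates : Tm Γ 𝟏 → Tm Γ 𝟏
      candidates g = subᵗ (ε ▸ Φ ▸ g) (lam candidatesBody)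

      candidates-eq : (g : Tm Γ 𝟏) (i : Tm Γ nat) →
                      Δ ⊩ candidates g · i ≅ g · (con (at nat) · (Φ · g) · i)
      candidates-eq g i = β₁ (ε ▸ Φ ▸ g) candidatesBody i

      chosen : Tm Γ 𝟏 → Tm Γ nat
      chosen g = con (at nat) · (Φ · g) · (search · candidates g · (con (len nat) · (Φ · g)))

      -- The value is that of `g` at the entry found, so a zero value certifies a zero of `g`
      -- whatever the search returns.
      selector : Tm Γ 𝟐
      selector = subᵗ (ε ▸ Φ) (lam selectorBody)

      selector-eq : (g : Tm Γ 𝟏) → Δ ⊩ selector · g ≅ g · chosen g
      selector-eq g = β₁ (ε ▸ Φ) selectorBody g

  TRANS→∃² : Π⁰₁-TRANS ∷ [] ⊩ ∃² ˢᵗ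
  TRANS→∃² = exE (use choice ε ∙ witnesses)
    (exI (selector v0) (∧I (st-term (ε ▸ v0) (noVars ▹ ∧E₁ h0) (lam selectorBody))
      (allI (⊃I (∧I
        (⊃I (exE h0 (exE (allE (∧E₂ (# 3)) v1 ∙ # 2)
          (exE (member v0 (v3 · v2) ∙ ∧E₁ h0)
            (↓ (selector-eq v4 v3 ⨾ candidates-eq v4 v3 _ ⁻¹
              ⨾ search-finds (∧E₁ h0) (candidates-eq v4 v3 v0
                  ⨾ rfl ⊛ ↑ (∧E₂ h0)
                  ⨾ ↑ (∧E₂ (# 1) ∙ exI v2 (∧E₂ (# 2))))))))))
        (⊃I (exI (chosen v1 v0) (∧I
          (st-con ·ˢ (∧E₁ (# 2) ·ˢ # 1)
            ·ˢ (st-name ·ˢ st-term (ε ▸ v1 ▸ v0) (noVars ▹ ∧E₁ (# 2) ▹ # 1) (lam candidatesBody)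
                 ·ˢ (st-con ·ˢ (∧E₁ (# 2) ·ˢ # 1))))
          (↓ (selector-eq v1 v0 ⁻¹ ⨾ ↑ h0))))))))))
    where
    choice : [] ⊩ allˢᵗ 𝟏 (exˢᵗ nat ZeroIfAny)
      ⊃ exˢᵗ {Γ = []} (𝟏 ⇒ nat *) (allˢᵗ 𝟏 (ex nat (v0 ∈ˢ v2 · v1 ∧ ZeroIfAny)))
    choice = axiom (axiom (HAC-int (expand ZeroIfAny) _))

    member : (t : Tm Γ nat) (s : Tm Γ (nat *)) {Δ : Hyps Γ} → Δ ⊩ t ∈ˢ s
      ⊃ ex nat (v0 <ᶠ con (len nat) · wkᵗ s ∧ con (at nat) · wkᵗ s · v0 ≐₀ wkᵗ t)
    member t s = ∧E₁ (fromBase (bounded∃ _ _))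

    -- If no standard number served, `g` would have no standard zero; its complement would vanish at
    -- standard numbers, hence everywhere by transfer. Then `g` has no zero at all, and 0 serves
    -- vacuously.
    witnesses : Π⁰₁-TRANS ∷ [] ⊩ allˢᵗ 𝟏 (exˢᵗ nat ZeroIfAny)
    witnesses = allI (⊃I (raa (# 0 ∙ exI num0 (∧I zeroˢ (⊃I (exE h0 (exFalso
      (suc≢0 (not-zero (↑ h0) ⁻¹ ⨾ complement-eq v1 v0 ⁻¹
        ⨾ transfer v0 (# 4) (complementˢ (# 3)) (allI (⊃I (↓ (complement-eq v2 v0
            ⨾ not-suc (nonzero (⊃I (# 4 ∙ exI v0 (∧I (# 1) (⊃I (# 1)))))))))))))))))))

  -- Tree principles from transfer, and the equivalences

  ∃²→UWKL : ∃² ˢᵗ ∷ [] ⊩ exˢᵗ (𝟏 ⇒ 𝟏) (UWKLAt v0)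
  ∃²→UWKL = exE h0 (exE (someMortality {φ = v0} (∧E₂ h0) (∧E₁ h0))
    (exI (path · v0) (∧I (st-name ·ˢ ∧E₁ h0)
      (allI (⊃I (⊃I (⊃I (path-in-tree (allE (∧E₂ (# 3)) v0 ∙ # 2 ∙ # 1) (# 1) (# 0) (∧E₁ (# 3)) (# 2)))))))))

  private
    distance : Tm Γ 𝟏 → Tm Γ 𝟏 → Tm Γ 𝟏
    distance f g = subᵗ (ε ▸ f ▸ g) (lam (dist (v2 · v0) (v1 · v0)))

    distance-eq : (f g : Tm Γ 𝟏) (n : Tm Γ nat) → Δ ⊩ distance f g · n ≅ dist (f · n) (g · n)
    distance-eq f g n = β₁ (ε ▸ f ▸ g) (dist (v2 · v0) (v1 · v0)) n

    -- `WKL*` asks for membership at all lengths. As a single standard sequence, membership can be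
    -- transferred from the standard lengths.
    membership : Tm Γ 𝟏 → Tm Γ 𝟏 → Tm Γ 𝟏
    membership T α = subᵗ (ε ▸ T ▸ α) (lam (v2 · (initial⁺ · v1 · v0)))

    membership-eq : (T α : Tm Γ 𝟏) (n : Tm Γ nat) → Δ ⊩ membership T α · n ≅ T · (initial⁺ · α · n)
    membership-eq T α n = β₁ (ε ▸ T ▸ α) (v2 · (initial⁺ · v1 · v0)) n

  -- Standard sequences which agree at all standard arguments are equal, so the
  -- axiom of extensionality gives standard extensionality.
  transfer-extensional : [] ⊩ Transfer ⊃ st {Γ = (𝟏 ⇒ 𝟏) ∷ []} v0 ⊃ ExtensionalAt v0
  transfer-extensional = ⊃I (⊃I (allI (⊃I (allI (⊃I (⊃I (allI (⊃I
    (↓ (rfl {t = v3} ⊛ equal ⊛ rfl {t = v0}))))))))))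
    where
    equal : st {Γ = nat ∷ 𝟏 ∷ 𝟏 ∷ (𝟏 ⇒ 𝟏) ∷ []} v0 ∷ allˢᵗ nat (v3 · v0 ≐₀ v2 · v0) ∷ st v1 ∷ st v2 ∷ st v3 ∷ Transfer ∷ []
            ⊩ v2 ≅ v1
    equal = equation (allI (↓ (dist≡0 (distance-eq v3 v2 v0 ⁻¹
      ⨾ transfer v0 (# 5) (st-term (ε ▸ v3 ▸ v2) (noVars ▹ # 3 ▹ # 2) (lam (dist (v2 · v0) (v1 · v0))))
          (allI (⊃I (↓ (distance-eq v4 v3 v0 ⨾ dist-refl (↑ (allE (# 2) v0 ∙ # 0))))))))))

  TRANS→WKL* : Π⁰₁-TRANS ∷ [] ⊩ WKL*⁺
  TRANS→WKL* = exE (weaken (λ ()) (⊃I ∃²→UWKL) ∙ TRANS→∃²)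
    (allI (⊃I (⊃I (⊃I (exI (v1 · v0) (∧I (∧E₁ (# 3) ·ˢ # 2)
      (allI (↓ (membership-eq v1 (v2 · v1) v0 ⁻¹
        ⨾ transfer v0 (# 4) (st-term (ε ▸ v1 ▸ v2 · v1) (noVars ▹ # 2 ▹ (∧E₁ (# 3) ·ˢ # 2))
              (lam (v2 · (initial⁺ · v1 · v0))))
            (allI (⊃I (↓ (membership-eq v2 (v3 · v2) v0
              ⨾ pathAt (uwkl-path (∧E₂ (# 4)) (# 3) (# 2) (# 1)) (# 0))))))))))))))

  TRANS→E-UWKL : Π⁰₁-TRANS ∷ [] ⊩ E-UWKLˢᵗ⁺
  TRANS→E-UWKL = exE (weaken (λ ()) (⊃I ∃²→UWKL) ∙ TRANS→∃²)
    (exI v0 (∧I (∧E₁ h0) (∧I (∧E₂ h0) (use transfer-extensional (ε ▸ v0) ∙ # 1 ∙ ∧E₁ h0))))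

  infixr 11 _⊃⨾_

  _⊃⨾_ : [] ⊩ A ⊃ B → [] ⊩ B ⊃ C → [] ⊩ A ⊃ C
  d ⊃⨾ e = ⊃I (w e ∙ (w d ∙ h0))

  equivalences : [] ⊩ (∃² ˢᵗ ⟺ Π⁰₁-TRANS) ∧ (Π⁰₁-TRANS ⟺ WKL*⁺) ∧ (WKL*⁺ ⟺ E-UWKLˢᵗ⁺)
  equivalences =
    ∧I (∧I (⊃I ∃²→TRANS) (⊃I TRANS→∃²))
    (∧I (∧I (⊃I TRANS→WKL*) (⊃I WKL*→TRANS))
      -- Both directions of the last equivalence pass through `Π⁰₁-TRANS`.
      (∧I (⊃I WKL*→TRANS ⊃⨾ ⊃I TRANS→E-UWKL)
          (⊃I E-UWKL→∃² ⊃⨾ ⊃I ∃²→TRANS ⊃⨾ ⊃I TRANS→WKL*)))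

theorem3p1 : (𝒮 : Specifications) →
    RCA₀Ω 𝒮 ⊢ (∃² ˢᵗ ⟺ Π⁰₁-TRANS) ∧ (Π⁰₁-TRANS ⟺ WKL*) ∧ (WKL* ⟺ E-UWKLˢᵗ)
-- The expansions of the marked formulas compute to the formulas of the theorem.
theorem3p1 𝒮 = Terms.conservative 𝒮 (Derivations.equivalences 𝒮)
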